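{- For every fixed rational $\alpha > 0$ we have $$n_{\alpha, m} = \left(\tfrac{1}{2} + o_{\alpha}(1)\right)\left(e^{2\alpha} - 1\right)m^2,$$ where $o_\alpha(1)$ denotes a quantity which, for fixed $\alpha$, tends to $0$ as the positive integer $m$ tends to infinity.
   Context: For a positive rational $\alpha$ and a positive integer $n$, an $\alpha$-partition of $n$ is a finite set $\{a_1, \ldots, a_r\}$ of distinct positive integers with $a_1 + \cdots + a_r = n$ and $\frac{1}{a_1} + \cdots + \frac{1}{a_r} = \alpha$. For a positive integer $m$, such a partition is called $m$-large if all its elements are larger than or equal to $m$. The quantity $n_{\alpha, m}$ is the smallest positive integer such that for every integer $n \ge n_{\alpha,m}$ an $m$-large $\alpha$-partition of $n$ exists (it is known, by a theorem of Graham, that $n_{\alpha,m}$ exists for every positive rational $\alpha$ and every positive integer $m$). -}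

module Defs where

open import Algebra.Definitions.RawSemiring using (_^_)
open import Data.Integer.Base as ℤ using (+_)
import Data.Integer.Properties as ℤ
open import Data.List.Base using (List; foldr)
open import Data.List.Relation.Unary.All using (All; reduce)
open import Data.List.Relation.Unary.Unique.Propositional using (Unique)
open import Data.Nat.Base as ℕ using (ℕ; zero; suc; _!)
open import Data.Nat.ListAction using (sum)
import Data.Nat.Properties as ℕ
open import Data.Product.Base using (∃; _×_; _,_; proj₁; proj₂)
open import Data.Rational.Base
open import Data.Rational.Properties
open import Data.Rational.Solver using (module +-*-Solver)
import Data.Rational.Unnormalised.Base as ℚᵘ
import Data.Rational.Unnormalised.Properties as ℚᵘ
open import Data.Sum.Base using (inj₁; inj₂)
open import Relation.Binary.PropositionalEquality

private
  module ≤R = ≤-Reasoning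

reciprocalSum : {as : List ℕ} → All ℕ.NonZero as → ℚ
reciprocalSum nz = foldr _+_ 0ℚ (reduce (λ {a} a≢0 → (+ 1 / a) {{a≢0}}) nz)

-- Finite sets of positive integers are represented by duplicate-free lists.
record Partition (α : ℚ) (n : ℕ) : Set where
  field
    parts          : List ℕ
    distinct       : Unique parts
    positive-parts : All ℕ.NonZero parts
    sum≡n          : sum parts ≡ n
    reciprocals≡α  : reciprocalSum positive-parts ≡ α

open Partition public

_-Large_ : ∀ (m : ℕ) {α n} → Partition α n → Set
m -Large p = All (m ℕ.≤_) (parts p)

EventuallyPartitionable : ℚ → ℕ → ℕ → Set
EventuallyPartitionable α m N = ∀ n → N ℕ.≤ n → ∃ λ (p : Partition α n) → m -Large p

-- IsThreshold α m N says that n_{α,m} = N.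
record IsThreshold (α : ℚ) (m N : ℕ) : Set where
  field
    positive-threshold : 1 ℕ.≤ N
    eventually         : EventuallyPartitionable α m N
    least              : ∀ k → 1 ℕ.≤ k → EventuallyPartitionable α m k → N ℕ.≤ k

IsCauchy : (ℕ → ℚ) → Set
IsCauchy x = ∀ ε → 0ℚ < ε → ∃ λ N → ∀ i j → N ℕ.≤ i → N ℕ.≤ j → ∣ x i - x j ∣ ≤ ε

record ℝ : Set where
  constructor mkℝ
  field
    approx : ℕ → ℚ
    cauchy : IsCauchy approx

open ℝ public

infix  4 _≃ℝ_ _≤ℝ_ _⟶_
infixl 6 _+ℝ_ _-ℝ_
infixl 7 _*ℝ_
infix  8 -ℝ_

_≃ℝ_ : ℝ → ℝ → Set
x ≃ℝ y = ∀ ε → 0ℚ < ε → ∃ λ N → ∀ i → N ℕ.≤ i → ∣ approx x i - approx y i ∣ ≤ ε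

_≤ℝ_ : ℝ → ℝ → Set
x ≤ℝ y = ∀ ε → 0ℚ < ε → ∃ λ N → ∀ i → N ℕ.≤ i → approx x i ≤ approx y i + ε

module ℚ-Lemmas where

  natℚ : ℕ → ℚ
  natℚ k = + k / 1

  ∣p-p∣≤ : ∀ p {ε} → 0ℚ < ε → ∣ p - p ∣ ≤ ε
  ∣p-p∣≤ p {ε} ε>0 = subst (λ z → ∣ z ∣ ≤ ε) (sym (+-inverseʳ p)) (<⇒≤ ε>0)

  ∣p-q∣-comm : ∀ p q → ∣ p - q ∣ ≡ ∣ q - p ∣
  ∣p-q∣-comm p q = trans (cong ∣_∣ (solve 2 (λ p q → p :- q := :- (q :- p)) refl p q)) (∣-p∣≡∣p∣ (q - p))
    where
    open +-*-Solver

  p≤∣p∣ : ∀ p → p ≤ ∣ p ∣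
  p≤∣p∣ p with ≤-total 0ℚ p
  ... | inj₁ 0≤p = ≤-reflexive (sym (0≤p⇒∣p∣≡p 0≤p))
  ... | inj₂ p≤0 = ≤-trans p≤0 (0≤∣p∣ p)

  ∣∣p∣-∣q∣∣≤∣p-q∣ : ∀ p q → ∣ ∣ p ∣ - ∣ q ∣ ∣ ≤ ∣ p - q ∣
  ∣∣p∣-∣q∣∣≤∣p-q∣ p q with ∣p∣≡p∨∣p∣≡-p (∣ p ∣ - ∣ q ∣)
  ... | inj₁ eq = ≤-trans (≤-reflexive eq) (one p q)
    where
    open +-*-Solver
    one : ∀ p q → ∣ p ∣ - ∣ q ∣ ≤ ∣ p - q ∣
    one p q = begin
      ∣ p ∣ - ∣ q ∣               ≡⟨ cong (λ z → ∣ z ∣ - ∣ q ∣) (solve 2 (λ p q → p := (p :- q) :+ q) refl p q) ⟩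
      ∣ p - q + q ∣ - ∣ q ∣       ≤⟨ +-monoˡ-≤ (- ∣ q ∣) (∣p+q∣≤∣p∣+∣q∣ (p - q) q) ⟩
      ∣ p - q ∣ + ∣ q ∣ - ∣ q ∣   ≡⟨ solve 2 (λ a b → a :+ b :- b := a) refl ∣ p - q ∣ ∣ q ∣ ⟩
      ∣ p - q ∣                   ∎
      where
      open ≤R
  ... | inj₂ eq = begin
      ∣ ∣ p ∣ - ∣ q ∣ ∣           ≡⟨ eq ⟩
      - (∣ p ∣ - ∣ q ∣)           ≡⟨ solve 2 (λ a b → :- (a :- b) := b :- a) refl ∣ p ∣ ∣ q ∣ ⟩
      ∣ q ∣ - ∣ p ∣               ≡⟨ cong (λ z → ∣ z ∣ - ∣ p ∣) (solve 2 (λ p q → q := (q :- p) :+ p) refl p q) ⟩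
      ∣ q - p + p ∣ - ∣ p ∣       ≤⟨ +-monoˡ-≤ (- ∣ p ∣) (∣p+q∣≤∣p∣+∣q∣ (q - p) p) ⟩
      ∣ q - p ∣ + ∣ p ∣ - ∣ p ∣   ≡⟨ solve 2 (λ a b → a :+ b :- b := a) refl ∣ q - p ∣ ∣ p ∣ ⟩
      ∣ q - p ∣                   ≡⟨ ∣p-q∣-comm q p ⟩
      ∣ p - q ∣                   ∎
      where
      open ≤R
      open +-*-Solver

  half>0 : ∀ {ε} → 0ℚ < ε → 0ℚ < ½ * ε
  half>0 {ε} ε>0 = positive⁻¹ (½ * ε) {{pos*pos⇒pos ½ ε {{positive ε>0}}}}

  half+half : ∀ ε → ½ * ε + ½ * ε ≡ ε
  half+half ε = solve 1 (λ e → con ½ :* e :+ con ½ :* e := e) refl ε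
    where
    open +-*-Solver

  natℚ-mono : ∀ {m n} → m ℕ.≤ n → natℚ m ≤ natℚ n
  natℚ-mono {m} {n} m≤n = toℚᵘ-cancel-≤
    (ℚᵘ.≤-respˡ-≃ (ℚᵘ.≃-sym (toℚᵘ-fromℚᵘ (ℚᵘ.mkℚᵘ (+ m) 0)))
    (ℚᵘ.≤-respʳ-≃ (ℚᵘ.≃-sym (toℚᵘ-fromℚᵘ (ℚᵘ.mkℚᵘ (+ n) 0)))
    (ℚᵘ.*≤* (ℤ.*-monoʳ-≤-nonNeg (+ 1) (ℤ.+≤+ m≤n)))))

  ≤natℚ : ∀ p → p ≤ natℚ ℤ.∣ ↥ p ∣
  ≤natℚ p@record{} = toℚᵘ-cancel-≤
    (ℚᵘ.≤-respʳ-≃ (ℚᵘ.≃-sym (toℚᵘ-fromℚᵘ (ℚᵘ.mkℚᵘ (+ ℤ.∣ ↥ p ∣) 0)))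
    (ℚᵘ.*≤* (le (↥ p) (ℚ.denominator-1 p))))
    where
    le : ∀ n d → n ℤ.* + 1 ℤ.≤ + ℤ.∣ n ∣ ℤ.* + suc d
    le (+ n)      d = subst₂ ℤ._≤_ (ℤ.pos-* n 1) (ℤ.pos-* n (suc d))
                        (ℤ.+≤+ (ℕ.*-monoʳ-≤ n (ℕ.s≤s ℕ.z≤n)))
    le ℤ.-[1+ n ] d = ℤ.-≤+

  archimedes : ∀ c ε → 0ℚ < ε → ∃ λ N → ∀ i → N ℕ.≤ i → c ≤ natℚ i * ε
  archimedes c ε ε>0 = ℤ.∣ ↥ (c * 1/ε) ∣ , λ i N≤i → begin
    c                 ≡⟨ *-identityʳ c ⟨
    c * 1ℚ            ≡⟨ cong (c *_) (*-inverseˡ ε) ⟨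
    c * (1/ε * ε)     ≡⟨ *-assoc c 1/ε ε ⟨
    c * 1/ε * ε       ≤⟨ *-monoʳ-≤-nonNeg ε (≤-trans (≤natℚ (c * 1/ε)) (natℚ-mono N≤i)) ⟩
    natℚ i * ε        ∎
    where
    open ≤R
    instance
      _ = positive ε>0
      _ = pos⇒nonZero ε
      _ = pos⇒nonNeg ε
    1/ε = 1/ ε

open ℚ-Lemmas

fromℚ : ℚ → ℝ
fromℚ q = mkℝ (λ _ → q) λ ε ε>0 → 0 , λ _ _ _ _ → ∣p-p∣≤ q ε>0

fromℕ : ℕ → ℝ
fromℕ k = fromℚ (+ k / 1)

0ℝ 1ℝ : ℝ
0ℝ = fromℚ 0ℚ
1ℝ = fromℚ 1ℚ

_+ℝ_ : ℝ → ℝ → ℝ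
x +ℝ y = mkℝ (λ i → approx x i + approx y i) λ ε ε>0 →
  let Nx , hx = cauchy x (½ * ε) (half>0 ε>0)
      Ny , hy = cauchy y (½ * ε) (half>0 ε>0)
  in Nx ℕ.⊔ Ny , λ i j N≤i N≤j → begin
    ∣ (approx x i + approx y i) - (approx x j + approx y j) ∣
      ≡⟨ cong ∣_∣ (solve 4 (λ a b c d → (a :+ b) :- (c :+ d) := (a :- c) :+ (b :- d)) refl
           (approx x i) (approx y i) (approx x j) (approx y j)) ⟩
    ∣ (approx x i - approx x j) + (approx y i - approx y j) ∣
      ≤⟨ ∣p+q∣≤∣p∣+∣q∣ (approx x i - approx x j) (approx y i - approx y j) ⟩
    ∣ approx x i - approx x j ∣ + ∣ approx y i - approx y j ∣
      ≤⟨ +-mono-≤ (hx i j (ℕ.m⊔n≤o⇒m≤o Nx Ny N≤i) (ℕ.m⊔n≤o⇒m≤o Nx Ny N≤j))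
                  (hy i j (ℕ.m⊔n≤o⇒n≤o Nx Ny N≤i) (ℕ.m⊔n≤o⇒n≤o Nx Ny N≤j)) ⟩
    ½ * ε + ½ * ε
      ≡⟨ half+half ε ⟩
    ε ∎
  where
  open ≤R
  open +-*-Solver

-ℝ_ : ℝ → ℝ
-ℝ x = mkℝ (λ i → - approx x i) λ ε ε>0 →
  let N , h = cauchy x ε ε>0
  in N , λ i j N≤i N≤j → subst (_≤ ε)
       (trans (sym (∣-p∣≡∣p∣ (approx x i - approx x j)))
              (cong ∣_∣ (solve 2 (λ a b → :- (a :- b) := (:- a) :- (:- b)) refl (approx x i) (approx x j))))
       (h i j N≤i N≤j)
  where
  open +-*-Solver

_-ℝ_ : ℝ → ℝ → ℝ
x -ℝ y = x +ℝ (-ℝ y)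

∣_∣ℝ : ℝ → ℝ
∣ x ∣ℝ = mkℝ (λ i → ∣ approx x i ∣) λ ε ε>0 →
  let N , h = cauchy x ε ε>0
  in N , λ i j N≤i N≤j →
       ≤-trans (∣∣p∣-∣q∣∣≤∣p-q∣ (approx x i) (approx x j)) (h i j N≤i N≤j)

module Product-Lemmas where

  eventually-bounded : ∀ {x} → IsCauchy x →
    ∃ λ B → 0ℚ < B × ∃ λ N → ∀ i → N ℕ.≤ i → ∣ x i ∣ ≤ B
  eventually-bounded {x} c with c 1ℚ (positive⁻¹ 1ℚ)
  ... | N , h = 1ℚ + ∣ x N ∣
              , positive⁻¹ _ {{pos+nonNeg⇒pos 1ℚ ∣ x N ∣ {{∣-∣-nonNeg (x N)}}}}
              , N , λ i N≤i → begin
    ∣ x i ∣                 ≡⟨ cong ∣_∣ (solve 2 (λ a b → a := (a :- b) :+ b) refl (x i) (x N)) ⟩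
    ∣ (x i - x N) + x N ∣   ≤⟨ ∣p+q∣≤∣p∣+∣q∣ (x i - x N) (x N) ⟩
    ∣ x i - x N ∣ + ∣ x N ∣ ≤⟨ +-monoˡ-≤ ∣ x N ∣ (h i N N≤i ℕ.≤-refl) ⟩
    1ℚ + ∣ x N ∣            ∎
    where
    open ≤R
    open +-*-Solver

  ∣*∣≤ : ∀ p q {B δ} → 0ℚ < B → ∣ p ∣ ≤ B → ∣ q ∣ ≤ δ → ∣ p * q ∣ ≤ B * δ
  ∣*∣≤ p q {B} {δ} B>0 hp hq = begin
    ∣ p * q ∣      ≡⟨ ∣p*q∣≡∣p∣*∣q∣ p q ⟩
    ∣ p ∣ * ∣ q ∣  ≤⟨ *-monoʳ-≤-nonNeg ∣ q ∣ {{∣-∣-nonNeg q}} hp ⟩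
    B * ∣ q ∣      ≤⟨ *-monoˡ-≤-nonNeg B {{pos⇒nonNeg B {{positive B>0}}}} hq ⟩
    B * δ          ∎
    where
    open ≤R

  divide : ∀ {B ε} → 0ℚ < B → 0ℚ < ε → ∃ λ δ → 0ℚ < δ × B * δ ≡ ε
  divide {B} {ε} B>0 ε>0 = 1/ B * ε
      , positive⁻¹ _ {{pos*pos⇒pos (1/ B) {{1/pos⇒pos B}} ε}}
      , trans (sym (*-assoc B (1/ B) ε)) (trans (cong (_* ε) (*-inverseʳ B)) (*-identityˡ ε))
    where
    instance
      _ = positive B>0
      _ = positive ε>0
      _ = pos⇒nonZero B

  product-difference : ∀ a b c d → a * b - c * d ≡ a * (b - d) + d * (a - c)
  product-difference = solve 4 (λ a b c d → a :* b :- c :* d := a :* (b :- d) :+ d :* (a :- c)) refl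
    where
    open +-*-Solver

  *-cauchy : ∀ {x y} → IsCauchy x → IsCauchy y → IsCauchy (λ i → x i * y i)
  *-cauchy {x} {y} cx cy ε ε>0 =
    let A , A>0 , Na , ha = eventually-bounded cx
        B , B>0 , Nb , hb = eventually-bounded cy
        δ , δ>0 , Aδ      = divide A>0 (half>0 ε>0)
        η , η>0 , Bη      = divide B>0 (half>0 ε>0)
        Ny , hy           = cy δ δ>0
        Nx , hx           = cx η η>0
    in (Na ℕ.⊔ Nb) ℕ.⊔ (Ny ℕ.⊔ Nx) , λ i j N≤i N≤j →
    let i₁ = ℕ.m⊔n≤o⇒m≤o (Na ℕ.⊔ Nb) (Ny ℕ.⊔ Nx) N≤i
        i₂ = ℕ.m⊔n≤o⇒n≤o (Na ℕ.⊔ Nb) (Ny ℕ.⊔ Nx) N≤i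
        j₁ = ℕ.m⊔n≤o⇒m≤o (Na ℕ.⊔ Nb) (Ny ℕ.⊔ Nx) N≤j
        j₂ = ℕ.m⊔n≤o⇒n≤o (Na ℕ.⊔ Nb) (Ny ℕ.⊔ Nx) N≤j
    in begin
    ∣ x i * y i - x j * y j ∣
      ≡⟨ cong ∣_∣ (product-difference (x i) (y i) (x j) (y j)) ⟩
    ∣ x i * (y i - y j) + y j * (x i - x j) ∣
      ≤⟨ ∣p+q∣≤∣p∣+∣q∣ (x i * (y i - y j)) (y j * (x i - x j)) ⟩
    ∣ x i * (y i - y j) ∣ + ∣ y j * (x i - x j) ∣
      ≤⟨ +-mono-≤
           (∣*∣≤ (x i) (y i - y j) A>0 (ha i (ℕ.m⊔n≤o⇒m≤o Na Nb i₁))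
             (hy i j (ℕ.m⊔n≤o⇒m≤o Ny Nx i₂) (ℕ.m⊔n≤o⇒m≤o Ny Nx j₂)))
           (∣*∣≤ (y j) (x i - x j) B>0 (hb j (ℕ.m⊔n≤o⇒n≤o Na Nb j₁))
             (hx i j (ℕ.m⊔n≤o⇒n≤o Ny Nx i₂) (ℕ.m⊔n≤o⇒n≤o Ny Nx j₂))) ⟩
    A * δ + B * η
      ≡⟨ cong₂ _+_ Aδ Bη ⟩
    ½ * ε + ½ * ε
      ≡⟨ half+half ε ⟩
    ε ∎
    where
    open ≤R
    open +-*-Solver

open Product-Lemmas

_*ℝ_ : ℝ → ℝ → ℝ
x *ℝ y = mkℝ (λ i → approx x i * approx y i) (*-cauchy {approx x} {approx y} (cauchy x) (cauchy y))

expTerm : ℚ → ℕ → ℚ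
expTerm q i = _^_ +-*-rawSemiring q i * (+ 1 / i !) {{i ℕ.!≢0}}

expSum : ℚ → ℕ → ℚ
expSum q zero    = 0ℚ
expSum q (suc k) = expSum q k + expTerm q k

module Exp-Lemmas where

  -- (i + 1) (1 / (i + 1)!) = 1 / i!
  factorial-step : ∀ i → natℚ (suc i) * (+ 1 / suc i !) {{suc i ℕ.!≢0}} ≡ (+ 1 / i !) {{i ℕ.!≢0}}
  factorial-step i = go (suc i) (i !) {{i ℕ.!≢0}} {{suc i ℕ.!≢0}}
    where
    go : ∀ a b .{{_ : ℕ.NonZero b}} .{{_ : ℕ.NonZero (a ℕ.* b)}} →
         natℚ a * (+ 1 / (a ℕ.* b)) ≡ + 1 / b
    go a b@(suc b-1) {{_}} {{nz}} with a ℕ.* b in eq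
    ... | suc c = toℚᵘ-injective (ℚᵘ.≃-trans (toℚᵘ-homo-* (natℚ a) (+ 1 / suc c))
      (ℚᵘ.≃-trans (ℚᵘ.*-cong (toℚᵘ-fromℚᵘ (ℚᵘ.mkℚᵘ (+ a) 0)) (toℚᵘ-fromℚᵘ (ℚᵘ.mkℚᵘ (+ 1) c)))
      (ℚᵘ.≃-trans (ℚᵘ.*≡* lem) (ℚᵘ.≃-sym (toℚᵘ-fromℚᵘ (ℚᵘ.mkℚᵘ (+ 1) b-1))))))
      where
      lem : + a ℤ.* + 1 ℤ.* + b ≡ + 1 ℤ.* + suc (c ℕ.+ 0)
      lem rewrite ℤ.*-identityʳ (+ a) | ℤ.*-identityˡ (+ suc (c ℕ.+ 0)) | ℕ.+-identityʳ c =
        trans (sym (ℤ.pos-* a b)) (cong +_ eq)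

  regroup : ∀ a q r f → a * ((q * r) * f) ≡ q * (r * (a * f))
  regroup = solve 4 (λ a q r f → a :* ((q :* r) :* f) := q :* (r :* (a :* f))) refl
    where
    open +-*-Solver

  module Exp (q : ℚ) where
    t = expTerm q
    S = expSum q

    t-step : ∀ i → natℚ (suc i) * ∣ t (suc i) ∣ ≡ ∣ q ∣ * ∣ t i ∣
    t-step i = begin
      a * ∣ t (suc i) ∣              ≡⟨ cong (_* ∣ t (suc i) ∣) (sym (0≤p⇒∣p∣≡p 0≤a)) ⟩
      ∣ a ∣ * ∣ t (suc i) ∣          ≡⟨ ∣p*q∣≡∣p∣*∣q∣ a (t (suc i)) ⟨
      ∣ a * ((q * qⁱ) * f) ∣         ≡⟨ cong ∣_∣ (regroup a q qⁱ f) ⟩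
      ∣ q * (qⁱ * (a * f)) ∣         ≡⟨ cong (λ z → ∣ q * (qⁱ * z) ∣) (factorial-step i) ⟩
      ∣ q * t i ∣                    ≡⟨ ∣p*q∣≡∣p∣*∣q∣ q (t i) ⟩
      ∣ q ∣ * ∣ t i ∣                ∎
      where
      open ≡-Reasoning
      open +-*-Solver
      a = natℚ (suc i)
      0≤a : 0ℚ ≤ a
      0≤a = natℚ-mono {0} {suc i} ℕ.z≤n
      qⁱ = _^_ +-*-rawSemiring q i
      f = (+ 1 / suc i !) {{suc i ℕ.!≢0}}

    B : ℕ
    B = proj₁ (archimedes ∣ q ∣ ½ (positive⁻¹ ½))

    halving : ∀ i → B ℕ.≤ i → ∣ t (suc i) ∣ ≤ ½ * ∣ t i ∣
    halving i B≤i = *-cancelˡ-≤-pos (natℚ (suc i)) {{normalize-pos (suc i) 1}} (begin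
      natℚ (suc i) * ∣ t (suc i) ∣      ≡⟨ t-step i ⟩
      ∣ q ∣ * ∣ t i ∣                   ≤⟨ *-monoʳ-≤-nonNeg ∣ t i ∣ {{∣-∣-nonNeg (t i)}}
                                             (proj₂ (archimedes ∣ q ∣ ½ (positive⁻¹ ½)) (suc i) (ℕ.m≤n⇒m≤1+n B≤i)) ⟩
      natℚ (suc i) * ½ * ∣ t i ∣        ≡⟨ *-assoc (natℚ (suc i)) ½ ∣ t i ∣ ⟩
      natℚ (suc i) * (½ * ∣ t i ∣)      ∎)
      where
      open ≤R

    tail : ∀ k i → B ℕ.≤ i → ∣ S (k ℕ.+ i) - S i ∣ ≤ ∣ t i ∣ + ∣ t i ∣
    tail zero    i B≤i = ≤-trans (≤-reflexive (cong ∣_∣ (+-inverseʳ (S i))))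
                           (+-mono-≤ (0≤∣p∣ (t i)) (0≤∣p∣ (t i)))
    tail (suc k) i B≤i = begin
      ∣ S (suc k ℕ.+ i) - S i ∣                      ≡⟨ cong (λ z → ∣ S z - S i ∣) (sym (ℕ.+-suc k i)) ⟩
      ∣ S (k ℕ.+ suc i) - S i ∣                      ≡⟨ cong ∣_∣ (solve 3 (λ a b c → a :- b := c :+ (a :- (b :+ c))) refl (S (k ℕ.+ suc i)) (S i) (t i)) ⟩
      ∣ t i + (S (k ℕ.+ suc i) - S (suc i)) ∣        ≤⟨ ∣p+q∣≤∣p∣+∣q∣ (t i) _ ⟩
      ∣ t i ∣ + ∣ S (k ℕ.+ suc i) - S (suc i) ∣      ≤⟨ +-monoʳ-≤ ∣ t i ∣ (tail k (suc i) (ℕ.m≤n⇒m≤1+n B≤i)) ⟩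
      ∣ t i ∣ + (∣ t (suc i) ∣ + ∣ t (suc i) ∣)      ≤⟨ +-monoʳ-≤ ∣ t i ∣ (+-mono-≤ (halving i B≤i) (halving i B≤i)) ⟩
      ∣ t i ∣ + (½ * ∣ t i ∣ + ½ * ∣ t i ∣)          ≡⟨ cong (λ z → ∣ t i ∣ + z) (half+half ∣ t i ∣) ⟩
      ∣ t i ∣ + ∣ t i ∣                              ∎
      where
      open ≤R
      open +-*-Solver

    decreasing : ∀ k → ∣ t (k ℕ.+ B) ∣ ≤ ∣ t B ∣
    decreasing zero    = ≤-refl
    decreasing (suc k) = begin
      ∣ t (suc k ℕ.+ B) ∣                     ≤⟨ halving (k ℕ.+ B) (ℕ.m≤n+m B k) ⟩
      ½ * ∣ t (k ℕ.+ B) ∣                     ≤⟨ *-monoʳ-≤-nonNeg ∣ t (k ℕ.+ B) ∣ {{∣-∣-nonNeg (t (k ℕ.+ B))}} {½} {1ℚ} (≤ᵇ⇒≤ _) ⟩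
      1ℚ * ∣ t (k ℕ.+ B) ∣                    ≡⟨ *-identityˡ _ ⟩
      ∣ t (k ℕ.+ B) ∣                         ≤⟨ decreasing k ⟩
      ∣ t B ∣                                 ∎
      where
      open ≤R

    small : ∀ ε → 0ℚ < ε → ∃ λ N → B ℕ.≤ N × (∀ i → N ℕ.≤ i → ∣ t i ∣ ≤ ε)
    small ε ε>0 = suc (M ℕ.⊔ B) , ℕ.m≤n⇒m≤1+n (ℕ.m≤n⊔m M B) , bound
      where
      M = proj₁ (archimedes (∣ q ∣ * ∣ t B ∣) ε ε>0)
      h = proj₂ (archimedes (∣ q ∣ * ∣ t B ∣) ε ε>0)
      bound : ∀ i → suc (M ℕ.⊔ B) ℕ.≤ i → ∣ t i ∣ ≤ ε
      bound (suc i) (ℕ.s≤s N≤i) = *-cancelˡ-≤-pos (natℚ (suc i)) {{normalize-pos (suc i) 1}} (begin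
        natℚ (suc i) * ∣ t (suc i) ∣   ≡⟨ t-step i ⟩
        ∣ q ∣ * ∣ t i ∣                ≤⟨ *-monoˡ-≤-nonNeg ∣ q ∣ {{∣-∣-nonNeg q}}
                                            (subst (λ z → ∣ t z ∣ ≤ ∣ t B ∣)
                                              (ℕ.m∸n+n≡m (ℕ.m⊔n≤o⇒n≤o M B N≤i)) (decreasing (i ℕ.∸ B))) ⟩
        ∣ q ∣ * ∣ t B ∣                ≤⟨ h (suc i) (ℕ.m≤n⇒m≤1+n (ℕ.m⊔n≤o⇒m≤o M B N≤i)) ⟩
        natℚ (suc i) * ε               ∎)
        where
        open ≤R

    S-cauchy : IsCauchy S
    S-cauchy ε ε>0 = N , both
      where
      N = proj₁ (small (½ * ε) (half>0 ε>0))
      B≤N = proj₁ (proj₂ (small (½ * ε) (half>0 ε>0)))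
      h = proj₂ (proj₂ (small (½ * ε) (half>0 ε>0)))
      ordered : ∀ i j → N ℕ.≤ i → i ℕ.≤ j → ∣ S j - S i ∣ ≤ ε
      ordered i j N≤i i≤j = begin
        ∣ S j - S i ∣                      ≡⟨ cong (λ z → ∣ S z - S i ∣) (ℕ.m∸n+n≡m i≤j) ⟨
        ∣ S (j ℕ.∸ i ℕ.+ i) - S i ∣        ≤⟨ tail (j ℕ.∸ i) i (ℕ.≤-trans B≤N N≤i) ⟩
        ∣ t i ∣ + ∣ t i ∣                  ≤⟨ +-mono-≤ (h i N≤i) (h i N≤i) ⟩
        ½ * ε + ½ * ε                      ≡⟨ half+half ε ⟩
        ε                                  ∎
        where
        open ≤R
      both : ∀ i j → N ℕ.≤ i → N ℕ.≤ j → ∣ S i - S j ∣ ≤ ε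
      both i j N≤i N≤j with ℕ.≤-total i j
      ... | inj₁ i≤j = ≤-trans (≤-reflexive (∣p-q∣-comm (S i) (S j))) (ordered i j N≤i i≤j)
      ... | inj₂ j≤i = ordered j i N≤j j≤i

open Exp-Lemmas

exp : ℚ → ℝ
exp q = mkℝ (expSum q) (Exp.S-cauchy q)

_⟶_ : (ℕ → ℝ) → ℝ → Set
x ⟶ l = ∀ ε → 0ℚ < ε → ∃ λ M → ∀ m → M ℕ.≤ m → ∣ x m -ℝ l ∣ℝ ≤ℝ fromℚ ε

-- Lower bound: an m-large α-partition of n has n ≥ Σ [m, X) for the X with Σ 1/a over [m, X) close to α, since the
-- smallest denominators give the most reciprocal per unit of sum; and Π (1 + 1/a)² = (X/m)² makes X/m close to e^α.
--
-- Upper bound: fix a large prime g.  The hypothesis itself supplies an m′-large α-partition S of every large number,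
-- m′ ≈ 4m/g, and gS accounts for α/g.  It remains to write α - α/g as a sum of reciprocals of numbers prime to g (one
-- multiple of g below g m′ clears g from the denominator) with nearly the least possible sum and with a prescribed
-- sum modulo g.  Almost all numbers in [m, X) divide a modulus 2^s · Π p · Q, where p runs through the primes of a
-- range (P, U] with U slightly below m (by a power of m) and Q is a product of large powers of fixed small primes: the
-- exceptions have a large square factor or a prime factor above U, and are few by Chebyshev's bound.  Take as many of
-- these divisors as fit.  The primes p are then cleared from the denominator of the remainder one at a time, by
-- unit fractions with denominators p q 2^j, q ∣ Q a prime power: by the Chinese remainder theorem every numerator over
-- p Q is reached, and as Q is huge the real size of the correction is known in advance up to a negligible error.  The
-- last remainder, a fraction over Q 2^h, is expanded in the same way.  The residue of the sum modulo g is adjusted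
-- through 1/6 = 1/10 + 1/15.  This gives n m ≤ Σ [m, X) + o(m²) + g · n m′; a first use with a fixed g yields
-- n m = O(m²), and then g → ∞ makes the last term negligible.

module Submission where

open import Defs
open import Data.Empty using (⊥; ⊥-elim)
open import Data.List.Base using (List; []; _∷_; _++_; map; filter; length; take)
open import Data.List.Membership.Propositional using (_∈_)
import Data.List.Membership.Propositional.Properties as ∈
import Data.List.Properties as List
open import Data.List.Relation.Unary.All as All using (All; []; _∷_)
import Data.List.Relation.Unary.All.Properties as All
open import Data.List.Relation.Unary.AllPairs using (AllPairs; []; _∷_)
open import Data.List.Relation.Unary.Any as Any using (Any; here; there)
import Data.List.Relation.Unary.Any.Properties as Any
open import Data.List.Relation.Unary.Unique.Propositional using (Unique)
import Data.List.Relation.Unary.Unique.Propositional.Properties as Unique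
open import Data.Nat.Coprimality as Coprimality using (Coprime; coprime-divisor; coprime-Bézout)
open import Data.Nat.Divisibility
open import Data.Nat.DivMod hiding (_/_; _%_)
open import Data.Nat.ListAction using (sum; product)
import Data.Nat.ListAction.Properties as ListAction
open import Data.Nat.Primality using (Prime; prime?; prime[2]; ¬prime[1]; prime⇒nonTrivial; prime⇒irreducible; euclidsLemma)
open import Data.Nat.Properties
open import Data.Nat.Tactic.RingSolver using (solve-∀)
open import Data.Product.Base using (∃; _×_; _,_; proj₁; proj₂)
open import Data.Rational.Base as ℚ using (ℚ; 0ℚ; 1ℚ; ½; toℚᵘ; positive; nonNegative)
  renaming (_+_ to _+ℚ_; _*_ to _*ℚ_; _-_ to _-ℚ_; -_ to -ℚ_; _≤_ to _≤ℚ_; _<_ to _<ℚ_; _/_ to _/ℚ_; ∣_∣ to ∣_∣ℚ)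
import Data.Rational.Properties as ℚ
open import Data.Rational.Solver using (module +-*-Solver)
open import Data.Sum.Base using (_⊎_; inj₁; inj₂)
open import Function.Base using (_∘_)
open import Relation.Binary.PropositionalEquality using (_≡_; _≢_; refl; sym; trans; cong; cong₂; subst; subst₂; module ≡-Reasoning)
open import Relation.Nullary using (¬_; yes; no)
open import Relation.Nullary.Decidable using (¬?; _×-dec_; from-yes)
open import Relation.Unary using (Pred; Decidable)

-- Distinctness is arranged by divisibility. Besides the scaled partition, whose terms are at least
-- `4 * m`, one multiple `e` of g below `4 * m` occurs, and all other denominators are prime to g. A
-- divisor of the modulus has at most `s` factors 2, a corrective fraction has more. The terms that
-- adjust the residue are multiples of 15 and of a power of 2 above m, and no corrective fraction is
-- divisible by both 3 and 5. Keeping U lower than m by 2s + 1 binary orders pays for this: it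
-- leaves room for the extra factors 2, and it makes the total cost of all p negligible against m².
--
-- The delicate point is the tolerance. A greedy choice of divisors above m leaves an uncertainty of
-- 1 / m, while the last expansion has a range of about 2^-L, which may be no more than 1 / m. The
-- divisors are therefore taken from m + η upwards, where η is a small proportion of m. The slack
-- gained is tiny, but the elimination of each p blurs the remainder by at most 1 / Q, and Q ≥ m³
-- exceeds the number of the p by far.
--
-- Inequalities with an error term are multiplied out by a natural number `ℓ`, the inverse of the
-- precision.

-- Rational arithmetic with naturals and unit fractions.

module Rationals where

  open import Data.Integer.Base as ℤ using (+_)
  import Data.Integer.Properties as ℤ
  open import Data.Nat.Base using (ℕ; zero; suc; _+_; _*_; _≤_; _<_; _∸_; z≤n; s≤s; NonZero)
  import Data.Rational.Unnormalised.Base as ℚᵘ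
  import Data.Rational.Unnormalised.Properties as ℚᵘ
  open ℚ-Lemmas using (natℚ; natℚ-mono)
  open +-*-Solver

  *ℚ-monoˡ : ∀ {r p q} → 0ℚ ≤ℚ r → p ≤ℚ q → r *ℚ p ≤ℚ r *ℚ q
  *ℚ-monoˡ {r} 0≤r = ℚ.*-monoˡ-≤-nonNeg r {{nonNegative 0≤r}}

  *ℚ-monoʳ : ∀ {r p q} → 0ℚ ≤ℚ r → p ≤ℚ q → p *ℚ r ≤ℚ q *ℚ r
  *ℚ-monoʳ {r} 0≤r = ℚ.*-monoʳ-≤-nonNeg r {{nonNegative 0≤r}}

  *ℚ-mono : ∀ {p q r s} → 0ℚ ≤ℚ p → p ≤ℚ q → 0ℚ ≤ℚ r → r ≤ℚ s → p *ℚ r ≤ℚ q *ℚ s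
  *ℚ-mono 0≤p p≤q 0≤r r≤s =
    ℚ.≤-trans (*ℚ-monoʳ 0≤r p≤q) (*ℚ-monoˡ (ℚ.≤-trans 0≤p p≤q) r≤s)

  *ℚ-cancelˡ-≤ : ∀ {r p q} → 0ℚ <ℚ r → r *ℚ p ≤ℚ r *ℚ q → p ≤ℚ q
  *ℚ-cancelˡ-≤ {r} 0<r = ℚ.*-cancelˡ-≤-pos r {{positive 0<r}}

  *ℚ-cancelʳ-≤ : ∀ {r p q} → 0ℚ <ℚ r → p *ℚ r ≤ℚ q *ℚ r → p ≤ℚ q
  *ℚ-cancelʳ-≤ {r} 0<r = ℚ.*-cancelʳ-≤-pos r {{positive 0<r}}

  *ℚ-cancelʳ-≡ : ∀ {r p q} → 0ℚ <ℚ r → p *ℚ r ≡ q *ℚ r → p ≡ q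
  *ℚ-cancelʳ-≡ 0<r eq = ℚ.≤-antisym (*ℚ-cancelʳ-≤ 0<r (ℚ.≤-reflexive eq))
                                      (*ℚ-cancelʳ-≤ 0<r (ℚ.≤-reflexive (sym eq)))

  *ℚ-monoˡ-< : ∀ {r p q} → 0ℚ <ℚ r → p <ℚ q → r *ℚ p <ℚ r *ℚ q
  *ℚ-monoˡ-< {r} 0<r = ℚ.*-monoʳ-<-pos r {{positive 0<r}}

  0≤*ℚ : ∀ {p q} → 0ℚ ≤ℚ p → 0ℚ ≤ℚ q → 0ℚ ≤ℚ p *ℚ q
  0≤*ℚ {p} {q} 0≤p 0≤q = subst (_≤ℚ p *ℚ q) (ℚ.*-zeroˡ q) (*ℚ-monoʳ 0≤q 0≤p)

  0<*ℚ : ∀ {p q} → 0ℚ <ℚ p → 0ℚ <ℚ q → 0ℚ <ℚ p *ℚ q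
  0<*ℚ {p} {q} 0<p 0<q = subst (_<ℚ p *ℚ q) (ℚ.*-zeroʳ p) (*ℚ-monoˡ-< 0<p 0<q)

  0≤+ℚ : ∀ {p q} → 0ℚ ≤ℚ p → 0ℚ ≤ℚ q → 0ℚ ≤ℚ p +ℚ q
  0≤+ℚ {p} {q} 0≤p 0≤q = subst (_≤ℚ p +ℚ q) (ℚ.+-identityˡ 0ℚ) (ℚ.+-mono-≤ 0≤p 0≤q)

  ≤⇒0≤-ℚ : ∀ {p q} → p ≤ℚ q → 0ℚ ≤ℚ q -ℚ p
  ≤⇒0≤-ℚ {p} {q} p≤q = subst (_≤ℚ q -ℚ p) (ℚ.+-inverseʳ p) (ℚ.+-monoˡ-≤ (-ℚ p) p≤q)

  ≤-by : ∀ {p q} r → 0ℚ ≤ℚ r → q ≡ p +ℚ r → p ≤ℚ q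
  ≤-by {p} {q} r 0≤r eq = subst₂ _≤ℚ_ (ℚ.+-identityʳ p) (sym eq) (ℚ.+-monoʳ-≤ p 0≤r)

  0≤-⇒≤ℚ : ∀ {p q} → 0ℚ ≤ℚ q -ℚ p → p ≤ℚ q
  0≤-⇒≤ℚ {p} {q} h = ≤-by (q -ℚ p) h (solve 2 (λ p q → q := p :+ (q :- p)) refl p q)

  abstract
    -- Sealed so that type checking elsewhere does not unfold the normalisation of fractions. The
    -- value 0 at 0 makes `inv` total, so that lists of denominators need not carry positivity
    -- proofs.
    ι : ℕ → ℚ
    ι = natℚ

    inv : ℕ → ℚ
    inv zero    = 0ℚ
    inv (suc a) = + 1 /ℚ suc a

    ι≡natℚ : ∀ k → ι k ≡ natℚ k
    ι≡natℚ k = refl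

    inv-unit : ∀ a (a≢0 : NonZero a) → (+ 1 /ℚ a) {{a≢0}} ≡ inv a
    inv-unit (suc a) _ = refl

    ι-0 : ι 0 ≡ 0ℚ
    ι-0 = refl

    ι-1 : ι 1 ≡ 1ℚ
    ι-1 = refl

    inv-0 : inv 0 ≡ 0ℚ
    inv-0 = refl

    inv-1 : inv 1 ≡ 1ℚ
    inv-1 = refl

    private
      natℚᵘ : ∀ k → toℚᵘ (natℚ k) ℚᵘ.≃ ℚᵘ.mkℚᵘ (+ k) 0
      natℚᵘ k = ℚ.toℚᵘ-fromℚᵘ (ℚᵘ.mkℚᵘ (+ k) 0)

    ι-+ : ∀ m n → ι (m + n) ≡ ι m +ℚ ι n
    ι-+ m n = ℚ.toℚᵘ-injective (ℚᵘ.≃-trans (natℚᵘ (m + n)) (ℚᵘ.≃-sym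
      (ℚᵘ.≃-trans (ℚ.toℚᵘ-homo-+ (ι m) (ι n))
      (ℚᵘ.≃-trans (ℚᵘ.+-cong (natℚᵘ m) (natℚᵘ n)) (ℚᵘ.*≡* (cong (ℤ._* + 1)
        (cong₂ ℤ._+_ (ℤ.*-identityʳ (+ m)) (ℤ.*-identityʳ (+ n)))))))))

    ι-* : ∀ m n → ι (m * n) ≡ ι m *ℚ ι n
    ι-* m n = ℚ.toℚᵘ-injective (ℚᵘ.≃-trans (natℚᵘ (m * n)) (ℚᵘ.≃-sym
      (ℚᵘ.≃-trans (ℚ.toℚᵘ-homo-* (ι m) (ι n))
      (ℚᵘ.≃-trans (ℚᵘ.*-cong (natℚᵘ m) (natℚᵘ n)) (ℚᵘ.*≡* (cong (ℤ._* + 1)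
        (sym (ℤ.pos-* m n))))))))

    ι-mono-≤ : ∀ {m n} → m ≤ n → ι m ≤ℚ ι n
    ι-mono-≤ = natℚ-mono

    ι-inv : ∀ {a} → 1 ≤ a → ι a *ℚ inv a ≡ 1ℚ
    ι-inv {suc a} _ = ℚ.toℚᵘ-injective (ℚᵘ.≃-trans (ℚ.toℚᵘ-homo-* (ι (suc a)) (inv (suc a)))
      (ℚᵘ.≃-trans (ℚᵘ.*-cong (natℚᵘ (suc a)) (ℚ.toℚᵘ-fromℚᵘ (ℚᵘ.mkℚᵘ (+ 1) a)))
        (ℚᵘ.*≡* (cong +_ (trans (*-identityʳ (suc a * 1)) (trans (*-identityʳ (suc a))
          (sym (trans (+-identityʳ _) (+-identityʳ (suc a))))))))))

  0≤1ℚ : 0ℚ ≤ℚ 1ℚ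
  0≤1ℚ = subst₂ _≤ℚ_ ι-0 ι-1 (ι-mono-≤ {0} {1} z≤n)

  0<1ℚ : 0ℚ <ℚ 1ℚ
  0<1ℚ = ℚ.positive⁻¹ 1ℚ

  0≤ι : ∀ n → 0ℚ ≤ℚ ι n
  0≤ι n = subst (_≤ℚ ι n) ι-0 (ι-mono-≤ z≤n)

  0<ι : ∀ {n} → 1 ≤ n → 0ℚ <ℚ ι n
  0<ι {n} 1≤n = ℚ.<-≤-trans 0<1ℚ (subst (_≤ℚ ι n) ι-1 (ι-mono-≤ 1≤n))

  ι-mono-< : ∀ {m n} → m < n → ι m <ℚ ι n
  ι-mono-< {m} {n} m<n = ℚ.<-≤-trans
    (subst₂ _<ℚ_ (ℚ.+-identityˡ (ι m)) (trans (cong (_+ℚ ι m) (sym ι-1)) (sym (ι-+ 1 m))) (ℚ.+-monoˡ-< (ι m) 0<1ℚ))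
    (ι-mono-≤ m<n)

  ι-cancel-≤ : ∀ {m n} → ι m ≤ℚ ι n → m ≤ n
  ι-cancel-≤ {m} {n} h = ≮⇒≥ λ n<m → ℚ.<-irrefl refl (ℚ.<-≤-trans (ι-mono-< n<m) h)

  ι-cancel-< : ∀ {m n} → ι m <ℚ ι n → m < n
  ι-cancel-< {m} {n} h = ≰⇒> λ n≤m → ℚ.<-irrefl refl (ℚ.<-≤-trans h (ι-mono-≤ n≤m))

  inv-unique : ∀ {a x} → 1 ≤ a → ι a *ℚ x ≡ 1ℚ → x ≡ inv a
  inv-unique {a} {x} 1≤a eq = *ℚ-cancelʳ-≡ (0<ι 1≤a)
    (trans (ℚ.*-comm x (ι a)) (trans eq (trans (sym (ι-inv 1≤a)) (ℚ.*-comm (ι a) (inv a)))))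

  inv>0 : ∀ {a} → 1 ≤ a → 0ℚ <ℚ inv a
  inv>0 {a} 1≤a = ℚ.*-cancelˡ-<-nonNeg (ι a) {{nonNegative (0≤ι a)}}
    (subst₂ _<ℚ_ (sym (ℚ.*-zeroʳ (ι a))) (sym (ι-inv 1≤a)) 0<1ℚ)

  0≤inv : ∀ a → 0ℚ ≤ℚ inv a
  0≤inv zero    = ℚ.≤-reflexive (sym inv-0)
  0≤inv (suc a) = ℚ.<⇒≤ (inv>0 {suc a} (s≤s z≤n))

  inv-* : ∀ {a b} → 1 ≤ a → 1 ≤ b → inv (a * b) ≡ inv a *ℚ inv b
  inv-* {a} {b} 1≤a 1≤b = sym (inv-unique (*-mono-≤ 1≤a 1≤b)
    (trans (cong (_*ℚ (inv a *ℚ inv b)) (ι-* a b))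
    (trans (solve 4 (λ a b x y → a :* b :* (x :* y) := (a :* x) :* (b :* y)) refl (ι a) (ι b) (inv a) (inv b))
    (trans (cong₂ _*ℚ_ (ι-inv 1≤a) (ι-inv 1≤b)) (ℚ.*-identityˡ 1ℚ)))))

  ÷-≤⇒ : ∀ {a x q} → 1 ≤ a → x ≤ℚ q *ℚ ι a → x *ℚ inv a ≤ℚ q
  ÷-≤⇒ {a} {x} {q} 1≤a h = *ℚ-cancelʳ-≤ (0<ι 1≤a) (ℚ.≤-trans (ℚ.≤-reflexive
    (trans (ℚ.*-assoc x (inv a) (ι a)) (trans (cong (x *ℚ_) (trans (ℚ.*-comm (inv a) (ι a)) (ι-inv 1≤a))) (ℚ.*-identityʳ x)))) h)

  ÷-cancel : ∀ {a} x → 1 ≤ a → x *ℚ inv a *ℚ ι a ≡ x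
  ÷-cancel {a} x 1≤a = trans (ℚ.*-assoc x (inv a) (ι a))
    (trans (cong (x *ℚ_) (trans (ℚ.*-comm (inv a) (ι a)) (ι-inv 1≤a))) (ℚ.*-identityʳ x))

  frac-≤ : ∀ a b c d → 1 ≤ b → 1 ≤ d → a * d ≤ c * b → ι a *ℚ inv b ≤ℚ ι c *ℚ inv d
  frac-≤ a b c d 1≤b 1≤d h = ÷-≤⇒ {b} {ι a} 1≤b (*ℚ-cancelʳ-≤ {ι d} {ι a} (0<ι 1≤d) (ℚ.≤-trans (ℚ.≤-reflexive (sym (ι-* a d)))
    (ℚ.≤-trans (ι-mono-≤ h) (ℚ.≤-reflexive (trans (ι-* c b)
     (trans (cong (_*ℚ ι b) (sym (÷-cancel (ι c) 1≤d)))
       (solve 3 (λ x y z → x :* y :* z := x :* z :* y) refl (ι c *ℚ inv d) (ι d) (ι b))))))))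

  frac-< : ∀ a b c d → 1 ≤ b → 1 ≤ d → a * d < c * b → ι a *ℚ inv b <ℚ ι c *ℚ inv d
  frac-< a b c d 1≤b 1≤d h = ℚ.≰⇒> {ι c *ℚ inv d} {ι a *ℚ inv b} λ le → <⇒≱ h (ι-cancel-≤ (ℚ.≤-trans (ℚ.≤-reflexive
      (trans (ι-* c b) (trans (cong (_*ℚ ι b) (sym (÷-cancel (ι c) 1≤d)))
        (solve 3 (λ x y z → x :* y :* z := x :* z :* y) refl (ι c *ℚ inv d) (ι d) (ι b)))))
    (ℚ.≤-trans (*ℚ-monoʳ {ι d} (0≤ι d) (*ℚ-monoʳ {ι b} {ι c *ℚ inv d} {ι a *ℚ inv b} (0≤ι b) le))
     (ℚ.≤-reflexive (trans (cong (_*ℚ ι d) (÷-cancel {b} (ι a) 1≤b)) (sym (ι-* a d)))))))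

  frac-≡ : ∀ a b c d → 1 ≤ b → 1 ≤ d → a * d ≡ c * b → ι a *ℚ inv b ≡ ι c *ℚ inv d
  frac-≡ a b c d 1≤b 1≤d h = ℚ.≤-antisym (frac-≤ a b c d 1≤b 1≤d (≤-reflexive h))
                                        (frac-≤ c d a b 1≤d 1≤b (≤-reflexive (sym h)))

  inv-anti : ∀ {a b} → 1 ≤ a → a ≤ b → inv b ≤ℚ inv a
  inv-anti {a} {b} 1≤a a≤b = subst₂ _≤ℚ_ (1* (inv b)) (1* (inv a))
    (frac-≤ 1 b 1 a (≤-trans 1≤a a≤b) 1≤a (*-monoʳ-≤ 1 a≤b))
    where
    1* : ∀ x → ι 1 *ℚ x ≡ x
    1* x = trans (cong (_*ℚ x) ι-1) (ℚ.*-identityˡ x)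

  abstract
    unfraction : ∀ a d .(c : Coprime a (suc d)) → ℚ.mkℚ (+ a) d c *ℚ ι (suc d) ≡ ι a
    unfraction a d c = ℚ.toℚᵘ-injective (ℚᵘ.≃-trans (ℚ.toℚᵘ-homo-* (ℚ.mkℚ (+ a) d c) (ι (suc d)))
      (ℚᵘ.≃-trans (ℚᵘ.*-cong (ℚᵘ.≃-refl {toℚᵘ (ℚ.mkℚ (+ a) d c)}) (ℚ.toℚᵘ-fromℚᵘ (ℚᵘ.mkℚᵘ (+ suc d) 0)))
      (ℚᵘ.≃-trans (ℚᵘ.*≡* (trans (ℤ.*-identityʳ (+ a ℤ.* + suc d)) (cong (λ z → + a ℤ.* + z) (sym (*-identityʳ (suc d))))))
        (ℚᵘ.≃-sym (ℚ.toℚᵘ-fromℚᵘ (ℚᵘ.mkℚᵘ (+ a) 0))))))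

  positive-fraction : ∀ {α} → 0ℚ <ℚ α → ∃ λ a → ∃ λ b → 1 ≤ a × 1 ≤ b × α *ℚ ι b ≡ ι a
  positive-fraction {ℚ.mkℚ (+ suc a) d c} _ = suc a , suc d , s≤s z≤n , s≤s z≤n , unfraction (suc a) d c
  positive-fraction {ℚ.mkℚ (+ zero) d c} h with ℚ.drop-*<* h
  ... | ℤ.+<+ ()
  positive-fraction {ℚ.mkℚ ℤ.-[1+ n ] d c} h with ℚ.drop-*<* h
  ... | ()

-- Sums over lists, greedy selection, intervals and counting of multiples.

module Sums where

  open import Data.Nat.Base using (ℕ; zero; suc; _+_; _*_; _≤_; _<_; z≤n; s≤s; NonZero)
  open +-*-Solver
  open Rationals

  ∑ : (ℕ → ℚ) → List ℕ → ℚ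
  ∑ f []       = 0ℚ
  ∑ f (a ∷ as) = f a +ℚ ∑ f as

  R : List ℕ → ℚ
  R = ∑ inv

  reciprocalSum≡R : ∀ {as} (nz : All NonZero as) → reciprocalSum nz ≡ R as
  reciprocalSum≡R []                = refl
  reciprocalSum≡R {a ∷ _} (nz ∷ nzs) = cong₂ _+ℚ_ (inv-unit a nz) (reciprocalSum≡R nzs)

  ∑-++ : ∀ f as bs → ∑ f (as ++ bs) ≡ ∑ f as +ℚ ∑ f bs
  ∑-++ f []       bs = sym (ℚ.+-identityˡ (∑ f bs))
  ∑-++ f (a ∷ as) bs = trans (cong (f a +ℚ_) (∑-++ f as bs)) (sym (ℚ.+-assoc (f a) (∑ f as) (∑ f bs)))

  R-map-* : ∀ {g} → 1 ≤ g → ∀ {as} → All (1 ≤_) as → R (map (g *_) as) ≡ inv g *ℚ R as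
  R-map-* {g} 1≤g []                 = sym (ℚ.*-zeroʳ (inv g))
  R-map-* {g} 1≤g {a ∷ as} (1≤a ∷ h) = trans (cong₂ _+ℚ_ (inv-* 1≤g 1≤a) (R-map-* 1≤g h))
    (sym (ℚ.*-distribˡ-+ (inv g) (inv a) (R as)))

  sum-map-* : ∀ g as → sum (map (g *_) as) ≡ g * sum as
  sum-map-* g []       = sym (*-zeroʳ g)
  sum-map-* g (a ∷ as) = trans (cong (g * a +_) (sum-map-* g as)) (sym (*-distribˡ-+ g a (sum as)))

  ∑≥0 : ∀ {f} as → (∀ {a} → a ∈ as → 0ℚ ≤ℚ f a) → 0ℚ ≤ℚ ∑ f as
  ∑≥0 []       h = ℚ.≤-refl
  ∑≥0 (a ∷ as) h = 0≤+ℚ (h (here refl)) (∑≥0 as (λ i → h (there i)))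

  R≥0 : ∀ as → 0ℚ ≤ℚ R as
  R≥0 as = ∑≥0 as (λ {a} _ → 0≤inv a)

  ∑-linear : ∀ (f : ℕ → ℚ) c as → ∑ (λ a → f a -ℚ c *ℚ inv a) as ≡ ∑ f as -ℚ c *ℚ R as
  ∑-linear f c []       = sym (trans (cong (λ z → 0ℚ -ℚ z) (ℚ.*-zeroʳ c)) (ℚ.+-inverseʳ 0ℚ))
  ∑-linear f c (a ∷ as) = trans (cong (f a -ℚ c *ℚ inv a +ℚ_) (∑-linear f c as))
    (solve 5 (λ f s c i r → f :- c :* i :+ (s :- c :* r) := f :+ s :- c :* (i :+ r)) refl
      (f a) (∑ f as) c (inv a) (R as))

  ∑ι : ∀ as → ∑ ι as ≡ ι (sum as)
  ∑ι []       = sym ι-0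
  ∑ι (a ∷ as) = trans (cong (ι a +ℚ_) (∑ι as)) (sym (ι-+ a (sum as)))

  ∑-remove : ∀ f {a bs} → a ∈ bs → ∃ λ cs → (∑ f bs ≡ f a +ℚ ∑ f cs) × (∀ {x} → x ∈ cs → x ∈ bs) ×
             (∀ {x} → x ∈ bs → x ≢ a → x ∈ cs)
  ∑-remove f {bs = b ∷ bs} (here refl) = bs , refl , there , λ { (here e) x≢a → ⊥-elim (x≢a e) ; (there i) _ → i }
  ∑-remove f {a} {b ∷ bs} (there i) with ∑-remove f i
  ... | cs , eq , back , keep = b ∷ cs
    , trans (cong (f b +ℚ_) eq) (solve 3 (λ b a c → b :+ (a :+ c) := a :+ (b :+ c)) refl (f b) (f a) (∑ f cs))
    , (λ { (here e) → here e ; (there j) → there (back j) })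
    , λ { (here e) _ → here e ; (there j) x≢a → there (keep j x≢a) }

  -- Each entry of `as` is removed once from `bs`. Uniqueness of `as` keeps the later entries in
  -- what is left, so `bs` itself may have repetitions.
  ∑-⊆ : ∀ {f as bs} → (∀ {b} → b ∈ bs → 0ℚ ≤ℚ f b) → Unique as → (∀ {x} → x ∈ as → x ∈ bs) → ∑ f as ≤ℚ ∑ f bs
  ∑-⊆ {as = []}     {bs} h _          _ = ∑≥0 bs h
  ∑-⊆ {f} {a ∷ as} {bs} h (a∉as ∷ u) as⊆bs with ∑-remove f (as⊆bs (here refl))
  ... | cs , eq , back , keep = subst (f a +ℚ ∑ f as ≤ℚ_) (sym eq) (ℚ.+-monoʳ-≤ (f a)
    (∑-⊆ (λ i → h (back i)) u λ i → keep (as⊆bs (there i)) (λ x≡a → All.lookup a∉as i (sym x≡a))))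

  sum-take-≤ : ∀ k as → sum (take k as) ≤ sum as
  sum-take-≤ zero    as       = z≤n
  sum-take-≤ (suc k) []       = z≤n
  sum-take-≤ (suc k) (a ∷ as) = +-monoʳ-≤ a (sum-take-≤ k as)

  sum-filter-≤ : ∀ {p} {P : Pred ℕ p} (P? : Decidable P) as → sum (filter P? as) ≤ sum as
  sum-filter-≤ P? []       = z≤n
  sum-filter-≤ P? (a ∷ as) with P? a
  ... | yes _ = +-monoʳ-≤ a (sum-filter-≤ P? as)
  ... | no  _ = ≤-trans (sum-filter-≤ P? as) (m≤n+m _ a)

  -- A prefix suffices: it ends before the first term that no longer fits, and that term is at most
  -- 1 / b, which bounds the gap.
  greedy : ∀ {b} as → All (b ≤_) as → 1 ≤ b → ∀ θ → 0ℚ ≤ℚ θ → θ ≤ℚ R as →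
           ∃ λ k → R (take k as) ≤ℚ θ × θ ≤ℚ R (take k as) +ℚ inv b
  greedy {b} []       _         1≤b θ 0≤θ θ≤R = 0 , 0≤θ , ℚ.≤-trans θ≤R (subst (0ℚ ≤ℚ_) (sym (ℚ.+-identityˡ (inv b))) (0≤inv b))
  greedy {b} (a ∷ as) (b≤a ∷ h) 1≤b θ 0≤θ θ≤R = go (ℚ.≤-total (inv a) θ)
    where
    back : ∀ θ a → a +ℚ (θ -ℚ a) ≡ θ
    back = solve 2 (λ θ a → a :+ (θ :- a) := θ) refl
    go : inv a ≤ℚ θ ⊎ θ ≤ℚ inv a → ∃ λ k → R (take k (a ∷ as)) ≤ℚ θ × θ ≤ℚ R (take k (a ∷ as)) +ℚ inv b
    go (inj₂ θ≤a) = 0 , 0≤θ , ℚ.≤-trans θ≤a (subst (inv a ≤ℚ_) (sym (ℚ.+-identityˡ (inv b))) (inv-anti 1≤b b≤a))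
    go (inj₁ a≤θ) =
      let k , lo , hi = greedy as h 1≤b (θ -ℚ inv a) (≤⇒0≤-ℚ a≤θ) (subst (θ -ℚ inv a ≤ℚ_)
                          (solve 2 (λ a r → a :+ r :- a := r) refl (inv a) (R as)) (ℚ.+-monoˡ-≤ (-ℚ inv a) θ≤R))
      in suc k
       , subst (inv a +ℚ R (take k as) ≤ℚ_) (back θ (inv a)) (ℚ.+-monoʳ-≤ (inv a) lo)
       , subst₂ _≤ℚ_ (back θ (inv a)) (sym (ℚ.+-assoc (inv a) (R (take k as)) (inv b))) (ℚ.+-monoʳ-≤ (inv a) hi)

  -- The numbers of [m, m + k) in decreasing order, so that raising the upper end is a cons.
  interval : ℕ → ℕ → List ℕ
  interval m zero    = []
  interval m (suc k) = m + k ∷ interval m k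

  interval-bounds : ∀ m k → All (λ n → m ≤ n × n < m + k) (interval m k)
  interval-bounds m zero    = []
  interval-bounds m (suc k) = (m≤m+n m k , +-monoʳ-< m (n<1+n k))
    ∷ All.map (λ (l , u) → l , <-trans u (+-monoʳ-< m (n<1+n k))) (interval-bounds m k)

  ∈-interval : ∀ {m n} k → m ≤ n → n < m + k → n ∈ interval m k
  ∈-interval {m} {n} zero    m≤n n<m = ⊥-elim (<⇒≱ n<m (subst (_≤ n) (sym (+-identityʳ m)) m≤n))
  ∈-interval {m} {n} (suc k) m≤n n<  with m<1+n⇒m<n∨m≡n (subst (n <_) (+-suc m k) n<)
  ... | inj₁ n<m+k = there (∈-interval k m≤n n<m+k)
  ... | inj₂ refl  = here refl

  interval-unique : ∀ m k → Unique (interval m k)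
  interval-unique m zero    = []
  interval-unique m (suc k) = All.map (λ (_ , u) e → <-irrefl (sym e) u) (interval-bounds m k) ∷ interval-unique m k

  length-interval : ∀ m k → length (interval m k) ≡ k
  length-interval m zero    = refl
  length-interval m (suc k) = cong suc (length-interval m k)

  -- Stated with all the subtracted terms moved to the left.
  sum-interval : ∀ m k → 2 * sum (interval m k) + m * m + k + m ≡ (m + k) * (m + k) + m
  sum-interval m zero    = base m
    where
    base : ∀ m → 2 * 0 + m * m + 0 + m ≡ (m + 0) * (m + 0) + m
    base = solve-∀
  sum-interval m (suc k) = trans (step m k (sum (interval m k)))
    (trans (cong (_+ (2 * (m + k) + 1)) (sum-interval m k)) (done m k))
    where
    step : ∀ m k s → 2 * (m + k + s) + m * m + suc k + m ≡ 2 * s + m * m + k + m + (2 * (m + k) + 1)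
    step = solve-∀
    done : ∀ m k → (m + k) * (m + k) + m + (2 * (m + k) + 1) ≡ (m + suc k) * (m + suc k) + m
    done = solve-∀

  module _ {p} {P : Pred ℕ p} (P? : Decidable P) where

    count : List ℕ → ℕ
    count as = length (filter P? as)

    R-filter : ∀ {m} → 1 ≤ m → ∀ {as} → All (m ≤_) as →
               R as ≤ℚ R (filter P? as) +ℚ ι (length (filter (¬? ∘ P?) as)) *ℚ inv m
    R-filter {m} 1≤m []                   = ℚ.≤-reflexive (sym (trans (ℚ.+-identityˡ _) (trans (cong (_*ℚ inv m) ι-0) (ℚ.*-zeroˡ (inv m)))))
    R-filter {m} 1≤m {a ∷ as} (m≤a ∷ h) with P? a
    ... | yes _ = ℚ.≤-trans (ℚ.+-monoʳ-≤ (inv a) (R-filter 1≤m h)) (ℚ.≤-reflexive (sym (ℚ.+-assoc (inv a) (R (filter P? as)) _)))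
    ... | no  _ = ℚ.≤-trans (ℚ.+-mono-≤ (inv-anti 1≤m m≤a) (R-filter 1≤m h)) (ℚ.≤-reflexive
        (trans (solve 3 (λ i r c → i :+ (r :+ c :* i) := r :+ (con 1ℚ :+ c) :* i) refl (inv m) (R (filter P? as)) (ι c))
          (cong (λ z → R (filter P? as) +ℚ z *ℚ inv m) (trans (cong (_+ℚ ι c) (sym ι-1)) (sym (ι-+ 1 c))))))
      where
      c = length (filter (¬? ∘ P?) as)

  private
    multiples : List ℕ → ℕ → ℕ
    multiples as d = count (d ∣?_) as

    multiples-∷ : ∀ a as d → multiples as d ≤ multiples (a ∷ as) d
    multiples-∷ a as d with d ∣? a
    ... | yes _ = n≤1+n _
    ... | no  _ = ≤-refl

    multiples-∷-∣ : ∀ a as {d} → d ∣ a → suc (multiples as d) ≤ multiples (a ∷ as) d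
    multiples-∷-∣ a as {d} d∣a with d ∣? a
    ... | yes _   = ≤-refl
    ... | no d∤a  = ⊥-elim (d∤a d∣a)

    Σ-mono : ∀ {f g : ℕ → ℕ} → (∀ d → f d ≤ g d) → ∀ ds → sum (map f ds) ≤ sum (map g ds)
    Σ-mono h []       = z≤n
    Σ-mono h (d ∷ ds) = +-mono-≤ (h d) (Σ-mono h ds)

    Σ-bump : ∀ {a as ds} → Any (_∣ a) ds → suc (sum (map (multiples as) ds)) ≤ sum (map (multiples (a ∷ as)) ds)
    Σ-bump {a} {as} {d ∷ ds} (here d∣a)  = +-mono-≤ (multiples-∷-∣ a as d∣a) (Σ-mono (multiples-∷ a as) ds)
    Σ-bump {a} {as} {d ∷ ds} (there any) = ≤-trans (≤-reflexive (sym (+-suc (multiples as d) _)))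
      (+-mono-≤ (multiples-∷ a as d) (Σ-bump any))

  multiplesIn : List ℕ → ℕ → ℕ
  multiplesIn = multiples

  union-bound : ∀ {p} {P : Pred ℕ p} (P? : Decidable P) ds {as} → All (λ a → P a → Any (_∣ a) ds) as →
                count P? as ≤ sum (map (multiplesIn as) ds)
  union-bound P? ds []                = z≤n
  union-bound P? ds {a ∷ as} (p ∷ h) with P? a
  ... | yes pa = ≤-trans (s≤s (union-bound P? ds h)) (Σ-bump (p pa))
  ... | no  _  = ≤-trans (union-bound P? ds h) (Σ-mono (multiples-∷ a as) ds)

  -- The strict inequality is what makes the induction work: if m + k = q d is a new multiple, then
  -- c d < q d gives c + 1 ≤ q, hence (c + 1) d ≤ m + k.
  multiples-bound : ∀ m → 1 ≤ m → ∀ k d → multiplesIn (interval m k) d * d < m + k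
  multiples-bound m 1≤m zero    d = m≤n⇒m≤n+o 0 1≤m
  multiples-bound m 1≤m (suc k) d with d ∣? (m + k) | multiples-bound m 1≤m k d
  ... | no  _                | ih = <-≤-trans ih (+-monoʳ-≤ m (n≤1+n k))
  ... | yes (divides q m+k≡) | ih = subst (suc c * d <_) (sym (+-suc m k)) (s≤s (subst (suc c * d ≤_) (sym m+k≡)
          (*-monoˡ-≤ d (*-cancelʳ-< d c q (subst (c * d <_) m+k≡ ih)))))
    where
    c = multiplesIn (interval m k) d

-- Congruences, coprimality and Chebyshev's bound.

module Primes where

  open import Data.Nat.Base
  open import Data.Nat.Combinatorics using (_C_; nCk≡n!/k![n-k]!; k![n∸k]!∣n!; nCk+nC[k+1]≡[n+1]C[k+1]; k>n⇒nCk≡0)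
  open import Data.Nat.GCD using (module Bézout)
  open import Data.Nat.Primality.Factorisation using (factorise; PrimeFactorisation)
  open Sums

  %-difference : ∀ x y k .{{_ : NonZero k}} → x % k ≡ y % k → x ≤ y → ∃ λ t → y ≡ x + t * k
  %-difference x y k eq x≤y = y / k ∸ x / k , (begin
      y                                      ≡⟨ m≡m%n+[m/n]*n y k ⟩
      y % k + y / k * k                      ≡⟨ cong₂ (λ a b → a + b * k) (sym eq) (sym (m+[n∸m]≡n (/-monoˡ-≤ k x≤y))) ⟩
      x % k + (x / k + (y / k ∸ x / k)) * k  ≡⟨ regroup (x % k) (x / k) (y / k ∸ x / k) k ⟩
      x % k + x / k * k + (y / k ∸ x / k) * k ≡⟨ cong (_+ (y / k ∸ x / k) * k) (m≡m%n+[m/n]*n x k) ⟨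
      x + (y / k ∸ x / k) * k                ∎)
    where
    open ≡-Reasoning
    regroup : ∀ a b c k → a + (b + c) * k ≡ a + b * k + c * k
    regroup = solve-∀

  inverse : ∀ {a k} .{{_ : NonZero k}} → Coprime a k → ∃ λ u → (a * u) % k ≡ 1 % k
  inverse {a} {k} c with coprime-Bézout c
  ... | Bézout.+- x y eq = x , trans (cong (_% k) (trans (*-comm a x) (sym eq))) ([m+kn]%n≡m%n 1 y k)
  -- Here x a ≡ -1 modulo k; the factor k - 1, which is also -1 modulo k, corrects the sign inside
  -- ℕ.
  ... | Bézout.-+ x y eq = x * (k ∸ 1) , (begin
      (a * (x * (k ∸ 1))) % k                    ≡⟨ [m+n]%n≡m%n (a * (x * (k ∸ 1))) k ⟨
      (a * (x * (k ∸ 1)) + k) % k                ≡⟨ cong (λ z → (a * (x * (k ∸ 1)) + z) % k) (m+[n∸m]≡n (>-nonZero⁻¹ k)) ⟨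
      (a * (x * (k ∸ 1)) + (1 + (k ∸ 1))) % k    ≡⟨ cong (_% k) (regroup a x (k ∸ 1)) ⟩
      (1 + (k ∸ 1) * (1 + x * a)) % k            ≡⟨ cong (λ z → (1 + (k ∸ 1) * z) % k) eq ⟩
      (1 + (k ∸ 1) * (y * k)) % k                ≡⟨ cong (λ z → (1 + z) % k) (sym (*-assoc (k ∸ 1) y k)) ⟩
      (1 + (k ∸ 1) * y * k) % k                  ≡⟨ [m+kn]%n≡m%n 1 ((k ∸ 1) * y) k ⟩
      1 % k                                      ∎)
    where
    open ≡-Reasoning
    regroup : ∀ a x j → a * (x * j) + (1 + j) ≡ 1 + j * (1 + x * a)
    regroup = solve-∀

  -- The reduced solution v always exists, the quotient y only if b - a v does not leave ℕ. Hence
  -- the lower bounds on numerators in all later uses.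
  congruence : ∀ {a k} → 1 ≤ k → Coprime a k → ∀ b →
               ∃ λ v → v < k × (a * v ≤ b → ∃ λ y → b ≡ a * v + y * k)
  congruence {a} {k@(suc _)} _ c b with inverse c
  ... | u , au≡1 = (u * b) % k , m%n<n (u * b) k , %-difference (a * ((u * b) % k)) b k (begin
      (a * ((u * b) % k)) % k             ≡⟨ %-distribˡ-* a ((u * b) % k) k ⟩
      ((a % k) * ((u * b) % k % k)) % k   ≡⟨ cong (λ z → ((a % k) * z) % k) (m%n%n≡m%n (u * b) k) ⟩
      ((a % k) * ((u * b) % k)) % k       ≡⟨ %-distribˡ-* a (u * b) k ⟨
      (a * (u * b)) % k                   ≡⟨ cong (_% k) (*-assoc a u b) ⟨
      (a * u * b) % k                     ≡⟨ %-distribˡ-* (a * u) b k ⟩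
      (((a * u) % k) * (b % k)) % k       ≡⟨ cong (λ z → (z * (b % k)) % k) au≡1 ⟩
      ((1 % k) * (b % k)) % k             ≡⟨ %-distribˡ-* 1 b k ⟨
      (1 * b) % k                         ≡⟨ cong (_% k) (*-identityˡ b) ⟩
      b % k                               ∎)
    where
    open ≡-Reasoning

  coprime-*ʳ : ∀ {a b c} → Coprime a b → Coprime a c → Coprime a (b * c)
  coprime-*ʳ ab ac (d∣a , d∣bc) = ac (d∣a , coprime-divisor (λ (e∣d , e∣b) → ab (∣-trans e∣d d∣a , e∣b)) d∣bc)

  coprime-1ʳ : ∀ {a} → Coprime a 1
  coprime-1ʳ (_ , d∣1) = ∣1⇒≡1 d∣1

  coprime-∣ : ∀ {a b c d} → Coprime a b → c ∣ a → d ∣ b → Coprime c d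
  coprime-∣ co c∣a d∣b (e∣c , e∣d) = co (∣-trans e∣c c∣a , ∣-trans e∣d d∣b)

  coprime-^ʳ : ∀ {a b} n → Coprime a b → Coprime a (b ^ n)
  coprime-^ʳ zero    _  = coprime-1ʳ
  coprime-^ʳ (suc n) co = coprime-*ʳ co (coprime-^ʳ n co)

  coprime-product : ∀ {a ns} → All (Coprime a) ns → Coprime a (product ns)
  coprime-product []      = coprime-1ʳ
  coprime-product (c ∷ h) = coprime-*ʳ c (coprime-product h)

  coprime-*-∣ : ∀ {a b n} → Coprime a b → a ∣ n → b ∣ n → a * b ∣ n
  coprime-*-∣ {a} {b} co (divides q refl) b∣qa = subst (_∣ q * a) (*-comm b a)
    (*-monoˡ-∣ a (coprime-divisor (Coprimality.sym co) (subst (b ∣_) (*-comm q a) b∣qa)))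

  product-∣ : ∀ {ns N} → AllPairs Coprime ns → All (_∣ N) ns → product ns ∣ N
  product-∣ []       []       = 1∣ _
  product-∣ (c ∷ cs) (d ∷ ds) = coprime-*-∣ (coprime-product c) d (product-∣ cs ds)

  prime≥2 : ∀ {p} → Prime p → 2 ≤ p
  prime≥2 {p} pr = nonTrivial⇒n>1 p {{prime⇒nonTrivial pr}}

  prime-coprime : ∀ {p n} → Prime p → ¬ p ∣ n → Coprime p n
  prime-coprime pr p∤n (d∣p , d∣n) with prime⇒irreducible pr d∣p
  ... | inj₁ d≡1  = d≡1
  ... | inj₂ refl = ⊥-elim (p∤n d∣n)

  prime-∣-prime : ∀ {p q} → Prime p → Prime q → p ∣ q → p ≡ q
  prime-∣-prime pp pq p∣q with prime⇒irreducible pq p∣q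
  ... | inj₁ refl = ⊥-elim (¬prime[1] pp)
  ... | inj₂ p≡q  = p≡q

  primes-coprime : ∀ {p q} → Prime p → Prime q → p ≢ q → Coprime p q
  primes-coprime pp pq p≢q = prime-coprime pp λ p∣q → p≢q (prime-∣-prime pp pq p∣q)

  prime-∣-^ : ∀ {p m} n → Prime p → p ∣ m ^ n → p ∣ m
  prime-∣-^ zero    pp p∣1 = ⊥-elim (¬prime[1] (subst Prime (∣1⇒≡1 p∣1) pp))
  prime-∣-^ {p} {m} (suc n) pp p∣ with euclidsLemma m (m ^ n) pp p∣
  ... | inj₁ p∣m = p∣m
  ... | inj₂ p∣^ = prime-∣-^ n pp p∣^

  primes-pairwise-coprime : ∀ {ps} → Unique ps → All Prime ps → AllPairs Coprime ps
  primes-pairwise-coprime []      []       = []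
  primes-pairwise-coprime {q ∷ qs} (u ∷ us) (p ∷ pp) = head u pp ∷ primes-pairwise-coprime us pp
    where
    head : ∀ {rs} → All (q ≢_) rs → All Prime rs → All (Coprime q) rs
    head []       []       = []
    head (n ∷ ns) (r ∷ rs) = primes-coprime p r n ∷ head ns rs

  prime-factor : ∀ {n} → 2 ≤ n → ∃ λ p → Prime p × p ∣ n
  prime-factor {n@(suc _)} 2≤n = go (factors f) (isFactorisation f) (factorsPrime f)
    where
    open PrimeFactorisation
    f = factorise n
    go : ∀ fs → n ≡ product fs → All Prime fs → ∃ λ p → Prime p × p ∣ n
    go []       refl _        = ⊥-elim (<-irrefl refl 2≤n)
    go (p ∷ fs) eq   (pr ∷ _) = p , pr , subst (p ∣_) (sym eq) (m∣m*n (product fs))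

  ∣! : ∀ {d n} → 1 ≤ d → d ≤ n → d ∣ n !
  ∣! {suc d} _ d≤n = ∣-trans (m∣m*n (d !)) (m≤n⇒m!∣n! d≤n)

  prime-∣! : ∀ {p} n → Prime p → p ∣ n ! → p ≤ n
  prime-∣! zero    pp p∣1 = ⊥-elim (¬prime[1] (subst Prime (∣1⇒≡1 p∣1) pp))
  prime-∣! (suc n) pp p∣ with euclidsLemma (suc n) (n !) pp p∣
  ... | inj₁ p∣n = ∣⇒≤ p∣n
  ... | inj₂ p∣! = m≤n⇒m≤1+n (prime-∣! n pp p∣!)

  prime-above : ∀ n → ∃ λ p → Prime p × n < p
  prime-above n with prime-factor {suc (n !)} (s≤s (1≤n! n))
  ... | p , pp , p∣ = p , pp , ≰⇒> λ p≤n → ¬prime[1] (subst Prime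
          (∣1⇒≡1 (∣m+n∣m⇒∣n {p} {n !} {1} (subst (p ∣_) (+-comm 1 (n !)) p∣) (∣! (≤-trans (n≤1+n 1) (prime≥2 pp)) p≤n))) pp)

  nCk≤2^n : ∀ n k → n C k ≤ 2 ^ n
  nCk≤2^n n       zero    = subst (_≤ 2 ^ n) (sym (nC0 n)) (m^n>0 2 n)
    where
    nC0 : ∀ n → n C 0 ≡ 1
    nC0 n = refl
  nCk≤2^n zero    (suc k) = subst (_≤ 1) (sym (k>n⇒nCk≡0 {0} {suc k} (s≤s z≤n))) z≤n
  nCk≤2^n (suc n) (suc k) = subst₂ _≤_ (nCk+nC[k+1]≡[n+1]C[k+1] n k) (cong (2 ^ n +_) (sym (+-identityʳ (2 ^ n))))
    (+-mono-≤ (nCk≤2^n n k) (nCk≤2^n n (suc k)))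

  central-factorial : ∀ x → ((x + x) C x) * (x ! * (x + x ∸ x) !) ≡ (x + x) !
  central-factorial x = trans (cong (_* (x ! * (x + x ∸ x) !)) (nCk≡n!/k![n-k]! (m≤m+n x x))) (m/n*n≡m (k![n∸k]!∣n! (m≤m+n x x)))
    where
    instance
      _ = x !* (x + x ∸ x) !≢0

  prime-∣-central : ∀ {p x} → Prime p → x < p → p ≤ x + x → p ∣ (x + x) C x
  prime-∣-central {p} {x} pp x<p p≤2x with euclidsLemma ((x + x) C x) (x ! * (x + x ∸ x) !) pp
      (subst (p ∣_) (sym (central-factorial x)) (∣! (≤-trans (s≤s z≤n) x<p) p≤2x))
  ... | inj₁ p∣C = p∣C
  ... | inj₂ p∣!! with euclidsLemma (x !) ((x + x ∸ x) !) pp p∣!!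
  ...   | inj₁ p∣x! = ⊥-elim (<⇒≱ x<p (prime-∣! x pp p∣x!))
  ...   | inj₂ p∣x! = ⊥-elim (<⇒≱ x<p (prime-∣! x pp (subst (λ z → p ∣ z !) (m+n∸n≡m x x) p∣x!)))

  product-≥-^ : ∀ {b ns} → All (b ≤_) ns → b ^ length ns ≤ product ns
  product-≥-^ []      = ≤-refl
  product-≥-^ (h ∷ hs) = *-mono-≤ h (product-≥-^ hs)

  2^-cancel-≤ : ∀ {a b} → 2 ^ a ≤ 2 ^ b → a ≤ b
  2^-cancel-≤ {a} {b} h = ≮⇒≥ λ b<a → <⇒≱ (^-monoʳ-< 2 (s≤s (s≤s z≤n)) b<a) h

  dyadicPrimes : ℕ → List ℕ
  dyadicPrimes k = filter prime? (interval (suc (2 ^ k)) (2 ^ k))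

  dyadicPrimes-spec : ∀ k → All (λ p → Prime p × 2 ^ k < p × p ≤ 2 ^ k + 2 ^ k) (dyadicPrimes k)
  dyadicPrimes-spec k = All.zipWith (λ (p , l , u) → p , l , ≤-pred u)
    (All.all-filter prime? (interval (suc (2 ^ k)) (2 ^ k)) , All.filter⁺ prime? (interval-bounds (suc (2 ^ k)) (2 ^ k)))

  -- The product of the primes in (x, 2x] divides the binomial coefficient (x + x) C x.
  dyadicPrimes-count : ∀ k → k * length (dyadicPrimes k) ≤ 2 ^ suc k
  dyadicPrimes-count k = 2^-cancel-≤ (begin
      2 ^ (k * length ps)     ≡⟨ ^-*-assoc 2 k (length ps) ⟨
      (2 ^ k) ^ length ps     ≤⟨ product-≥-^ (All.map (λ (_ , l , _) → <⇒≤ l) spec) ⟩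
      product ps              ≤⟨ ∣⇒≤ {{C≢0}} (product-∣ (primes-pairwise-coprime unique (All.map proj₁ spec))
                                   (All.map (λ (p , l , u) → prime-∣-central p l u) spec)) ⟩
      (x + x) C x             ≤⟨ nCk≤2^n (x + x) x ⟩
      2 ^ (x + x)             ≡⟨ cong (λ z → 2 ^ (x + z)) (+-identityʳ x) ⟨
      2 ^ (2 ^ suc k)         ∎)
    where
    open ≤-Reasoning
    x = 2 ^ k
    ps = dyadicPrimes k
    spec = dyadicPrimes-spec k
    unique : Unique ps
    unique = Unique.filter⁺ prime? (interval-unique (suc x) x)
    C≢0 : NonZero ((x + x) C x)
    C≢0 = ≢-nonZero λ C≡0 → <⇒≱ (1≤n! (x + x))
      (subst (_≤ 0) (trans (sym (cong (_* (x ! * (x + x ∸ x) !)) C≡0)) (central-factorial x)) z≤n)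

  primesBetween : ℕ → ℕ → List ℕ
  primesBetween k zero    = []
  primesBetween k (suc j) = dyadicPrimes (k + j) ++ primesBetween k j

  ∈-primesBetween : ∀ {p} k j → Prime p → 2 ^ k < p → p ≤ 2 ^ (k + j) → p ∈ primesBetween k j
  ∈-primesBetween {p} k zero    pp l u = ⊥-elim (<⇒≱ l (subst (λ z → p ≤ 2 ^ z) (+-identityʳ k) u))
  ∈-primesBetween {p} k (suc j) pp l u with p ≤? 2 ^ (k + j)
  ... | yes p≤ = ∈.∈-++⁺ʳ (dyadicPrimes (k + j)) (∈-primesBetween k j pp l p≤)
  ... | no  p≰ = ∈.∈-++⁺ˡ (∈.∈-filter⁺ prime? (∈-interval x (≰⇒> p≰) (s≤s (subst (p ≤_)
          (trans (cong (2 ^_) (+-suc k j)) (cong (x +_) (+-identityʳ x))) u))) pp)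
    where
    x = 2 ^ (k + j)

-- Expansion of fractions into unit fractions with denominators q 2^j.

module BinaryExpansions where

  open import Data.Nat.Base
  open Rationals
  open Sums
  open Primes

  infix 4 _is_÷_

  -- A fraction that need not be in lowest terms: the denominator is the one prescribed by the
  -- construction, so cancelling a prime is a visible step in ℕ.
  record _is_÷_ (q : ℚ) (x d : ℕ) : Set where
    constructor cleared
    field
      equation : q *ℚ ι d ≡ ι x

  open _is_÷_ public

  ÷-scale : ∀ {q x d} k → q is x ÷ d → q is x * k ÷ (d * k)
  ÷-scale {q} {x} {d} k (cleared h) = cleared (trans (cong (q *ℚ_) (ι-* d k)) (trans (sym (ℚ.*-assoc q (ι d) (ι k)))
    (trans (cong (_*ℚ ι k) h) (sym (ι-* x k)))))

  ÷-unscale : ∀ {q x d k} → 1 ≤ k → q is x * k ÷ (d * k) → q is x ÷ d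
  ÷-unscale {q} {x} {d} {k} 1≤k (cleared h) = cleared (*ℚ-cancelʳ-≡ {ι k} (0<ι 1≤k) (trans (ℚ.*-assoc q (ι d) (ι k))
    (trans (cong (q *ℚ_) (sym (ι-* d k))) (trans h (ι-* x k)))))

  ÷-+ : ∀ {p q x y d} → p is x ÷ d → q is y ÷ d → (p +ℚ q) is x + y ÷ d
  ÷-+ {p} {q} {x} {y} {d} (cleared hp) (cleared hq) = cleared (trans (ℚ.*-distribʳ-+ (ι d) p q) (trans (cong₂ _+ℚ_ hp hq) (sym (ι-+ x y))))

  ÷-- : ∀ {p q x y d} → p is x + y ÷ d → q is x ÷ d → (p -ℚ q) is y ÷ d
  ÷-- {p} {q} {x} {y} {d} (cleared hp) (cleared hq) = cleared (trans (solve 3 (λ p q d → (p :- q) :* d := p :* d :- q :* d) refl p q (ι d))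
    (trans (cong₂ _-ℚ_ (trans hp (ι-+ x y)) hq) (solve 2 (λ x y → x :+ y :- x := y) refl (ι x) (ι y))))
    where open +-*-Solver

  ÷-unit : ∀ {a} → 1 ≤ a → inv a is 1 ÷ a
  ÷-unit {a} 1≤a = cleared (trans (ℚ.*-comm (inv a) (ι a)) (trans (ι-inv 1≤a) (sym ι-1)))

  ÷-zero : ∀ {d} → 0ℚ is 0 ÷ d
  ÷-zero {d} = cleared (trans (ℚ.*-zeroˡ (ι d)) (sym ι-0))

  ÷-cong : ∀ {q x y d e} → x ≡ y → d ≡ e → q is x ÷ d → q is y ÷ e
  ÷-cong refl refl h = h

  ÷⇒≡ : ∀ {q x d} → 1 ≤ d → q is x ÷ d → q ≡ ι x *ℚ inv d
  ÷⇒≡ {q} {x} {d} 1≤d (cleared h) = *ℚ-cancelʳ-≡ {ι d} (0<ι 1≤d) (trans h (sym (÷-cancel (ι x) 1≤d)))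

  ≡⇒÷ : ∀ {q} x d → 1 ≤ d → q ≡ ι x *ℚ inv d → q is x ÷ d
  ≡⇒÷ x d 1≤d e = cleared (trans (cong (_*ℚ ι d) e) (÷-cancel (ι x) 1≤d))

  ÷-unique : ∀ {p q x d} → 1 ≤ d → p is x ÷ d → q is x ÷ d → p ≡ q
  ÷-unique 1≤d hp hq = trans (÷⇒≡ 1≤d hp) (sym (÷⇒≡ 1≤d hq))

  *2^-≢ : ∀ {c i j} → 1 ≤ c → i < j → c * 2 ^ i ≢ c * 2 ^ j
  *2^-≢ {c@(suc _)} _ i<j eq = <-irrefl eq (*-monoʳ-< c (^-monoʳ-< 2 (s≤s (s≤s z≤n)) i<j))

  -- The last digit of `a` decides on the denominator c 2^n, and a / 2 is expanded over c 2^(n - 1).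
  -- Since a < 2^n there is no integer part, hence 1 ≤ i. The bound on the sum is that of the full
  -- geometric series.
  binary : ∀ c → 1 ≤ c → ∀ n a → a < 2 ^ n → ∃ λ F → (R F is a ÷ (c * 2 ^ n)) × Unique F ×
           All (λ v → ∃ λ i → 1 ≤ i × i ≤ n × v ≡ c * 2 ^ i) F × sum F ≤ c * 2 ^ suc n
  binary c 1≤c zero    zero    _    = [] , ÷-zero {c * 1} , [] , [] , z≤n
  binary c 1≤c zero    (suc a) (s≤s ())
  binary c 1≤c (suc n) a       a<2ⁿ⁺¹
    with a % 2 | m%n<n a 2 | m≡m%n+[m/n]*n a 2
       | binary c 1≤c n (a / 2) (*-cancelʳ-< 2 (a / 2) (2 ^ n) (≤-<-trans (≤-trans (m≤n+m (a / 2 * 2) (a % 2)) (≤-reflexive (sym (m≡m%n+[m/n]*n a 2)))) (subst (a <_) (*-comm 2 (2 ^ n)) a<2ⁿ⁺¹)))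
  ... | zero  | _ | a≡ | F , eq , u , el , s =
      F , ÷-cong (sym a≡) (shape c (2 ^ n)) (÷-scale 2 eq) , u
    , All.map (λ (i , 1≤i , i≤n , e) → i , 1≤i , m≤n⇒m≤1+n i≤n , e) el
    , ≤-trans s (*-monoʳ-≤ c (^-monoʳ-≤ 2 (n≤1+n (suc n))))
    where
    shape : ∀ c x → c * x * 2 ≡ c * (2 * x)
    shape = solve-∀
  ... | suc zero | _ | a≡ | F , eq , u , el , s =
      c * 2 ^ suc n ∷ F , ÷-cong (sym a≡) refl (÷-+ (÷-unit (*-mono-≤ 1≤c (m^n>0 2 (suc n)))) (÷-cong refl (shape c (2 ^ n)) (÷-scale 2 eq)))
    , All.map (λ (i , _ , i≤n , e) eq → *2^-≢ 1≤c (s≤s i≤n) (trans (sym e) (sym eq))) el ∷ u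
    , (suc n , s≤s z≤n , ≤-refl , refl) ∷ All.map (λ (i , 1≤i , i≤n , e) → i , 1≤i , m≤n⇒m≤1+n i≤n , e) el
    , ≤-trans (+-monoʳ-≤ (c * 2 ^ suc n) s) (≤-reflexive (double c (2 ^ n)))
    where
    shape : ∀ c x → c * x * 2 ≡ c * (2 * x)
    shape = solve-∀
    double : ∀ c x → c * (2 * x) + c * (2 * x) ≡ c * (2 * (2 * x))
    double = solve-∀
  ... | suc (suc _) | s≤s (s≤s ()) | _ | _

  ≥1-product : ∀ {qs} → All (2 ≤_) qs → 1 ≤ product qs
  ≥1-product []      = s≤s z≤n
  ≥1-product (h ∷ hs) = *-mono-≤ (≤-trans (n≤1+n 1) h) (≥1-product hs)

  -- By the Chinese remainder theorem x / Q = Σ aᵢ / qᵢ + z with 0 ≤ aᵢ < qᵢ for every x ≥ |qs| Q, where Q is the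
  -- product of qs; each of the summands is then expanded in binary.
  module Expansion {s n e a b H m o : ℕ} (1≤o : 1 ≤ o) (H≡s+a : H ≡ s + a) (H≡n+b : H ≡ n + b)
                   (e≤a : e ≤ a) (e≤b : e ≤ b) (m≤o : m ≤ o * 2 ^ suc b) where

    Shape : List ℕ → ℕ → Set
    Shape qs v = ∃ λ q → ∃ λ j → (q ≡ 1 ⊎ q ∈ qs) × e < j × j ≤ H × v ≡ o * q * 2 ^ j

    expansion : ∀ qs → AllPairs Coprime qs → All (λ q → 2 ≤ q × Coprime q 2 × q ≤ 2 ^ s × m ≤ o * q * 2 ^ suc a) qs →
                ∀ x → length qs * product qs ≤ x → x < 2 ^ n * product qs →
                ∃ λ F → (R F is x ÷ (o * product qs * 2 ^ H)) × Unique F × All (m ≤_) F ×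
                  All (Shape qs) F × sum F ≤ suc (length qs) * (o * 2 ^ (suc H + s))
    expansion [] _ _ x _ x<2ⁿ =
      let F , eq , u , el , σ = binary (o * 2 ^ b) (*-mono-≤ 1≤o (m^n>0 2 b)) n x (subst (x <_) (*-identityʳ (2 ^ n)) x<2ⁿ)
      in F , ÷-cong refl shape eq , u
       , All.map (λ { (i , 1≤i , _ , refl) → ≤-trans m≤o (≤-trans (≤-reflexive (shift o (2 ^ b)))
           (*-monoʳ-≤ (o * 2 ^ b) (^-monoʳ-≤ 2 1≤i))) }) el
       , All.map (λ { (i , 1≤i , i≤n , refl) → 1 , b + i , inj₁ refl , ≤-trans (s≤s e≤b) (≤-trans (≤-reflexive (+-comm 1 b)) (+-monoʳ-≤ b 1≤i))
           , ≤-trans (+-monoʳ-≤ b i≤n) (≤-reflexive (trans (+-comm b n) (sym H≡n+b)))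
           , trans (*-assoc o (2 ^ b) (2 ^ i)) (cong₂ _*_ (sym (*-identityʳ o)) (sym (^-distribˡ-+-* 2 b i))) }) el
       , ≤-trans σ (≤-trans (≤-reflexive size) (≤-trans (*-monoʳ-≤ o (^-monoʳ-≤ 2 (m≤m+n (suc H) s))) (≤-reflexive (sym (+-identityʳ (o * 2 ^ (suc H + s)))))))
      where
      shift : ∀ o x → o * (2 * x) ≡ o * x * 2
      shift = solve-∀
      pow : 2 ^ b * 2 ^ n ≡ 2 ^ H
      pow = trans (sym (^-distribˡ-+-* 2 b n)) (cong (2 ^_) (trans (+-comm b n) (sym H≡n+b)))
      shape : o * 2 ^ b * 2 ^ n ≡ o * 1 * 2 ^ H
      shape = trans (*-assoc o (2 ^ b) (2 ^ n)) (cong₂ _*_ (sym (*-identityʳ o)) pow)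
      size : o * 2 ^ b * 2 ^ suc n ≡ o * 2 ^ suc H
      size = trans (lem o (2 ^ b) (2 ^ n)) (cong (λ z → o * (2 * z)) pow)
        where
        lem : ∀ o x y → o * x * (2 * y) ≡ o * (2 * (x * y))
        lem = solve-∀
    expansion (q ∷ qs) (cq ∷ cs) ((2≤q , odd , q≤2ˢ , m≤q) ∷ hs) x low high = assemble
      where
      open ≤-Reasoning
      Q = product qs
      instance
        _ = >-nonZero (≤-trans (n≤1+n 1) 2≤q)
      -- With x = Q d + x′ q the fraction x / (q Q) splits into d / q + x′ / Q. As Q d ≤ q Q, one of
      -- the multiples of the product in the lower bound on x pays for d, and the others pass on to
      -- x′.
      dig = congruence {Q} {q} (≤-trans (n≤1+n 1) 2≤q) (Coprimality.sym (coprime-product cq)) x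
      d = proj₁ dig
      d<q = proj₁ (proj₂ dig)
      Qd≤Qq : Q * d ≤ q * Q
      Qd≤Qq = ≤-trans (*-monoʳ-≤ Q (<⇒≤ d<q)) (≤-reflexive (*-comm Q q))
      quo = proj₂ (proj₂ dig) (≤-trans Qd≤Qq (≤-trans (m≤m+n (q * Q) (length qs * (q * Q))) low))
      x′ = proj₁ quo
      x≡ : x ≡ Q * d + x′ * q
      x≡ = proj₂ quo
      low′ : length qs * Q ≤ x′
      low′ = *-cancelʳ-≤ (length qs * Q) x′ q (+-cancelˡ-≤ (q * Q) (length qs * Q * q) (x′ * q) (begin
        q * Q + length qs * Q * q    ≡⟨ lem q Q (length qs) ⟩
        suc (length qs) * (q * Q)    ≤⟨ low ⟩
        x                            ≡⟨ x≡ ⟩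
        Q * d + x′ * q               ≤⟨ +-monoˡ-≤ (x′ * q) Qd≤Qq ⟩
        q * Q + x′ * q               ∎))
        where
        lem : ∀ q Q l → q * Q + l * Q * q ≡ suc l * (q * Q)
        lem = solve-∀
      high′ : x′ < 2 ^ n * Q
      high′ = *-cancelʳ-< q x′ (2 ^ n * Q) (begin-strict
        x′ * q               ≤⟨ m≤n+m (x′ * q) (Q * d) ⟩
        Q * d + x′ * q       ≡⟨ x≡ ⟨
        x                    <⟨ high ⟩
        2 ^ n * (q * Q)      ≡⟨ lem (2 ^ n) q Q ⟩
        2 ^ n * Q * q        ∎)
        where
        lem : ∀ z q Q → z * (q * Q) ≡ z * Q * q
        lem = solve-∀
      pow : 2 ^ a * 2 ^ s ≡ 2 ^ H
      pow = trans (sym (^-distribˡ-+-* 2 a s)) (cong (2 ^_) (trans (+-comm a s) (sym H≡s+a)))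
      assemble : ∃ λ F → (R F is x ÷ (o * (q * Q) * 2 ^ H)) × Unique F × All (m ≤_) F ×
                  All (Shape (q ∷ qs)) F × sum F ≤ suc (suc (length qs)) * (o * 2 ^ (suc H + s))
      assemble =
        let G , eqG , uG , elG , σG = binary (o * q * 2 ^ a) (*-mono-≤ (*-mono-≤ 1≤o (≤-trans (n≤1+n 1) 2≤q)) (m^n>0 2 a)) s d (<-≤-trans d<q q≤2ˢ)
            F , eqF , uF , mF , elF , σF = expansion qs cs hs x′ low′ high′
        in G ++ F
         , subst (_is x ÷ (o * (q * Q) * 2 ^ H)) (sym (∑-++ inv G F))
           (÷-cong (trans (cong (_+ x′ * q) (*-comm d Q)) (sym x≡)) refl
             (÷-+ (÷-cong refl (trans (cong (_* Q) (trans (*-assoc (o * q) (2 ^ a) (2 ^ s)) (cong (o * q *_) pow))) (shapeG o q Q (2 ^ H))) (÷-scale Q eqG))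
                  (÷-cong refl (shapeF o q Q (2 ^ H)) (÷-scale q eqF))))
         , Unique.++⁺ uG uF (λ {v} (v∈G , v∈F) → disjoint (All.lookup elG v∈G) (All.lookup elF v∈F))
         , All.++⁺ (All.map (λ { (i , 1≤i , _ , refl) → ≤-trans m≤q (≤-trans (≤-reflexive (shift (o * q) (2 ^ a)))
             (*-monoʳ-≤ (o * q * 2 ^ a) (^-monoʳ-≤ 2 1≤i))) }) elG) mF
         , All.++⁺ (All.map (λ { (i , 1≤i , i≤s , refl) → q , a + i , inj₂ (here refl) , ≤-trans (s≤s e≤a) (≤-trans (≤-reflexive (+-comm 1 a)) (+-monoʳ-≤ a 1≤i))
             , ≤-trans (+-monoʳ-≤ a i≤s) (≤-reflexive (trans (+-comm a s) (sym H≡s+a)))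
             , trans (*-assoc (o * q) (2 ^ a) (2 ^ i)) (cong (o * q *_) (sym (^-distribˡ-+-* 2 a i))) }) elG)
             (All.map (λ { (q′ , j , inj₁ e , r) → q′ , j , inj₁ e , r ; (q′ , j , inj₂ i , r) → q′ , j , inj₂ (there i) , r }) elF)
         , ≤-trans (≤-reflexive (ListAction.sum-++ G F)) (+-mono-≤ (≤-trans σG (begin
             o * q * 2 ^ a * 2 ^ suc s       ≡⟨ trans (grow o q (2 ^ a) (2 ^ s)) (cong (λ z → o * (2 * z * q)) pow) ⟩
             o * (2 * 2 ^ H * q)             ≤⟨ *-monoʳ-≤ o (*-monoʳ-≤ (2 * 2 ^ H) q≤2ˢ) ⟩
             o * (2 * 2 ^ H * 2 ^ s)         ≡⟨ cong (o *_) (^-distribˡ-+-* 2 (suc H) s) ⟨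
             o * 2 ^ (suc H + s)             ∎)) σF)
        where
        grow : ∀ o q x y → o * q * x * (2 * y) ≡ o * (2 * (x * y) * q)
        grow = solve-∀
        shapeG : ∀ o q Q h → o * q * h * Q ≡ o * (q * Q) * h
        shapeG = solve-∀
        shapeF : ∀ o q Q h → o * Q * h * q ≡ o * (q * Q) * h
        shapeF = solve-∀
        shift : ∀ o x → o * (2 * x) ≡ o * x * 2
        shift = solve-∀
        disjoint : ∀ {v} → (∃ λ i → 1 ≤ i × i ≤ s × v ≡ o * q * 2 ^ a * 2 ^ i) → Shape qs v → ⊥
        disjoint {v} (i , _ , _ , v≡) (q′ , j , q′∈ , _ , _ , v≡′) = <-irrefl (sym (coprime (∣-refl , q∣))) 2≤q
          where
          instance
            _ = >-nonZero 1≤o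
          q∣ : q ∣ q′ * 2 ^ j
          q∣ = divides (2 ^ a * 2 ^ i) (*-cancelˡ-≡ (q′ * 2 ^ j) (2 ^ a * 2 ^ i * q) o
                 (trans (sym (*-assoc o q′ (2 ^ j))) (trans (sym v≡′) (trans v≡ (lem o q (2 ^ a) (2 ^ i))))))
            where
            lem : ∀ o q x y → o * q * x * y ≡ o * (x * y * q)
            lem = solve-∀
          member : ∀ {q″} → (q″ ≡ 1 ⊎ q″ ∈ qs) → Coprime q q″
          member (inj₁ refl) = coprime-1ʳ
          member (inj₂ q″∈)  = All.lookup cq q″∈
          coprime : Coprime q (q′ * 2 ^ j)
          coprime = coprime-*ʳ (member q′∈) (coprime-^ʳ j odd)

-- Clearing the primes from the denominator of the remainder.

module Elimination where

  open import Data.Nat.Base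
  open Rationals
  open Sums
  open Primes
  open BinaryExpansions

  ÷-≤⇒≤ : ∀ {p q x y d} → p is x ÷ d → q is y ÷ d → p ≤ℚ q → x ≤ y
  ÷-≤⇒≤ {d = d} (cleared hp) (cleared hq) p≤q = ι-cancel-≤ (subst₂ _≤ℚ_ hp hq (*ℚ-monoʳ (0≤ι d) p≤q))

  ÷-<⇒< : ∀ {p q x y d} → 1 ≤ d → p is x ÷ d → q is y ÷ d → p <ℚ q → x < y
  ÷-<⇒< {p} {q} {x} {y} {d} 1≤d (cleared hp) (cleared hq) p<q = ι-cancel-< (subst₂ _<ℚ_
    (trans (ℚ.*-comm (ι d) p) hp) (trans (ℚ.*-comm (ι d) q) hq) (*ℚ-monoˡ-< (0<ι 1≤d) p<q))

  module Completion (m s h κ n : ℕ) (qs : List ℕ) (H : ℕ → ℕ) where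

    Q = product qs
    t = length qs

    QsOK : ℕ → Set
    QsOK q = 2 ≤ q × Coprime q 2 × q ≤ 2 ^ s × 2 ^ s ≤ q * 2 ^ κ

    -- `H p` brings p 2^(H p) within a factor 2 of 2^κ m. The factor 2^κ is a reserve, because a
    -- prime power q may fall short of 2^s by that much. Of the exponent, s digits serve the
    -- numerators over q, and s more ensure that every denominator is divisible by a higher power of
    -- 2 than 2^s.
    PsOK : ℕ → Set
    PsOK p = 2 ≤ p × Coprime p 2 × All (Coprime p) qs × p ≤ Q × 2 ^ κ * m ≤ p * 2 ^ H p ×
             p * 2 ^ H p ≤ 2 * (2 ^ κ * m) × s + s ≤ H p × H p ≤ h

    Shape : List ℕ → ℕ → Set
    Shape ps v = ∃ λ o → ∃ λ q → ∃ λ j → (o ≡ 1 ⊎ o ∈ ps) × (q ≡ 1 ⊎ q ∈ qs) × s < j × v ≡ o * q * 2 ^ j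

    -- To clear p, a numerator x over p Q 2^H is subtracted with x in [t Q, t Q + p): up to 1 / Q this removes drift p,
    -- whatever the residue of x modulo p.
    drift : ℕ → ℚ
    drift p = ι t *ℚ inv (p * 2 ^ H p)

    -- The window of remainders that can be completed. Clearing p removes at least `drift p` and at
    -- most `drift p +ℚ inv Q`, so both ends move by the drift and the window narrows by only 1 / Q.
    -- For the empty list the ends say that a numerator over Q 2^h lies between t Q and 2^n Q, as
    -- the expansion requires.
    lower upper : List ℕ → ℚ
    lower []       = ι t *ℚ inv (2 ^ h)
    lower (p ∷ ps) = drift p +ℚ inv Q +ℚ lower ps
    upper []       = ι (2 ^ n) *ℚ inv (2 ^ h)
    upper (p ∷ ps) = drift p +ℚ upper ps

    -- Bounds for the sums of the denominators in the last expansion and in the elimination of one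
    -- prime. The second is uniform in p because p 2^(H p) is at most twice 2^κ m.
    cost₀ cost₁ : ℕ
    cost₀ = suc t * (1 * 2 ^ (suc h + s))
    cost₁ = suc t * (2 * 2 ^ s * (2 * (2 ^ κ * m)))

    Completed : List ℕ → ℚ → Set
    Completed ps τ = ∃ λ F → R F ≡ τ × Unique F × All (m ≤_) F × All (Shape ps) F × sum F ≤ length ps * cost₁ + cost₀

    module _ (1≤m : 1 ≤ m) (qs-coprime : AllPairs Coprime qs) (qs-ok : All QsOK qs) (t<2^κ : t < 2 ^ κ) (κ≤s : κ ≤ s)
             (s+n≤h : s + n ≤ h) (s+s≤h : s + s ≤ h) (m≤ : m ≤ 2 ^ suc (h ∸ n)) (2^κm≤2^h : 2 ^ κ * m ≤ 2 ^ h) where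

      private
        1≤Q : 1 ≤ Q
        1≤Q = ≥1-product (All.map proj₁ qs-ok)

        -- Using q in place of 2^s loses a factor of at most 2^κ, which is what the assumption on o
        -- 2^G holds in reserve.
        q-size : ∀ {q o G} → s ≤ G → 2 ^ κ * m ≤ o * 2 ^ G → 2 ^ s ≤ q * 2 ^ κ → m ≤ o * q * 2 ^ suc (G ∸ s)
        q-size {q} {o} {G} s≤G big 2ˢ≤ = ≤-trans step (*-monoʳ-≤ (o * q) (^-monoʳ-≤ 2 (n≤1+n (G ∸ s))))
          where
          open ≤-Reasoning
          instance
            _ = >-nonZero (*-mono-≤ (m^n>0 2 κ) (m^n>0 2 s))
          step : m ≤ o * q * 2 ^ (G ∸ s)
          step = *-cancelʳ-≤ m (o * q * 2 ^ (G ∸ s)) (2 ^ κ * 2 ^ s) (begin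
            m * (2 ^ κ * 2 ^ s)                          ≡⟨ lem₁ m (2 ^ κ) (2 ^ s) ⟩
            2 ^ κ * m * 2 ^ s                            ≤⟨ *-mono-≤ big 2ˢ≤ ⟩
            o * 2 ^ G * (q * 2 ^ κ)                      ≡⟨ cong (λ z → o * z * (q * 2 ^ κ)) (trans (cong (2 ^_) (sym (m∸n+n≡m s≤G))) (^-distribˡ-+-* 2 (G ∸ s) s)) ⟩
            o * (2 ^ (G ∸ s) * 2 ^ s) * (q * 2 ^ κ)      ≡⟨ lem₂ o (2 ^ (G ∸ s)) (2 ^ s) q (2 ^ κ) ⟩
            o * q * 2 ^ (G ∸ s) * (2 ^ κ * 2 ^ s)        ∎)
            where
            lem₁ : ∀ m k s → m * (k * s) ≡ k * m * s
            lem₁ = solve-∀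
            lem₂ : ∀ o g s q k → o * (g * s) * (q * k) ≡ o * q * g * (k * s)
            lem₂ = solve-∀

        sized : ∀ {o G} → s ≤ G → 2 ^ κ * m ≤ o * 2 ^ G → ∀ {q} → QsOK q →
                2 ≤ q × Coprime q 2 × q ≤ 2 ^ s × m ≤ o * q * 2 ^ suc (G ∸ s)
        sized {o} s≤G big {q} (2≤q , odd , q≤ , 2ˢ≤) = 2≤q , odd , q≤ , q-size {q} {o} s≤G big 2ˢ≤

      complete : ∀ ps → All PsOK ps → AllPairs Coprime ps → ∀ τ c → τ is c ÷ (product ps * (Q * 2 ^ h)) →
                 lower ps ≤ℚ τ → τ <ℚ upper ps → Completed ps τ
      complete [] _ _ τ c τ≡ low high =
        let F , eq , u , m≤F , sh , σ = expansion qs qs-coprime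
                  (All.map (sized {1} s≤h (subst (2 ^ κ * m ≤_) (sym (*-identityˡ (2 ^ h))) 2^κm≤2^h)) qs-ok)
                  c tQ≤c c<
        in F , ÷-unique 1≤d eq τ≡′ , u , m≤F
         , All.map (λ { (q , j , q∈ , s<j , _ , v≡) → 1 , q , j , inj₁ refl , q∈ , s<j , v≡ }) sh , σ
        where
        s≤h = ≤-trans (m≤m+n s s) s+s≤h
        n≤h = ≤-trans (m≤n+m n s) s+n≤h
        1≤d : 1 ≤ 1 * Q * 2 ^ h
        1≤d = *-mono-≤ (*-mono-≤ (≤-refl {1}) 1≤Q) (m^n>0 2 h)
        τ≡′ : τ is c ÷ (1 * Q * 2 ^ h)
        τ≡′ = ÷-cong refl (sym (*-assoc 1 Q (2 ^ h))) τ≡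
        frac : ∀ x → (ι x *ℚ inv (2 ^ h)) is x * Q ÷ (1 * Q * 2 ^ h)
        frac x = ÷-cong refl (lem (2 ^ h) Q) (÷-scale Q (≡⇒÷ x (2 ^ h) (m^n>0 2 h) refl))
          where
          lem : ∀ z q → z * q ≡ 1 * q * z
          lem = solve-∀
        tQ≤c : t * Q ≤ c
        tQ≤c = ÷-≤⇒≤ (frac t) τ≡′ low
        c< : c < 2 ^ n * Q
        c< = ÷-<⇒< 1≤d τ≡′ (frac (2 ^ n)) high
        open Expansion {s} {n} {s} {h ∸ s} {h ∸ n} {h} {m} {1} (s≤s z≤n) (sym (m+[n∸m]≡n s≤h)) (sym (m+[n∸m]≡n n≤h))
               (m+n≤o⇒m≤o∸n s s+s≤h) (m+n≤o⇒m≤o∸n s s+n≤h) (subst (m ≤_) (sym (*-identityˡ (2 ^ suc (h ∸ n)))) m≤)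
      complete (p ∷ ps) ((2≤p , odd , p⊥qs , p≤Q , big , small , 2s≤H , H≤h) ∷ oks) (p⊥ps ∷ cops) τ c τ≡ low high =
        G ++ F , trans (∑-++ inv G F) (trans (cong (R G +ℚ_) RF) (cancel (R G) τ))
        , Unique.++⁺ uG uF (λ (v∈G , v∈F) → disjoint (All.lookup shG v∈G) (All.lookup shF v∈F))
        , All.++⁺ m≤G m≤F
        , All.++⁺ (All.map (λ { (q , j , q∈ , s<j , _ , v≡) → p , q , j , inj₂ (here refl) , q∈ , s<j , v≡ }) shG)
            (All.map (λ { (o , q , j , inj₁ e , r) → o , q , j , inj₁ e , r ; (o , q , j , inj₂ i , r) → o , q , j , inj₂ (there i) , r }) shF)
        , (begin
            sum (G ++ F)                           ≡⟨ ListAction.sum-++ G F ⟩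
            sum G + sum F                          ≤⟨ +-mono-≤ (≤-trans σG cost) σF ⟩
            cost₁ + (length ps * cost₁ + cost₀)    ≡⟨ +-assoc cost₁ (length ps * cost₁) cost₀ ⟨
            suc (length ps) * cost₁ + cost₀        ∎)
        where
        open ≤-Reasoning
        Hp = H p
        W = product ps
        w = W * 2 ^ (h ∸ Hp)
        D = W * (Q * 2 ^ h)
        d = p * Q * 2 ^ Hp
        s≤H = ≤-trans (m≤m+n s s) 2s≤H
        κ≤H = ≤-trans κ≤s s≤H
        1≤p = ≤-trans (n≤1+n 1) 2≤p
        1≤2^H = m^n>0 2 Hp
        1≤d : 1 ≤ d
        1≤d = *-mono-≤ (*-mono-≤ 1≤p 1≤Q) 1≤2^H
        pow : 2 ^ Hp * 2 ^ (h ∸ Hp) ≡ 2 ^ h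
        pow = trans (sym (^-distribˡ-+-* 2 Hp (h ∸ Hp))) (cong (2 ^_) (m+[n∸m]≡n H≤h))
        d*w : d * w ≡ p * W * (Q * 2 ^ h)
        d*w = trans (lem p Q (2 ^ Hp) W (2 ^ (h ∸ Hp))) (cong (λ z → p * W * (Q * z)) pow)
          where
          lem : ∀ p q a w b → p * q * a * (w * b) ≡ p * w * (q * (a * b))
          lem = solve-∀
        1/Q≥ : ι (t * Q + p) *ℚ inv d ≤ℚ drift p +ℚ inv Q
        1/Q≥ = ℚ.≤-trans (ℚ.≤-reflexive (trans (cong (_*ℚ inv d) (ι-+ (t * Q) p)) (ℚ.*-distribʳ-+ (inv d) (ι (t * Q)) (ι p))))
          (ℚ.+-mono-≤ (frac-≤ (t * Q) d t (p * 2 ^ Hp) 1≤d (*-mono-≤ 1≤p 1≤2^H) (≤-reflexive (lem₁ t Q p (2 ^ Hp))))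
            (ℚ.≤-trans (frac-≤ p d 1 Q 1≤d 1≤Q (≤-trans (m≤m*n (p * Q) (2 ^ Hp) {{m^n≢0 2 Hp}}) (≤-reflexive (sym (+-identityʳ d)))))
              (ℚ.≤-reflexive (trans (cong (_*ℚ inv Q) ι-1) (ℚ.*-identityˡ (inv Q))))))
          where
          lem₁ : ∀ t q p a → t * q * (p * a) ≡ t * (p * q * a)
          lem₁ = solve-∀
        0≤lower : ∀ rs → 0ℚ ≤ℚ lower rs
        0≤lower []       = 0≤*ℚ (0≤ι t) (0≤inv (2 ^ h))
        0≤lower (r ∷ rs) = 0≤+ℚ (0≤+ℚ (0≤*ℚ (0≤ι t) (0≤inv (r * 2 ^ H r))) (0≤inv Q)) (0≤lower rs)
        room : (t * Q + p) * w ≤ c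
        room = ÷-≤⇒≤ (÷-cong refl d*w (÷-scale w (≡⇒÷ (t * Q + p) d 1≤d refl))) τ≡
          (ℚ.≤-trans 1/Q≥ (ℚ.≤-trans (≤-by (lower ps) (0≤lower ps) refl) low))
        p⊥w : Coprime w p
        p⊥w = Coprimality.sym (coprime-*ʳ (coprime-product p⊥ps) (coprime-^ʳ (h ∸ Hp) odd))
        -- With x = t Q + v, the congruence w v ≡ c - t Q w modulo p makes c - x w divisible by p,
        -- so p leaves the denominator of τ - R G. By `room` both subtractions stay in ℕ, whatever
        -- residue v turns out to be.
        con = congruence {w} {p} 1≤p p⊥w (c ∸ t * Q * w)
        v = proj₁ con
        v<p = proj₁ (proj₂ con)
        tQw≤c : t * Q * w ≤ c
        tQw≤c = ≤-trans (*-monoˡ-≤ w (m≤m+n (t * Q) p)) room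
        wv≤ : w * v ≤ c ∸ t * Q * w
        wv≤ = m+n≤o⇒m≤o∸n (w * v) (begin
          w * v + t * Q * w     ≤⟨ +-monoˡ-≤ (t * Q * w) (*-monoʳ-≤ w (<⇒≤ v<p)) ⟩
          w * p + t * Q * w     ≡⟨ lem w p (t * Q) ⟩
          (t * Q + p) * w       ≤⟨ room ⟩
          c                     ∎)
          where
          lem : ∀ w p x → w * p + x * w ≡ (x + p) * w
          lem = solve-∀
        y = proj₁ (proj₂ (proj₂ con) wv≤)
        x = t * Q + v
        c≡ : c ≡ x * w + y * p
        c≡ = trans (sym (m+[n∸m]≡n tQw≤c)) (trans (cong (t * Q * w +_) (proj₂ (proj₂ (proj₂ con) wv≤))) (lem (t * Q) w v (y * p)))
          where
          lem : ∀ z w v u → z * w + (w * v + u) ≡ (z + v) * w + u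
          lem = solve-∀
        m≤o : m ≤ p * 2 ^ suc (Hp ∸ κ)
        m≤o = *-cancelˡ-≤ (2 ^ κ) {{m^n≢0 2 κ}} (begin
          2 ^ κ * m                              ≤⟨ big ⟩
          p * 2 ^ Hp                             ≡⟨ cong (λ z → p * 2 ^ z) (m+[n∸m]≡n κ≤H) ⟨
          p * 2 ^ (κ + (Hp ∸ κ))                 ≡⟨ cong (p *_) (^-distribˡ-+-* 2 κ (Hp ∸ κ)) ⟩
          p * (2 ^ κ * 2 ^ (Hp ∸ κ))             ≡⟨ lem p (2 ^ κ) (2 ^ (Hp ∸ κ)) ⟩
          2 ^ κ * (p * 2 ^ (Hp ∸ κ))             ≤⟨ *-monoʳ-≤ (2 ^ κ) (*-monoʳ-≤ p (^-monoʳ-≤ 2 (n≤1+n (Hp ∸ κ)))) ⟩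
          2 ^ κ * (p * 2 ^ suc (Hp ∸ κ))         ∎)
          where
          lem : ∀ p a b → p * (a * b) ≡ a * (p * b)
          lem = solve-∀
        x<2^κ*Q : x < 2 ^ κ * Q
        x<2^κ*Q = begin-strict
          t * Q + v   <⟨ +-monoʳ-< (t * Q) (<-≤-trans v<p p≤Q) ⟩
          t * Q + Q   ≡⟨ +-comm (t * Q) Q ⟩
          suc t * Q   ≤⟨ *-monoˡ-≤ Q t<2^κ ⟩
          2 ^ κ * Q   ∎
        open Expansion {s} {κ} {s} {Hp ∸ s} {Hp ∸ κ} {Hp} {m} {p} 1≤p (sym (m+[n∸m]≡n s≤H)) (sym (m+[n∸m]≡n κ≤H))
               (m+n≤o⇒m≤o∸n s 2s≤H) (m+n≤o⇒m≤o∸n s (≤-trans (+-monoʳ-≤ s κ≤s) 2s≤H)) m≤o renaming (Shape to Shapeᵖ)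
        head = expansion qs qs-coprime (All.map (sized {p} s≤H big) qs-ok)
                 x (m≤m+n (t * Q) v) x<2^κ*Q
        G = proj₁ head
        eqG = proj₁ (proj₂ head)
        uG = proj₁ (proj₂ (proj₂ head))
        m≤G = proj₁ (proj₂ (proj₂ (proj₂ head)))
        shG = proj₁ (proj₂ (proj₂ (proj₂ (proj₂ head))))
        σG = proj₂ (proj₂ (proj₂ (proj₂ (proj₂ head))))
        RG≤ : R G ≤ℚ drift p +ℚ inv Q
        RG≤ = ℚ.≤-trans (ℚ.≤-reflexive (÷⇒≡ 1≤d eqG)) (ℚ.≤-trans (*ℚ-monoʳ (0≤inv d) (ι-mono-≤ (+-monoʳ-≤ (t * Q) (<⇒≤ v<p)))) 1/Q≥)
        RG≥ : drift p ≤ℚ R G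
        RG≥ = ℚ.≤-trans (frac-≤ t (p * 2 ^ Hp) x d (*-mono-≤ 1≤p 1≤2^H) 1≤d
                (≤-trans (≤-reflexive (lem t p Q (2 ^ Hp))) (*-monoˡ-≤ (p * 2 ^ Hp) (m≤m+n (t * Q) v)))) (ℚ.≤-reflexive (sym (÷⇒≡ 1≤d eqG)))
          where
          lem : ∀ t p q a → t * (p * q * a) ≡ t * q * (p * a)
          lem = solve-∀
        τ′≡ : (τ -ℚ R G) is y ÷ D
        τ′≡ = ÷-unscale 1≤p (÷-cong refl (lem p W (Q * 2 ^ h))
                (÷-- (÷-cong c≡ refl τ≡) (÷-cong refl d*w (÷-scale w eqG))))
          where
          lem : ∀ p w z → p * w * z ≡ w * z * p
          lem = solve-∀
        open +-*-Solver
        cancel : ∀ g τ → g +ℚ (τ -ℚ g) ≡ τ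
        cancel = solve 2 (λ g τ → g :+ (τ :- g) := τ) refl
        low′ : lower ps ≤ℚ τ -ℚ R G
        low′ = ≤-by ((drift p +ℚ inv Q -ℚ R G) +ℚ (τ -ℚ lower (p ∷ ps))) (0≤+ℚ (≤⇒0≤-ℚ RG≤) (≤⇒0≤-ℚ low))
          (solve 5 (λ τ g d i l → τ :- g := l :+ ((d :+ i :- g) :+ (τ :- (d :+ i :+ l)))) refl τ (R G) (drift p) (inv Q) (lower ps))
        high′ : τ -ℚ R G <ℚ upper ps
        high′ = ℚ.<-≤-trans (ℚ.+-monoˡ-< (-ℚ R G) high) (≤-by (R G -ℚ drift p) (≤⇒0≤-ℚ RG≥)
          (solve 3 (λ d u g → u := (d :+ u :- g) :+ (g :- d)) refl (drift p) (upper ps) (R G)))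
        rest = complete ps oks cops (τ -ℚ R G) y τ′≡ low′ high′
        F = proj₁ rest
        RF = proj₁ (proj₂ rest)
        uF = proj₁ (proj₂ (proj₂ rest))
        m≤F = proj₁ (proj₂ (proj₂ (proj₂ rest)))
        shF = proj₁ (proj₂ (proj₂ (proj₂ (proj₂ rest))))
        σF = proj₂ (proj₂ (proj₂ (proj₂ (proj₂ rest))))
        cost : suc t * (p * 2 ^ (suc Hp + s)) ≤ cost₁
        cost = *-monoʳ-≤ (suc t) (begin
          p * 2 ^ (suc Hp + s)           ≡⟨ cong (p *_) (^-distribˡ-+-* 2 (suc Hp) s) ⟩
          p * (2 * 2 ^ Hp * 2 ^ s)       ≡⟨ lem p (2 ^ Hp) (2 ^ s) ⟩
          2 * 2 ^ s * (p * 2 ^ Hp)       ≤⟨ *-monoʳ-≤ (2 * 2 ^ s) small ⟩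
          2 * 2 ^ s * (2 * (2 ^ κ * m))  ∎)
          where
          lem : ∀ p a b → p * (2 * a * b) ≡ 2 * b * (p * a)
          lem = solve-∀
        disjoint : ∀ {v} → Shapeᵖ qs v → Shape ps v → ⊥
        disjoint (q , j , _ , _ , _ , v≡) (o , q′ , j′ , o∈ , q′∈ , _ , v≡′) =
          <-irrefl (sym (coprime-*ʳ (coprime-*ʳ (o⊥ o∈) (q⊥ q′∈)) (coprime-^ʳ j′ odd) (∣-refl , p∣))) 2≤p
          where
          p∣ : p ∣ o * q′ * 2 ^ j′
          p∣ = subst (p ∣_) (trans (sym v≡) v≡′) (∣-trans (m∣m*n q) (m∣m*n (2 ^ j)))
          o⊥ : ∀ {o} → (o ≡ 1 ⊎ o ∈ ps) → Coprime p o
          o⊥ (inj₁ refl) = coprime-1ʳ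
          o⊥ (inj₂ o∈)   = All.lookup p⊥ps o∈
          q⊥ : ∀ {q} → (q ≡ 1 ⊎ q ∈ qs) → Coprime p q
          q⊥ (inj₁ refl) = coprime-1ʳ
          q⊥ (inj₂ q∈)   = All.lookup p⊥qs q∈

-- The modulus M and the count of the numbers that do not divide it.

module Sieving where

  open import Data.Nat.Base
  open import Data.Nat.GCD using (gcd; gcd[m,n]∣m; gcd[m,n]∣n; gcd-greatest)
  open Sums
  open Primes

  power-between : ∀ {r} → 2 ≤ r → ∀ N → ∃ λ e → r ^ e ≤ suc N × suc N < r ^ suc e
  power-between {r} 2≤r zero    = 0 , ≤-refl , subst (1 <_) (sym (*-identityʳ r)) 2≤r
  power-between {r} 2≤r (suc N) with power-between 2≤r N
  ... | e , lo , hi with suc (suc N) <? r ^ suc e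
  ...   | yes hi′ = e , m≤n⇒m≤1+n lo , hi′
  ...   | no  ≥   = suc e , ≮⇒≥ ≥ , ≤-<-trans hi (^-monoʳ-< r 2≤r (n<1+n (suc e)))

  -- A base r < 2 is replaced by 2.
  maxPower : ℕ → ℕ → ℕ
  maxPower r N = proj₁ (power-between {2 + (r ∸ 2)} (s≤s (s≤s z≤n)) (N ∸ 1))

  maxPower-spec : ∀ {r N} → 2 ≤ r → 1 ≤ N → r ^ maxPower r N ≤ N × N < r ^ suc (maxPower r N)
  maxPower-spec {suc (suc r)} {suc N} (s≤s (s≤s _)) _ = proj₂ (power-between {2 + r} (s≤s (s≤s z≤n)) N)

  count-∷ : ∀ {p} {P : Pred ℕ p} (P? : Decidable P) a as → count P? as ≤ count P? (a ∷ as)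
  count-∷ P? a as with P? a
  ... | yes _ = n≤1+n _
  ... | no  _ = ≤-refl

  smallPrimes : ℕ → ℕ → List ℕ
  smallPrimes g k = filter (λ r → prime? r ×-dec ¬? (r ≟ g)) (interval 3 k)

  smallPrimes-many : ∀ g G → g ≤ G → ∀ T → ∃ λ k → G ≤ k × T ≤ length (smallPrimes g k)
  smallPrimes-many g G g≤G zero    = G , ≤-refl , z≤n
  smallPrimes-many g G g≤G (suc T) with smallPrimes-many g G g≤G T
  ... | k , G≤k , T≤ with prime-above (3 + k)
  ... | p , pp , 3+k<p = suc (p ∸ 3) , ≤-trans G≤k (≤-trans (<⇒≤ k<) (n≤1+n (p ∸ 3))) , new
    where
    g≤k = ≤-trans g≤G G≤k
    k< : k < p ∸ 3
    k< = m+n≤o⇒m≤o∸n (suc k) (subst (_≤ p) (+-comm 3 (suc k)) (subst (_≤ p) (sym (+-suc 3 k)) 3+k<p))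
    3+[p∸3] : 3 + (p ∸ 3) ≡ p
    3+[p∸3] = m+[n∸m]≡n (≤-trans (m≤m+n 3 k) (<⇒≤ 3+k<p))
    isSmall? : Decidable (λ r → Prime r × r ≢ g)
    isSmall? r = prime? r ×-dec ¬? (r ≟ g)
    mono : ∀ {i j} → i ≤′ j → count isSmall? (interval 3 i) ≤ count isSmall? (interval 3 j)
    mono ≤′-refl         = ≤-refl
    mono (≤′-step {j} h) = ≤-trans (mono h) (count-∷ isSmall? (3 + j) (interval 3 j))
    p≢g : p ≢ g
    p≢g p≡g = <⇒≢ (<-≤-trans (s≤s (≤-trans g≤k (m≤n+m k 2))) (≤-trans (n≤1+n _) 3+k<p)) (sym p≡g)
    new : suc T ≤ count isSmall? (interval 3 (suc (p ∸ 3)))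
    new = ≤-trans (s≤s (≤-trans T≤ (mono (≤⇒≤′ (<⇒≤ k<)))))
      (≤-reflexive (cong length (sym (List.filter-accept isSmall? {3 + (p ∸ 3)} {interval 3 (p ∸ 3)}
        (subst (λ z → Prime z × z ≢ g) (sym 3+[p∸3]) (pp , p≢g))))))

  module Modulus (g k s U : ℕ) where

    P : ℕ
    P = 3 + k

    rs qs ps : List ℕ
    rs = smallPrimes g k
    qs = map (λ r → r ^ maxPower r (2 ^ s)) rs
    ps = filter prime? (interval P (suc U ∸ P))

    Q W M : ℕ
    Q = product qs
    W = product ps
    M = 2 ^ s * (W * Q)

    SmallPrimePower : ℕ → Set
    SmallPrimePower q = ∃ λ r → ∃ λ e → Prime r × r ≢ g × 3 ≤ r × r < P × 1 ≤ e × q ≡ r ^ e × q ≤ 2 ^ s × 2 ^ s < r * q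

    rs-spec : All (λ r → Prime r × r ≢ g × 3 ≤ r × r < P) rs
    rs-spec = All.zipWith (λ ((p , q) , l , u) → p , q , l , u)
      (All.all-filter (λ r → prime? r ×-dec ¬? (r ≟ g)) (interval 3 k)
      , All.filter⁺ (λ r → prime? r ×-dec ¬? (r ≟ g)) (interval-bounds 3 k))

    ps-spec : All (λ p → Prime p × P ≤ p × p ≤ U) ps
    ps-spec = All.zipWith (λ (p , l , u) → p , l , bound l u)
      (All.all-filter prime? (interval P (suc U ∸ P)) , All.filter⁺ prime? (interval-bounds P (suc U ∸ P)))
      where
      bound : ∀ {p} → P ≤ p → p < P + (suc U ∸ P) → p ≤ U
      bound {p} l u with P ≤? suc U
      ... | yes P≤ = ≤-pred (subst (p <_) (m+[n∸m]≡n P≤) u)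
      ... | no  P> = ⊥-elim (<⇒≱ u (subst (_≤ p) (sym (trans (cong (P +_) (m≤n⇒m∸n≡0 (<⇒≤ (≰⇒> P>)))) (+-identityʳ P))) l))

    ps-coprime : AllPairs Coprime ps
    ps-coprime = primes-pairwise-coprime (Unique.filter⁺ prime? (interval-unique P (suc U ∸ P))) (All.map proj₁ ps-spec)

    length-ps : length ps ≤ U
    length-ps = ≤-trans (List.length-filter prime? (interval P (suc U ∸ P)))
      (≤-trans (≤-reflexive (length-interval P (suc U ∸ P))) (∸-monoʳ-≤ {n = P} (suc U) (s≤s z≤n)))

    qs-coprime : AllPairs Coprime qs
    qs-coprime = powers (primes-pairwise-coprime (Unique.filter⁺ _ (interval-unique 3 k)) (All.map proj₁ rs-spec))
      where
      f : ℕ → ℕ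
      f r = r ^ maxPower r (2 ^ s)
      one : ∀ {r xs} → All (Coprime r) xs → All (Coprime (f r)) (map f xs)
      one []       = []
      one {r} {x ∷ _} (c ∷ h) = coprime-^ʳ (maxPower x (2 ^ s)) (Coprimality.sym (coprime-^ʳ (maxPower r (2 ^ s)) (Coprimality.sym c))) ∷ one h
      powers : ∀ {xs} → AllPairs Coprime xs → AllPairs Coprime (map f xs)
      powers []      = []
      powers (c ∷ h) = one c ∷ powers h

    module _ (P≤2ˢ : P * P * P ≤ 2 ^ s) where

      private
        P≤P³ : P ≤ P * P * P
        P≤P³ = ≤-trans (m≤m*n P (P * P)) (≤-reflexive (sym (*-assoc P P P)))

        spec : ∀ {r} → 2 ≤ r → r ^ maxPower r (2 ^ s) ≤ 2 ^ s × 2 ^ s < r ^ suc (maxPower r (2 ^ s))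
        spec 2≤r = maxPower-spec 2≤r (m^n>0 2 s)

        exponent≥1 : ∀ {r} → 2 ≤ r → r < P → 1 ≤ maxPower r (2 ^ s)
        exponent≥1 {r} 2≤r r<P with maxPower r (2 ^ s) | proj₂ (spec 2≤r)
        ... | zero  | h = ⊥-elim (<⇒≱ h (≤-trans (≤-reflexive (*-identityʳ r)) (≤-trans (<⇒≤ r<P) (≤-trans P≤P³ P≤2ˢ))))
        ... | suc _ | _ = s≤s z≤n

      q-prime-power : ∀ {q} → q ∈ qs → SmallPrimePower q
      q-prime-power q∈ with ∈.∈-map⁻ (λ r → r ^ maxPower r (2 ^ s)) q∈
      ... | r , r∈ , refl with All.lookup rs-spec r∈
      ...   | pr , r≢g , 3≤r , r<P = r , maxPower r (2 ^ s) , pr , r≢g , 3≤r , r<P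
            , exponent≥1 2≤r r<P , refl , spec 2≤r
        where 2≤r = ≤-trans (n≤1+n 2) 3≤r

      -- p · gcd (n, M) ∣ n says that p occurs in n to a higher power than in M.
      private
        climb : ∀ {p n i} → p * gcd n M ∣ n → p ^ i ∣ M → p ^ suc i ∣ n
        climb {p} {n} {i} pG∣n pⁱ∣M = go i ≤-refl
          where
          go : ∀ j → j ≤ i → p ^ suc j ∣ n
          go zero    _   = ∣-trans (subst (_∣ p * gcd n M) (sym (*-identityʳ p)) (m∣m*n (gcd n M))) pG∣n
          go (suc j) j<i = ∣-trans (*-monoʳ-∣ p (gcd-greatest (go j (<⇒≤ j<i))
            (∣-trans (divides (p ^ (i ∸ suc j)) (trans (cong (p ^_) (sym (m∸n+n≡m j<i))) (^-distribˡ-+-* p (i ∸ suc j) (suc j)))) pⁱ∣M))) pG∣n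

        halve : ∀ e → ∃ λ f → suc e ≡ f + f ⊎ suc e ≡ suc (f + f)
        halve zero    = 0 , inj₂ refl
        halve (suc e) with halve e
        ... | f , inj₁ eq = f , inj₂ (cong suc eq)
        ... | f , inj₂ eq = suc f , inj₁ (trans (cong suc eq) (cong suc (sym (+-suc f f))))

        -- Take w = p^f with f half of the exponent, rounded down. If w < P, then p^(e + 1) ≤ p w²
        -- would be at most P³ ≤ 2^s.
        big-square : ∀ {p e n} → 2 ≤ p → p < P → p ^ suc e ∣ n → 2 ^ s < p ^ suc e → ∃ λ w → P ≤ w × w * w ∣ n
        big-square {p} {e} {n} 2≤p p<P p∣n big with halve e
        ... | f , parity = p ^ f , P≤w , ∣-trans (ww∣ parity) p∣n
          where
          open ≤-Reasoning
          instance
            _ = >-nonZero (≤-trans (n≤1+n 1) 2≤p)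
          w = p ^ f
          ww : p ^ (f + f) ≡ w * w
          ww = ^-distribˡ-+-* p f f
          ww∣ : suc e ≡ f + f ⊎ suc e ≡ suc (f + f) → w * w ∣ p ^ suc e
          ww∣ (inj₁ eq) = ∣-reflexive (sym (trans (cong (p ^_) eq) ww))
          ww∣ (inj₂ eq) = divides p (trans (cong (p ^_) eq) (cong (p *_) ww))
          small : suc e ≡ f + f ⊎ suc e ≡ suc (f + f) → p ^ suc e ≤ p * (w * w)
          small (inj₁ eq) = ≤-trans (≤-reflexive (trans (cong (p ^_) eq) ww)) (m≤n*m (w * w) p)
          small (inj₂ eq) = ≤-reflexive (trans (cong (p ^_) eq) (cong (p *_) ww))
          P≤w : P ≤ w
          P≤w = ≮⇒≥ λ w<P → <⇒≱ big (begin
            p ^ suc e     ≤⟨ small parity ⟩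
            p * (w * w)   ≤⟨ *-mono-≤ (<⇒≤ p<P) (*-mono-≤ (<⇒≤ w<P) (<⇒≤ w<P)) ⟩
            P * (P * P)   ≡⟨ *-assoc P P P ⟨
            P * P * P     ≤⟨ P≤2ˢ ⟩
            2 ^ s         ∎)

      -- A prime p dividing n / gcd (n, M) occurs in n to a higher power than in M. If p = g or p >
      -- U, this is one of the exceptions. If p < P, its power in n exceeds 2^s and contains a large
      -- square; if P ≤ p ≤ U, then p² divides n, as p itself divides M.
      nondivisor : ∀ {n} → 1 ≤ n → ¬ n ∣ M → g ∣ n ⊎ (∃ λ w → P ≤ w × w * w ∣ n) ⊎ (∃ λ p → Prime p × U < p × p ∣ n)
      nondivisor {n} 1≤n n∤M = found (prime-factor 2≤quotient)
        where
        instance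
          _ = >-nonZero 1≤n
        G = gcd n M
        G∣n = gcd[m,n]∣m n M
        n′ = quotient G∣n
        n≡ : n ≡ n′ * G
        n≡ = _∣_.equality G∣n
        2≤quotient : 2 ≤ n′
        2≤quotient = ≰⇒> λ n′≤1 → n∤M (case n′≤1)
          where
          case : n′ ≤ 1 → n ∣ M
          case n′≤1 with n≤1⇒n≡0∨n≡1 n′≤1
          ... | inj₁ n′≡0 = ⊥-elim (<-irrefl (sym (trans n≡ (cong (_* G) n′≡0))) 1≤n)
          ... | inj₂ n′≡1 = subst (_∣ M) (sym (trans n≡ (trans (cong (_* G) n′≡1) (*-identityˡ G)))) (gcd[m,n]∣n n M)
        found : (∃ λ p → Prime p × p ∣ n′) → _
        found (p , pp , p∣n′) = decide
          where
          2≤p = prime≥2 pp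
          pG∣n : p * G ∣ n
          pG∣n = subst (p * G ∣_) (sym n≡) (*-monoˡ-∣ G p∣n′)
          p∣n : p ∣ n
          p∣n = ∣-trans (m∣m*n G) pG∣n
          p≤P→ : p < P → p ≢ g → p ^ maxPower p (2 ^ s) ∣ M
          p≤P→ p<P p≢g with m≤n⇒m<n∨m≡n 2≤p
          ... | inj₁ 3≤p  = ∣-trans (ListAction.∈⇒∣product (∈.∈-map⁺ (λ r → r ^ maxPower r (2 ^ s))
                  (∈.∈-filter⁺ (λ r → prime? r ×-dec ¬? (r ≟ g)) (∈-interval k 3≤p p<P) (pp , p≢g))))
                  (∣-trans (n∣m*n W) (n∣m*n (2 ^ s)))
          ... | inj₂ refl = ∣-trans (divides (2 ^ (s ∸ e)) (trans (cong (2 ^_) (sym (m∸n+n≡m e≤s))) (^-distribˡ-+-* 2 (s ∸ e) e))) (m∣m*n (W * Q))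
            where
            e = maxPower 2 (2 ^ s)
            e≤s : e ≤ s
            e≤s = 2^-cancel-≤ (proj₁ (spec 2≤p))
          decide : g ∣ n ⊎ (∃ λ w → P ≤ w × w * w ∣ n) ⊎ (∃ λ p → Prime p × U < p × p ∣ n)
          decide with p ≟ g | p <? P | p ≤? U
          ... | yes refl | _       | _      = inj₁ p∣n
          ... | no p≢g   | yes p<P | _      = inj₂ (inj₁ (big-square {p} {maxPower p (2 ^ s)} 2≤p p<P (climb {p} {n} {maxPower p (2 ^ s)} pG∣n (p≤P→ p<P p≢g)) (proj₂ (spec 2≤p))))
          ... | no p≢g   | no p≥P  | yes p≤U = inj₂ (inj₁ (p , ≮⇒≥ p≥P , subst (λ z → p * z ∣ n) (*-identityʳ p) (climb {p} {n} {1} pG∣n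
                  (subst (_∣ M) (sym (*-identityʳ p)) (∣-trans (ListAction.∈⇒∣product (∈.∈-filter⁺ prime? (∈-interval (suc U ∸ P) (≮⇒≥ p≥P)
                     (subst (p <_) (sym (m+[n∸m]≡n (≤-trans (≮⇒≥ p≥P) (m≤n⇒m≤1+n p≤U)))) (s≤s p≤U))) pp)) (∣-trans (m∣m*n Q) (n∣m*n (2 ^ s))))))))
          ... | no p≢g   | no p≥P  | no p>U = inj₂ (inj₂ (p , pp , ≰⇒> p>U , p∣n))

  squares : ℕ → ℕ → List ℕ
  squares a zero    = []
  squares a (suc j) = (a + suc j) * (a + suc j) ∷ squares a j

  ∈-squares : ∀ {a w} j → a < w → w ≤ a + j → w * w ∈ squares a j
  ∈-squares {a} {w} zero    a<w w≤ = ⊥-elim (<⇒≱ a<w (subst (w ≤_) (+-identityʳ a) w≤))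
  ∈-squares {a} {w} (suc j) a<w w≤ with m≤n⇒m<n∨m≡n w≤
  ... | inj₁ w<   = there (∈-squares j a<w (≤-pred (subst (w <_) (+-suc a j) w<)))
  ... | inj₂ refl = here refl

  module Counting {X : ℕ} (c : ℕ → ℕ) (c-bound : ∀ d → c d * d ≤ X) where

    private
      ∑c : List ℕ → ℕ
      ∑c ds = sum (map c ds)

      ∑c-++ : ∀ as bs → ∑c (as ++ bs) ≡ ∑c as + ∑c bs
      ∑c-++ as bs = trans (cong sum (List.map-++ c as bs)) (ListAction.sum-++ (map c as) (map c bs))

    -- Σ 1 / w² over a < w ≤ a + j is at most j / (a (a + j)).
    squares-count : ∀ {a} → 1 ≤ a → ∀ j → ∑c (squares a j) * a ≤ X
    squares-count {a} 1≤a j = *-cancelʳ-≤ (∑c (squares a j) * a) X (a + j) (begin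
        ∑c (squares a j) * a * (a + j)    ≡⟨ *-assoc (∑c (squares a j)) a (a + j) ⟩
        ∑c (squares a j) * (a * (a + j))  ≤⟨ go j ⟩
        X * j                             ≤⟨ *-monoʳ-≤ X (m≤n+m j a) ⟩
        X * (a + j)                       ∎)
      where
      open ≤-Reasoning
      instance
        _ = >-nonZero (≤-trans 1≤a (m≤m+n a j))
      go : ∀ j → ∑c (squares a j) * (a * (a + j)) ≤ X * j
      go zero    = z≤n
      go (suc j) = *-cancelʳ-≤ _ _ (a + j) {{>-nonZero (≤-trans 1≤a (m≤m+n a j))}} (begin
          (cw + S) * (a * (a + suc j)) * (a + j)                         ≡⟨ lem₁ cw S a (a + j) (a + suc j) ⟩
          cw * ((a + suc j) * (a + j)) * a + S * (a * (a + j)) * (a + suc j)  ≤⟨ +-mono-≤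
             (*-monoˡ-≤ a (≤-trans (*-monoʳ-≤ cw (*-monoʳ-≤ (a + suc j) (+-monoʳ-≤ a (n≤1+n j)))) (c-bound ((a + suc j) * (a + suc j)))))
             (*-monoˡ-≤ (a + suc j) (go j)) ⟩
          X * a + X * j * (a + suc j)                                    ≡⟨ lem₂ X a j ⟩
          X * suc j * (a + j)                                            ∎)
        where
        S = ∑c (squares a j)
        cw = c ((a + suc j) * (a + suc j))
        lem₁ : ∀ c s a x y → (c + s) * (a * y) * x ≡ c * (y * x) * a + s * (a * x) * y
        lem₁ = solve-∀
        lem₂ : ∀ X a j → X * a + X * j * (a + suc j) ≡ X * suc j * (a + j)
        lem₂ = solve-∀

    -- There are at most 2^(k + 1) / k primes in the block by Chebyshev's bound, and each has at
    -- most X / 2^k multiples.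
    dyadic-count : ∀ k → ∑c (dyadicPrimes k) * k ≤ 2 * X
    dyadic-count k = *-cancelʳ-≤ _ _ (2 ^ k) {{m^n≢0 2 k}} (begin
        ∑c ps * k * 2 ^ k       ≡⟨ lem (∑c ps) k (2 ^ k) ⟩
        k * (∑c ps * 2 ^ k)     ≤⟨ *-monoʳ-≤ k (each (All.map (λ (_ , l , _) → <⇒≤ l) (dyadicPrimes-spec k))) ⟩
        k * (length ps * X)     ≡⟨ *-assoc k (length ps) X ⟨
        k * length ps * X       ≤⟨ *-monoˡ-≤ X (dyadicPrimes-count k) ⟩
        2 * 2 ^ k * X           ≡⟨ lem′ (2 ^ k) X ⟩
        2 * X * 2 ^ k           ∎)
      where
      open ≤-Reasoning
      ps = dyadicPrimes k
      lem : ∀ a k x → a * k * x ≡ k * (a * x)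
      lem = solve-∀
      lem′ : ∀ x y → 2 * x * y ≡ 2 * y * x
      lem′ = solve-∀
      each : ∀ {ds} → All (2 ^ k ≤_) ds → ∑c ds * 2 ^ k ≤ length ds * X
      each []                = z≤n
      each {d ∷ ds} (h ∷ hs) = ≤-trans (≤-reflexive (*-distribʳ-+ (2 ^ k) (c d) (∑c ds)))
        (+-mono-≤ (≤-trans (*-monoʳ-≤ (c d) h) (c-bound d)) (each hs))

    -- Each of the j blocks contributes at most 2 X / k. Using the factor 1 / k of the lowest block
    -- throughout is harmless, since j will be small against k.
    primes-count : ∀ k j → ∑c (primesBetween k j) * k ≤ 2 * X * j
    primes-count k zero    = z≤n
    primes-count k (suc j) = begin
        ∑c (dyadicPrimes (k + j) ++ primesBetween k j) * k                       ≡⟨ cong (_* k) (∑c-++ (dyadicPrimes (k + j)) (primesBetween k j)) ⟩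
        (∑c (dyadicPrimes (k + j)) + ∑c (primesBetween k j)) * k                 ≡⟨ *-distribʳ-+ k (∑c (dyadicPrimes (k + j))) _ ⟩
        ∑c (dyadicPrimes (k + j)) * k + ∑c (primesBetween k j) * k               ≤⟨ +-mono-≤ (≤-trans (*-monoʳ-≤ (∑c (dyadicPrimes (k + j))) (m≤m+n k j)) (dyadic-count (k + j))) (primes-count k j) ⟩
        2 * X + 2 * X * j                                                        ≡⟨ *-suc (2 * X) j ⟨
        2 * X * suc j                                                            ∎
      where
      open ≤-Reasoning

    count-++₃ : ∀ g as bs → ∑c (g ∷ as ++ bs) ≡ c g + (∑c as + ∑c bs)
    count-++₃ g as bs = cong (c g +_) (∑c-++ as bs)

  module _ (g k s k₀ : ℕ) where

    open Modulus g k s (2 ^ k₀)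

    -- The three numbers count the multiples of g, of large squares and of large primes.
    -- `squares (2 + k)` begins with the square of 3 + k = P, hence the factor 2 + k in the second
    -- bound.
    nondivisors-count : P * P * P ≤ 2 ^ s → ∀ m → 1 ≤ m → ∀ l j → m + l ≤ 2 ^ (k₀ + j) →
      ∃ λ a → ∃ λ b → ∃ λ c → count (λ n → ¬? (n ∣? M)) (interval m l) ≤ a + (b + c) ×
        a * g ≤ m + l × b * (2 + k) ≤ m + l × c * k₀ ≤ 2 * (m + l) * j
    nondivisors-count P³≤ m 1≤m l j X≤ =
        mult g , sum (map mult (squares (2 + k) (m + l))) , sum (map mult (primesBetween k₀ j))
      , ≤-trans (union-bound (λ n → ¬? (n ∣? M)) ds (All.map (λ (m≤n , n<) → covered m≤n n<) (interval-bounds m l)))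
          (≤-reflexive (count-++₃ g (squares (2 + k) (m + l)) (primesBetween k₀ j)))
      , <⇒≤ (multiples-bound m 1≤m l g) , squares-count (s≤s z≤n) (m + l) , primes-count k₀ j
      where
      mult = multiplesIn (interval m l)
      open Counting {m + l} mult (λ d → <⇒≤ (multiples-bound m 1≤m l d))
      ds = g ∷ squares (2 + k) (m + l) ++ primesBetween k₀ j
      covered : ∀ {n} → m ≤ n → n < m + l → ¬ n ∣ M → Any (_∣ n) ds
      covered {n} m≤n n<X n∤M with nondivisor P³≤ (≤-trans 1≤m m≤n) n∤M
      ... | inj₁ g∣n = here g∣n
      ... | inj₂ (inj₁ (w , P≤w , ww∣n)) = there (Any.++⁺ˡ (Any.map (λ { refl → ww∣n }) (∈-squares (m + l) P≤w
              (≤-trans (≤-trans (m≤m*n w w {{>-nonZero (≤-trans (s≤s z≤n) P≤w)}}) (∣⇒≤ {{>-nonZero (≤-trans 1≤m m≤n)}} ww∣n)) (≤-trans (<⇒≤ n<X) (m≤n+m (m + l) (2 + k)))))))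
      ... | inj₂ (inj₂ (p , pp , U<p , p∣n)) = there (Any.++⁺ʳ (squares (2 + k) (m + l)) (Any.map (λ { refl → p∣n })
              (∈-primesBetween k₀ j pp U<p (≤-trans (∣⇒≤ {{>-nonZero (≤-trans 1≤m m≤n)}} p∣n) (≤-trans (<⇒≤ n<X) X≤)))))

-- The truncated exponential series, harmonic sums and the lower bound for sums.

module Exponential where

  open import Algebra.Definitions.RawSemiring using (_^_)
  open import Data.Nat.Base using (ℕ; zero; suc; _+_; _*_; _∸_; _≤_; _<_; z≤n; s≤s; _!)
  open import Data.Rational.Base using (+-*-rawSemiring)
  open +-*-Solver
  open Rationals
  open Sums

  pw : ℚ → ℕ → ℚ
  pw = _^_ +-*-rawSemiring

  expTerm≡ : ∀ q i → expTerm q i ≡ pw q i *ℚ inv (i !)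
  expTerm≡ q i = cong (pw q i *ℚ_) (inv-unit (i !) (i !≢0))

  0≤pw : ∀ {q} → 0ℚ ≤ℚ q → ∀ i → 0ℚ ≤ℚ pw q i
  0≤pw 0≤q zero    = 0≤1ℚ
  0≤pw 0≤q (suc i) = 0≤*ℚ 0≤q (0≤pw 0≤q i)

  pw-mono : ∀ {p q} → 0ℚ ≤ℚ p → p ≤ℚ q → ∀ i → pw p i ≤ℚ pw q i
  pw-mono 0≤p p≤q zero    = ℚ.≤-refl
  pw-mono 0≤p p≤q (suc i) = *ℚ-mono 0≤p p≤q (0≤pw 0≤p i) (pw-mono 0≤p p≤q i)

  private
    module Bernoulli {p q : ℚ} (0≤p : 0ℚ ≤ℚ p) (0≤q : 0ℚ ≤ℚ q) where

      s = p +ℚ q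

      0≤s : 0ℚ ≤ℚ s
      0≤s = 0≤+ℚ 0≤p 0≤q

      q≤s : q ≤ℚ s
      q≤s = ≤-by p 0≤p (ℚ.+-comm p q)

      -- The mean value inequality for x^(i + 1) on [q, p + q], with the derivative at the left end;
      -- `upper` has it at the right end. Divided by (i + 1)!, they compare consecutive terms of the
      -- exponential series.
      lower : ∀ i → pw q (suc i) +ℚ ι (suc i) *ℚ (p *ℚ pw q i) ≤ℚ pw s (suc i)
      lower zero    = ℚ.≤-reflexive (trans (cong (λ z → q *ℚ 1ℚ +ℚ z *ℚ (p *ℚ 1ℚ)) ι-1)
        (solve 2 (λ p q → q :* con 1ℚ :+ con 1ℚ :* (p :* con 1ℚ) := (p :+ q) :* con 1ℚ) refl p q))
      lower (suc i) = ℚ.≤-trans (≤-by (ι (suc i) *ℚ (p *ℚ p *ℚ pw q i))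
          (0≤*ℚ (0≤ι (suc i)) (0≤*ℚ (0≤*ℚ 0≤p 0≤p) (0≤pw 0≤q i)))
          (trans (solve 4 (λ p q n x → (p :+ q) :* (q :* x :+ n :* (p :* x))
             := q :* (q :* x) :+ (con 1ℚ :+ n) :* (p :* (q :* x)) :+ n :* (p :* p :* x)) refl p q (ι (suc i)) (pw q i))
            (cong (λ z → pw q (suc (suc i)) +ℚ z *ℚ (p *ℚ pw q (suc i)) +ℚ ι (suc i) *ℚ (p *ℚ p *ℚ pw q i))
              (trans (cong (_+ℚ ι (suc i)) (sym ι-1)) (sym (ι-+ 1 (suc i)))))))
        (*ℚ-monoˡ 0≤s (lower i))

      upper : ∀ i → pw s (suc i) ≤ℚ pw q (suc i) +ℚ ι (suc i) *ℚ (p *ℚ pw s i)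
      upper zero    = ℚ.≤-reflexive (sym (trans (cong (λ z → q *ℚ 1ℚ +ℚ z *ℚ (p *ℚ 1ℚ)) ι-1)
        (solve 2 (λ p q → q :* con 1ℚ :+ con 1ℚ :* (p :* con 1ℚ) := (p :+ q) :* con 1ℚ) refl p q)))
      upper (suc i) = ℚ.≤-trans (*ℚ-monoˡ 0≤s (upper i)) (≤-by (p *ℚ (pw s (suc i) -ℚ pw q (suc i)))
          (0≤*ℚ 0≤p (≤⇒0≤-ℚ (pw-mono 0≤q q≤s (suc i))))
          (trans (cong (λ z → pw q (suc (suc i)) +ℚ z *ℚ (p *ℚ pw s (suc i))) (trans (ι-+ 1 (suc i)) (cong (_+ℚ ι (suc i)) ι-1)))
            (solve 5 (λ p q n x y → q :* y :+ (con 1ℚ :+ n) :* (p :* ((p :+ q) :* x))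
              := (p :+ q) :* (y :+ n :* (p :* x)) :+ p :* ((p :+ q) :* x :- y)) refl p q (ι (suc i)) (pw s i) (pw q (suc i)))))

      suc-inv-! : ∀ i → ι (suc i) *ℚ inv (suc i !) ≡ inv (i !)
      suc-inv-! i = trans (cong (ι (suc i) *ℚ_) (inv-* (s≤s z≤n) (1≤n! i)))
        (trans (sym (ℚ.*-assoc (ι (suc i)) (inv (suc i)) (inv (i !)))) (trans (cong (_*ℚ inv (i !)) (ι-inv {suc i} (s≤s z≤n))) (ℚ.*-identityˡ (inv (i !)))))

      shift : ∀ x y i → (x +ℚ ι (suc i) *ℚ (p *ℚ y)) *ℚ inv (suc i !) ≡ x *ℚ inv (suc i !) +ℚ p *ℚ (y *ℚ inv (i !))
      shift x y i = trans (solve 5 (λ x n p y f → (x :+ n :* (p :* y)) :* f := x :* f :+ p :* (y :* (n :* f))) refl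
          x (ι (suc i)) p y (inv (suc i !))) (cong (λ z → x *ℚ inv (suc i !) +ℚ p *ℚ (y *ℚ z)) (suc-inv-! i))

      term-lower : ∀ i → expTerm q (suc i) +ℚ p *ℚ expTerm q i ≤ℚ expTerm s (suc i)
      term-lower i = subst₂ _≤ℚ_
        (trans (shift (pw q (suc i)) (pw q i) i) (sym (cong₂ (λ a b → a +ℚ p *ℚ b) (expTerm≡ q (suc i)) (expTerm≡ q i))))
        (sym (expTerm≡ s (suc i))) (*ℚ-monoʳ (0≤inv (suc i !)) (lower i))

      term-upper : ∀ i → expTerm s (suc i) ≤ℚ expTerm q (suc i) +ℚ p *ℚ expTerm s i
      term-upper i = subst₂ _≤ℚ_ (sym (expTerm≡ s (suc i)))
        (trans (shift (pw q (suc i)) (pw s i) i) (sym (cong₂ (λ a b → a +ℚ p *ℚ b) (expTerm≡ q (suc i)) (expTerm≡ s i))))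
        (*ℚ-monoʳ (0≤inv (suc i !)) (upper i))

  0≤expTerm : ∀ {q} → 0ℚ ≤ℚ q → ∀ i → 0ℚ ≤ℚ expTerm q i
  0≤expTerm {q} 0≤q i = subst (0ℚ ≤ℚ_) (sym (expTerm≡ q i)) (0≤*ℚ (0≤pw 0≤q i) (0≤inv (i !)))

  expSum-mono : ∀ {p q} → 0ℚ ≤ℚ p → p ≤ℚ q → ∀ N → expSum p N ≤ℚ expSum q N
  expSum-mono 0≤p p≤q zero    = ℚ.≤-refl
  expSum-mono {p} {q} 0≤p p≤q (suc N) = ℚ.+-mono-≤ (expSum-mono 0≤p p≤q N)
    (subst₂ _≤ℚ_ (sym (expTerm≡ p N)) (sym (expTerm≡ q N)) (*ℚ-monoʳ (0≤inv (N !)) (pw-mono 0≤p p≤q N)))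

  expSum-step : ∀ {q} → 0ℚ ≤ℚ q → ∀ N → expSum q N ≤ℚ expSum q (suc N)
  expSum-step {q} 0≤q N = ≤-by (expTerm q N) (0≤expTerm 0≤q N) refl

  expSum-+ : ∀ {q} → 0ℚ ≤ℚ q → ∀ N k → expSum q N ≤ℚ expSum q (k + N)
  expSum-+ 0≤q N zero    = ℚ.≤-refl
  expSum-+ 0≤q N (suc k) = ℚ.≤-trans (expSum-+ 0≤q N k) (expSum-step 0≤q (k + N))

  expSum-≤ : ∀ {q} → 0ℚ ≤ℚ q → ∀ {M N} → M ≤ N → expSum q M ≤ℚ expSum q N
  expSum-≤ {q} 0≤q {M} {N} M≤N = subst (λ z → expSum q M ≤ℚ expSum q z) (m∸n+n≡m M≤N) (expSum-+ 0≤q M (N ∸ M))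

  expSum-1 : ∀ q → expSum q 1 ≡ 1ℚ
  expSum-1 q = trans (ℚ.+-identityˡ (expTerm q 0)) (trans (expTerm≡ q 0) (trans (cong (1ℚ *ℚ_) inv-1) (ℚ.*-identityˡ 1ℚ)))

  0≤expSum : ∀ {q} → 0ℚ ≤ℚ q → ∀ N → 0ℚ ≤ℚ expSum q N
  0≤expSum 0≤q N = expSum-≤ 0≤q {0} {N} z≤n

  -- The truncated form of (1 + p) e^q ≤ e^(p + q). Multiplication by p moves a term of degree i to
  -- degree i + 1, so the truncation index rises by one.
  expSum-lower : ∀ {p q} → 0ℚ ≤ℚ p → 0ℚ ≤ℚ q → ∀ N → (1ℚ +ℚ p) *ℚ expSum q N ≤ℚ expSum (p +ℚ q) (suc N)
  expSum-lower {p} {q} 0≤p 0≤q N = ℚ.≤-trans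
    (≤-by (expTerm q N) (0≤expTerm 0≤q N) (solve 3 (λ e t p → e :+ t :+ p :* e := (con 1ℚ :+ p) :* e :+ t) refl (expSum q N) (expTerm q N) p))
    (go N)
    where
    open Bernoulli 0≤p 0≤q
    go : ∀ N → expSum q (suc N) +ℚ p *ℚ expSum q N ≤ℚ expSum (p +ℚ q) (suc N)
    go zero    = ℚ.≤-reflexive (trans (cong₂ _+ℚ_ (expSum-1 q) (ℚ.*-zeroʳ p)) (sym (trans (expSum-1 (p +ℚ q)) (sym (ℚ.+-identityʳ 1ℚ)))))
    go (suc N) = ℚ.≤-trans (ℚ.≤-reflexive (solve 5 (λ a t b p u → a :+ t :+ p :* (b :+ u) := (a :+ p :* b) :+ (t :+ p :* u)) refl
        (expSum q (suc N)) (expTerm q (suc N)) (expSum q N) p (expTerm q N)))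
      (ℚ.+-mono-≤ (go N) (term-lower N))

  -- That is, (1 - p) e^(p + q) ≤ e^q.
  expSum-upper : ∀ {p q} → 0ℚ ≤ℚ p → 0ℚ ≤ℚ q → ∀ N → expSum (p +ℚ q) N ≤ℚ expSum q N +ℚ p *ℚ expSum (p +ℚ q) N
  expSum-upper {p} {q} 0≤p 0≤q zero    = ℚ.≤-reflexive (sym (trans (ℚ.+-identityˡ (p *ℚ 0ℚ)) (ℚ.*-zeroʳ p)))
  expSum-upper {p} {q} 0≤p 0≤q (suc N) = ℚ.≤-trans (go N) (ℚ.+-monoʳ-≤ (expSum q (suc N)) (*ℚ-monoˡ 0≤p (expSum-step 0≤s N)))
    where
    open Bernoulli 0≤p 0≤q
    go : ∀ N → expSum s (suc N) ≤ℚ expSum q (suc N) +ℚ p *ℚ expSum s N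
    go zero    = ℚ.≤-reflexive (trans (expSum-1 s) (sym (trans (cong₂ _+ℚ_ (expSum-1 q) (ℚ.*-zeroʳ p)) (ℚ.+-identityʳ 1ℚ))))
    go (suc N) = ℚ.≤-trans (ℚ.+-mono-≤ (go N) (term-upper N))
      (ℚ.≤-reflexive (solve 5 (λ a t b p u → a :+ p :* b :+ (t :+ p :* u) := a :+ t :+ p :* (b :+ u)) refl
        (expSum q (suc N)) (expTerm q (suc N)) (expSum s N) p (expTerm s N)))

  harmonic : ℕ → ℕ → ℚ
  harmonic m k = R (interval m k)

  0≤harmonic : ∀ m k → 0ℚ ≤ℚ harmonic m k
  0≤harmonic m k = R≥0 (interval m k)

  private
    split : ∀ u h → (u +ℚ h) +ℚ (u +ℚ h) ≡ u +ℚ (u +ℚ (h +ℚ h))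
    split = solve 2 (λ u h → (u :+ h) :+ (u :+ h) := u :+ (u :+ (h :+ h))) refl

  -- The product of (1 + 1 / a)² over the interval telescopes to the square of (m + k) / m. Each of
  -- the k numbers enters with two factors, and each factor raises the truncation index by one,
  -- hence 2 k + 1.
  expSum-harmonic-lower : ∀ m → 1 ≤ m → ∀ k →
    ι (m + k) *ℚ ι (m + k) ≤ℚ ι m *ℚ ι m *ℚ expSum (harmonic m k +ℚ harmonic m k) (suc (k + k))
  expSum-harmonic-lower m 1≤m zero    = ℚ.≤-reflexive (trans (cong (λ z → ι z *ℚ ι z) (+-identityʳ m))
    (sym (trans (cong (ι m *ℚ ι m *ℚ_) (expSum-1 (0ℚ +ℚ 0ℚ))) (ℚ.*-identityʳ (ι m *ℚ ι m)))))
  expSum-harmonic-lower m 1≤m (suc k) = begin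
      ι (m + suc k) *ℚ ι (m + suc k)                         ≡⟨ cong (λ z → z *ℚ z) grow ⟩
      (1ℚ +ℚ u) *ℚ x *ℚ ((1ℚ +ℚ u) *ℚ x)                     ≡⟨ solve 2 (λ a x → a :* x :* (a :* x) := a :* a :* (x :* x)) refl (1ℚ +ℚ u) x ⟩
      (1ℚ +ℚ u) *ℚ (1ℚ +ℚ u) *ℚ (x *ℚ x)                     ≤⟨ *ℚ-monoˡ (0≤*ℚ 0≤1+u 0≤1+u) (expSum-harmonic-lower m 1≤m k) ⟩
      (1ℚ +ℚ u) *ℚ (1ℚ +ℚ u) *ℚ (ι m *ℚ ι m *ℚ E)            ≡⟨ solve 3 (λ a m e → a :* a :* (m :* m :* e) := m :* m :* (a :* (a :* e))) refl (1ℚ +ℚ u) (ι m) E ⟩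
      ι m *ℚ ι m *ℚ ((1ℚ +ℚ u) *ℚ ((1ℚ +ℚ u) *ℚ E))          ≤⟨ *ℚ-monoˡ 0≤mm (*ℚ-monoˡ 0≤1+u (expSum-lower 0≤u 0≤2h N)) ⟩
      ι m *ℚ ι m *ℚ ((1ℚ +ℚ u) *ℚ expSum (u +ℚ (h +ℚ h)) (suc N))   ≤⟨ *ℚ-monoˡ 0≤mm (expSum-lower 0≤u (0≤+ℚ 0≤u 0≤2h) (suc N)) ⟩
      ι m *ℚ ι m *ℚ expSum (u +ℚ (u +ℚ (h +ℚ h))) (suc (suc N))     ≡⟨ cong₂ (λ a b → ι m *ℚ ι m *ℚ expSum a (suc b)) (split u h) (cong suc (+-suc k k)) ⟨
      ι m *ℚ ι m *ℚ expSum (harmonic m (suc k) +ℚ harmonic m (suc k)) (suc (suc k + suc k)) ∎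
    where
    open ℚ.≤-Reasoning
    h = harmonic m k
    u = inv (m + k)
    x = ι (m + k)
    N = suc (k + k)
    E = expSum (h +ℚ h) N
    0≤u = 0≤inv (m + k)
    0≤1+u = 0≤+ℚ 0≤1ℚ 0≤u
    0≤2h = 0≤+ℚ (0≤harmonic m k) (0≤harmonic m k)
    0≤mm = 0≤*ℚ (0≤ι m) (0≤ι m)
    1≤m+k = ≤-trans 1≤m (m≤m+n m k)
    grow : ι (m + suc k) ≡ (1ℚ +ℚ u) *ℚ x
    grow = trans (cong ι (+-suc m k)) (trans (ι-+ 1 (m + k)) (trans (cong₂ _+ℚ_ (trans ι-1 (sym (ι-inv 1≤m+k))) refl)
      (solve 2 (λ x u → x :* u :+ x := (con 1ℚ :+ u) :* x) refl x u)))

  -- The factors 1 - 1 / a = (a - 1) / a telescope as well, but down to the predecessor of the first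
  -- number: this is why the harmonic sum begins at m + 1. `expSum-upper` keeps the truncation
  -- index, so the bound is uniform in N.
  expSum-harmonic-upper : ∀ m → 1 ≤ m → ∀ k N →
    expSum (harmonic (suc m) k +ℚ harmonic (suc m) k) N *ℚ (ι m *ℚ ι m) ≤ℚ ι (m + k) *ℚ ι (m + k)
  expSum-harmonic-upper m 1≤m zero    N = ℚ.≤-trans (*ℚ-monoʳ (0≤*ℚ (0≤ι m) (0≤ι m)) (at0 N))
    (ℚ.≤-reflexive (trans (ℚ.*-identityˡ (ι m *ℚ ι m)) (cong (λ z → ι z *ℚ ι z) (sym (+-identityʳ m)))))
    where
    at0 : ∀ N → expSum (0ℚ +ℚ 0ℚ) N ≤ℚ 1ℚ
    at0 zero          = 0≤1ℚ
    at0 (suc zero)    = ℚ.≤-reflexive (expSum-1 (0ℚ +ℚ 0ℚ))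
    at0 (suc (suc N)) = ℚ.≤-trans (ℚ.≤-reflexive (trans (cong (expSum (0ℚ +ℚ 0ℚ) (suc N) +ℚ_) (trans (expTerm≡ (0ℚ +ℚ 0ℚ) (suc N))
        (trans (ℚ.*-assoc (0ℚ +ℚ 0ℚ) (pw (0ℚ +ℚ 0ℚ) N) (inv (suc N !))) (ℚ.*-zeroˡ (pw (0ℚ +ℚ 0ℚ) N *ℚ inv (suc N !)))))) (ℚ.+-identityʳ _))) (at0 (suc N))
  expSum-harmonic-upper m 1≤m (suc k) N = *ℚ-cancelˡ-≤ (0<*ℚ 0<X 0<X) (begin
      X *ℚ X *ℚ (E″ *ℚ mm)                       ≡⟨ solve 3 (λ x e m → x :* x :* (e :* m) := x :* (x :* e) :* m) refl X E″ mm ⟩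
      X *ℚ (X *ℚ E″) *ℚ mm                       ≤⟨ *ℚ-monoʳ 0≤mm (*ℚ-monoˡ (0≤ι (m + k)) (subst (λ z → X *ℚ expSum z N ≤ℚ Y *ℚ E′) (sym (split u h)) (once (0≤+ℚ 0≤u 0≤2h)))) ⟩
      X *ℚ (Y *ℚ E′) *ℚ mm                       ≡⟨ solve 4 (λ x y e m → x :* (y :* e) :* m := y :* (x :* e) :* m) refl X Y E′ mm ⟩
      Y *ℚ (X *ℚ E′) *ℚ mm                       ≤⟨ *ℚ-monoʳ 0≤mm (*ℚ-monoˡ (0≤ι (suc m + k)) (once 0≤2h)) ⟩
      Y *ℚ (Y *ℚ E) *ℚ mm                        ≡⟨ solve 3 (λ y e m → y :* (y :* e) :* m := y :* y :* (e :* m)) refl Y E mm ⟩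
      Y *ℚ Y *ℚ (E *ℚ mm)                        ≤⟨ *ℚ-monoˡ (0≤*ℚ (0≤ι (suc m + k)) (0≤ι (suc m + k))) (expSum-harmonic-upper m 1≤m k N) ⟩
      Y *ℚ Y *ℚ (X *ℚ X)                         ≡⟨ ℚ.*-comm (Y *ℚ Y) (X *ℚ X) ⟩
      X *ℚ X *ℚ (Y *ℚ Y)                         ≡⟨ cong (λ z → X *ℚ X *ℚ (ι z *ℚ ι z)) (+-suc m k) ⟨
      X *ℚ X *ℚ (ι (m + suc k) *ℚ ι (m + suc k)) ∎)
    where
    open ℚ.≤-Reasoning
    h = harmonic (suc m) k
    u = inv (suc m + k)
    X = ι (m + k)
    Y = ι (suc m + k)
    mm = ι m *ℚ ι m
    E = expSum (h +ℚ h) N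
    E′ = expSum (u +ℚ (h +ℚ h)) N
    E″ = expSum (harmonic (suc m) (suc k) +ℚ harmonic (suc m) (suc k)) N
    0≤u = 0≤inv (suc m + k)
    0≤2h = 0≤+ℚ (0≤harmonic (suc m) k) (0≤harmonic (suc m) k)
    0≤mm = 0≤*ℚ (0≤ι m) (0≤ι m)
    0<X : 0ℚ <ℚ X
    0<X = 0<ι (≤-trans 1≤m (m≤m+n m k))
    -- This is `expSum-upper` multiplied by Y, in view of Y u = 1 and X = Y - 1.
    once : ∀ {q} → 0ℚ ≤ℚ q → X *ℚ expSum (u +ℚ q) N ≤ℚ Y *ℚ expSum q N
    once {q} 0≤q = ≤-by (Y *ℚ (expSum q N +ℚ u *ℚ e -ℚ e)) (0≤*ℚ (0≤ι (suc m + k)) (≤⇒0≤-ℚ (expSum-upper 0≤u 0≤q N)))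
        (sym (trans (cong (λ z → z *ℚ e +ℚ Y *ℚ (expSum q N +ℚ u *ℚ e -ℚ e)) X≡)
          (trans (solve 4 (λ y u a e → (y :- con 1ℚ) :* e :+ y :* (a :+ u :* e :- e) := y :* a :+ (y :* u :- con 1ℚ) :* e) refl Y u (expSum q N) e)
          (trans (cong (λ z → Y *ℚ expSum q N +ℚ (z -ℚ 1ℚ) *ℚ e) (ι-inv {suc m + k} (s≤s z≤n)))
            (solve 2 (λ a e → a :+ (con 1ℚ :- con 1ℚ) :* e := a) refl (Y *ℚ expSum q N) e)))))
      where
      e = expSum (u +ℚ q) N
      X≡ : X ≡ Y -ℚ 1ℚ
      X≡ = sym (trans (cong (_-ℚ 1ℚ) (trans (ι-+ 1 (m + k)) (cong (_+ℚ X) ι-1))) (solve 1 (λ x → con 1ℚ :+ x :- con 1ℚ := x) refl X))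

  -- Linear programming duality: with X = m + k, every term of Σ (a - X² / a) with a ≥ X is nonnegative.
  sum-lower-bound : ∀ {m k S} → 1 ≤ m → Unique S → All (m ≤_) S → harmonic m k ≤ℚ R S → sum (interval m k) ≤ sum S
  sum-lower-bound {m} {k} {S} 1≤m u m≤S h≤ = ι-cancel-≤ (begin
      ι (sum I)                                    ≡⟨ solve 3 (λ s c r → s := (s :- c :* r) :+ c :* r) refl (ι (sum I)) c (R I) ⟩
      (ι (sum I) -ℚ c *ℚ R I) +ℚ c *ℚ R I          ≡⟨ cong (_+ℚ c *ℚ R I) (linear I) ⟨
      ∑ f I +ℚ c *ℚ R I                            ≤⟨ ℚ.+-mono-≤ key (*ℚ-monoˡ 0≤c h≤) ⟩
      ∑ f S +ℚ c *ℚ R S                            ≡⟨ cong (_+ℚ c *ℚ R S) (linear S) ⟩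
      (ι (sum S) -ℚ c *ℚ R S) +ℚ c *ℚ R S          ≡⟨ solve 3 (λ s c r → (s :- c :* r) :+ c :* r := s) refl (ι (sum S)) c (R S) ⟩
      ι (sum S)                                    ∎)
    where
    open ℚ.≤-Reasoning
    X = m + k
    I = interval m k
    c = ι X *ℚ ι X
    0≤c = 0≤*ℚ (0≤ι X) (0≤ι X)
    f φ : ℕ → ℚ
    f a = ι a -ℚ c *ℚ inv a
    φ a = -ℚ f a
    linear : ∀ as → ∑ f as ≡ ι (sum as) -ℚ c *ℚ R as
    linear as = trans (∑-linear ι c as) (cong (_-ℚ c *ℚ R as) (∑ι as))
    square : ∀ {a} → 1 ≤ a → ι a ≡ ι a *ℚ ι a *ℚ inv a
    square {a} 1≤a = trans (sym (ℚ.*-identityʳ (ι a))) (trans (cong (ι a *ℚ_) (sym (ι-inv 1≤a))) (sym (ℚ.*-assoc (ι a) (ι a) (inv a))))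
    f≥0 : ∀ {a} → 1 ≤ a → X ≤ a → 0ℚ ≤ℚ f a
    f≥0 {a} 1≤a X≤a = ≤⇒0≤-ℚ (ℚ.≤-trans (*ℚ-monoʳ (0≤inv a) (*ℚ-mono (0≤ι X) (ι-mono-≤ X≤a) (0≤ι X) (ι-mono-≤ X≤a))) (ℚ.≤-reflexive (sym (square 1≤a))))
    φ≥0 : ∀ {a} → 1 ≤ a → a ≤ X → 0ℚ ≤ℚ φ a
    φ≥0 {a} 1≤a a≤X = subst (0ℚ ≤ℚ_) (solve 2 (λ x y → x :- y := :- (y :- x)) refl (c *ℚ inv a) (ι a))
      (≤⇒0≤-ℚ (ℚ.≤-trans (ℚ.≤-reflexive (square 1≤a)) (*ℚ-monoʳ (0≤inv a) (*ℚ-mono (0≤ι a) (ι-mono-≤ a≤X) (0≤ι a) (ι-mono-≤ a≤X)))))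
    ∑φ : ∀ as → ∑ φ as ≡ -ℚ ∑ f as
    ∑φ []       = refl
    ∑φ (a ∷ as) = trans (cong (φ a +ℚ_) (∑φ as)) (solve 2 (λ x y → :- x :+ :- y := :- (x :+ y)) refl (f a) (∑ f as))
    drop : ∀ {as} → All (m ≤_) as → ∑ f (filter (_<? X) as) ≤ℚ ∑ f as
    drop []                = ℚ.≤-refl
    drop {a ∷ as} (p ∷ ps) = case (a <? X) (drop ps)
      where
      case : ∀ d → ∑ f (filter (_<? X) as) ≤ℚ ∑ f as → ∑ f (filter (_<? X) (a ∷ as)) ≤ℚ ∑ f (a ∷ as)
      case (yes a<X) ih = subst (λ l → ∑ f l ≤ℚ ∑ f (a ∷ as)) (sym (List.filter-accept (_<? X) a<X)) (ℚ.+-monoʳ-≤ (f a) ih)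
      case (no  a≮X) ih = subst (λ l → ∑ f l ≤ℚ ∑ f (a ∷ as)) (sym (List.filter-reject (_<? X) a≮X))
        (ℚ.≤-trans ih (≤-by (f a) (f≥0 (≤-trans 1≤m p) (≮⇒≥ a≮X)) (ℚ.+-comm (f a) (∑ f as))))
    S′ = filter (_<? X) S
    S′⊆I : ∀ {x} → x ∈ S′ → x ∈ I
    S′⊆I x∈ = ∈-interval k (All.lookup m≤S (proj₁ (∈.∈-filter⁻ (_<? X) {xs = S} x∈))) (proj₂ (∈.∈-filter⁻ (_<? X) {xs = S} x∈))
    -- Below X the terms of f are nonpositive, and the part of S below X is a subset of I; hence f
    -- has a sum over it at least as large as over I.
    dual : ∑ φ S′ ≤ℚ ∑ φ I
    dual = ∑-⊆ (λ i → let l , r = All.lookup (interval-bounds m k) i in φ≥0 (≤-trans 1≤m l) (<⇒≤ r)) (Unique.filter⁺ (_<? X) u) S′⊆I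
    key : ∑ f I ≤ℚ ∑ f S
    key = ℚ.≤-trans (≤-by (∑ φ I -ℚ ∑ φ S′) (≤⇒0≤-ℚ dual) (trans (solve 2 (λ i s → s := i :+ (:- i :- :- s)) refl (∑ f I) (∑ f S′))
      (sym (cong₂ (λ a b → ∑ f I +ℚ (a -ℚ b)) (∑φ I) (∑φ S′))))) (drop m≤S)

-- Adjusting the sum at a constant sum of reciprocals.

module Toggles where

  open import Data.Nat.Base
  open Rationals
  open Sums
  open BinaryExpansions

  inv-*-scale : ∀ {a b} → 1 ≤ a → 1 ≤ b → inv b ≡ ι a *ℚ inv (a * b)
  inv-*-scale {a} {b} 1≤a 1≤b = trans (sym (trans (cong (_*ℚ inv b) ι-1) (ℚ.*-identityˡ (inv b))))
    (frac-≡ 1 b a (a * b) 1≤b (*-mono-≤ 1≤a 1≤b) (*-identityˡ (a * b)))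

  -- 1 / 6 = 1 / 10 + 1 / 15, so every binary digit of x can be encoded without affecting the sum of the reciprocals.
  toggleSum : ℕ → ℕ → ℚ
  toggleSum c zero    = 0ℚ
  toggleSum c (suc n) = inv (6 * c) +ℚ toggleSum (2 * c) n

  toggleBase : ℕ → ℕ → ℕ
  toggleBase c zero    = 0
  toggleBase c (suc n) = 6 * c + toggleBase (2 * c) n

  -- The last alternative covers the blocks of all later digits, at the scales 2 c, 4 c, and so on.
  -- From u ≥ 6 it follows that 2 u exceeds 10, and 15 is odd, so these blocks never meet 6 c, 10 c
  -- or 15 c.
  ToggleShape : ℕ → ℕ → Set
  ToggleShape c v = ∃ λ w → v ≡ c * w × (w ≡ 6 ⊎ w ≡ 10 ⊎ w ≡ 15 ⊎ ∃ λ u → 6 ≤ u × w ≡ 2 * u)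

  private
    deeper : ∀ {c v} → ToggleShape (2 * c) v → ∃ λ u → 6 ≤ u × v ≡ c * (2 * u)
    deeper {c} (w , v≡ , w∈) = w , six w∈ , trans v≡ (lem c w)
      where
      lem : ∀ c w → 2 * c * w ≡ c * (2 * w)
      lem = solve-∀
      six : (w ≡ 6 ⊎ w ≡ 10 ⊎ w ≡ 15 ⊎ ∃ λ u → 6 ≤ u × w ≡ 2 * u) → 6 ≤ w
      six (inj₁ refl) = ≤-refl
      six (inj₂ (inj₁ refl)) = m≤m+n 6 4
      six (inj₂ (inj₂ (inj₁ refl))) = m≤m+n 6 9
      six (inj₂ (inj₂ (inj₂ (u , 6≤u , refl)))) = ≤-trans 6≤u (m≤n*m u 2)

    lift : ∀ {c v} → ToggleShape (2 * c) v → ToggleShape c v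
    lift {c} sh = let u , 6≤u , v≡ = deeper {c} sh in 2 * u , v≡ , inj₂ (inj₂ (inj₂ (u , 6≤u , refl)))

    fresh : ∀ {c v} k → 1 ≤ c → (∀ u → 6 ≤ u → k ≢ 2 * u) → ToggleShape (2 * c) v → c * k ≢ v
    fresh {c@(suc _)} k _ k≢ sh eq = let u , 6≤u , v≡ = deeper {c} sh in k≢ u 6≤u (*-cancelˡ-≡ k (2 * u) c (trans eq v≡))

    6≢ : ∀ u → 6 ≤ u → 6 ≢ 2 * u
    6≢ u 6≤u e = <⇒≢ (≤-trans (m≤m+n 7 5) (*-monoʳ-≤ 2 6≤u)) e
    10≢ : ∀ u → 6 ≤ u → 10 ≢ 2 * u
    10≢ u 6≤u e = <⇒≢ (≤-trans (m≤m+n 11 1) (*-monoʳ-≤ 2 6≤u)) e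
    15≢ : ∀ u → 6 ≤ u → 15 ≢ 2 * u
    15≢ u _ e = even≢odd u 7 (sym e)

    swap : ∀ c → 1 ≤ c → inv (c * 10) +ℚ inv (c * 15) ≡ inv (6 * c)
    swap c 1≤c = trans (cong₂ _+ℚ_ (trans (inv-*-scale {3} (s≤s z≤n) (*-mono-≤ 1≤c (s≤s {n = 9} z≤n))) (cong (λ z → ι 3 *ℚ inv z) (lem₁ c)))
        (trans (inv-*-scale {2} (s≤s z≤n) (*-mono-≤ 1≤c (s≤s {n = 14} z≤n))) (cong (λ z → ι 2 *ℚ inv z) (lem₂ c))))
      (trans (sym (ℚ.*-distribʳ-+ (inv (5 * (6 * c))) (ι 3) (ι 2))) (trans (cong (_*ℚ inv (5 * (6 * c))) (sym (ι-+ 3 2)))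
        (sym (inv-*-scale {5} (s≤s z≤n) (*-mono-≤ (s≤s {n = 5} z≤n) 1≤c)))))
      where
      lem₁ : ∀ c → 3 * (c * 10) ≡ 5 * (6 * c)
      lem₁ = solve-∀
      lem₂ : ∀ c → 2 * (c * 15) ≡ 5 * (6 * c)
      lem₂ = solve-∀

  -- A digit 1 exchanges 6 c for 10 c and 15 c and so raises the sum by 19 c. The scale c doubles
  -- with each digit, and the increments add up to 19 c x.
  toggles : ∀ c → 1 ≤ c → ∀ n x → x < 2 ^ n → ∃ λ T → R T ≡ toggleSum c n × sum T ≡ toggleBase c n + 19 * c * x ×
            Unique T × All (ToggleShape c) T × All (_∣ 30 * (c * 2 ^ n)) T
  toggles c 1≤c zero    zero    _ = [] , refl , sym (*-zeroʳ (19 * c)) , [] , [] , []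
  toggles c 1≤c zero    (suc x) (s≤s ())
  toggles c 1≤c (suc n) x       x<
    with x % 2 | m%n<n x 2 | m≡m%n+[m/n]*n x 2
       | toggles (2 * c) (*-mono-≤ (s≤s {n = 1} z≤n) 1≤c) n (x / 2) (*-cancelʳ-< 2 (x / 2) (2 ^ n) (≤-<-trans (≤-trans (m≤n+m (x / 2 * 2) (x % 2)) (≤-reflexive (sym (m≡m%n+[m/n]*n x 2)))) (subst (x <_) (*-comm 2 (2 ^ n)) x<)))
  ... | zero | _ | x≡ | T , r , σ , u , sh , dv =
      c * 6 ∷ T , cong₂ _+ℚ_ (cong inv (*-comm c 6)) r
    , trans (cong (c * 6 +_) σ) (trans (lem c (toggleBase (2 * c) n) (x / 2)) (cong (λ z → 6 * c + toggleBase (2 * c) n + 19 * c * z) (sym x≡)))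
    , All.map (fresh {c} 6 1≤c 6≢) sh ∷ u
    , (6 , refl , inj₁ refl) ∷ All.map (lift {c}) sh
    , subst (c * 6 ∣_) (lem′ c (2 ^ n)) (m∣m*n (5 * (2 * 2 ^ n))) ∷ All.map (λ {v} → subst (v ∣_) (cong (30 *_) (shuffle c (2 ^ n)))) dv
    where
    lem : ∀ c b y → c * 6 + (b + 19 * (2 * c) * y) ≡ 6 * c + b + 19 * c * (y * 2)
    lem = solve-∀
    lem′ : ∀ c p → c * 6 * (5 * (2 * p)) ≡ 30 * (c * (2 * p))
    lem′ = solve-∀
    shuffle : ∀ c p → 2 * c * p ≡ c * (2 * p)
    shuffle = solve-∀
  ... | suc zero | _ | x≡ | T , r , σ , u , sh , dv =
      c * 10 ∷ c * 15 ∷ T , trans (sym (ℚ.+-assoc (inv (c * 10)) (inv (c * 15)) (R T))) (cong₂ _+ℚ_ (swap c 1≤c) r)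
    , trans (cong (λ z → c * 10 + (c * 15 + z)) σ) (trans (lem c (toggleBase (2 * c) n) (x / 2)) (cong (λ z → 6 * c + toggleBase (2 * c) n + 19 * c * z) (sym x≡)))
    , ((λ e → 10≢15 1≤c e) ∷ All.map (fresh {c} 10 1≤c 10≢) sh) ∷ All.map (fresh {c} 15 1≤c 15≢) sh ∷ u
    , (10 , refl , inj₂ (inj₁ refl)) ∷ (15 , refl , inj₂ (inj₂ (inj₁ refl))) ∷ All.map (lift {c}) sh
    , subst (c * 10 ∣_) (lem₁ c (2 ^ n)) (m∣m*n (3 * (2 * 2 ^ n))) ∷ subst (c * 15 ∣_) (lem₂ c (2 ^ n)) (m∣m*n (2 * (2 * 2 ^ n)))
      ∷ All.map (λ {v} → subst (v ∣_) (cong (30 *_) (shuffle c (2 ^ n)))) dv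
    where
    10≢15 : ∀ {c} → 1 ≤ c → c * 10 ≢ c * 15
    10≢15 {c@(suc _)} _ = <⇒≢ (*-monoʳ-< c (m≤m+n 11 4))
    lem : ∀ c b y → c * 10 + (c * 15 + (b + 19 * (2 * c) * y)) ≡ 6 * c + b + 19 * c * (1 + y * 2)
    lem = solve-∀
    lem₁ : ∀ c p → c * 10 * (3 * (2 * p)) ≡ 30 * (c * (2 * p))
    lem₁ = solve-∀
    lem₂ : ∀ c p → c * 15 * (2 * (2 * p)) ≡ 30 * (c * (2 * p))
    lem₂ = solve-∀
    shuffle : ∀ c p → 2 * c * p ≡ c * (2 * p)
    shuffle = solve-∀
  ... | suc (suc _) | s≤s (s≤s ()) | _ | _

  ToggleShape⇒∣ : ∀ {c v} → ToggleShape c v → c ∣ v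
  ToggleShape⇒∣ {c} (w , refl , _) = m∣m*n w

  ToggleShape⇒≤ : ∀ {c v} → ToggleShape c v → c ≤ v
  ToggleShape⇒≤ {c} (w , refl , w∈) = m≤m*n c w {{>-nonZero (pos w∈)}}
    where
    pos : (w ≡ 6 ⊎ w ≡ 10 ⊎ w ≡ 15 ⊎ ∃ λ u → 6 ≤ u × w ≡ 2 * u) → 1 ≤ w
    pos (inj₁ refl) = s≤s z≤n
    pos (inj₂ (inj₁ refl)) = s≤s z≤n
    pos (inj₂ (inj₂ (inj₁ refl))) = s≤s z≤n
    pos (inj₂ (inj₂ (inj₂ (u , 6≤u , refl)))) = ≤-trans (≤-trans (s≤s z≤n) 6≤u) (m≤n*m u 2)

  toggleSum-÷ : ∀ c → 1 ≤ c → ∀ n → ∃ λ z → toggleSum c n is z ÷ (6 * c * 2 ^ n)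
  toggleSum-÷ c 1≤c zero    = 0 , ÷-zero {6 * c * 1}
  toggleSum-÷ c 1≤c (suc n) = let z , eq = toggleSum-÷ (2 * c) (*-mono-≤ (s≤s {n = 1} z≤n) 1≤c) n in
      1 * 2 ^ suc n + z , ÷-+ (÷-scale (2 ^ suc n) (÷-unit (*-mono-≤ (s≤s {n = 5} z≤n) 1≤c))) (÷-cong refl (lem c (2 ^ n)) eq)
    where
    lem : ∀ c p → 6 * (2 * c) * p ≡ 6 * c * (2 * p)
    lem = solve-∀

  toggleSum-≤ : ∀ c → 1 ≤ c → ∀ n → toggleSum c n ≤ℚ inv c
  toggleSum-≤ c 1≤c zero    = 0≤inv c
  toggleSum-≤ c 1≤c (suc n) = ℚ.≤-trans (ℚ.+-mono-≤ {inv (6 * c)} {inv (2 * c)}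
      (inv-anti (*-mono-≤ (s≤s {n = 1} z≤n) 1≤c) (*-monoˡ-≤ c (m≤m+n 2 4))) (toggleSum-≤ (2 * c) (*-mono-≤ (s≤s {n = 1} z≤n) 1≤c) n))
    (ℚ.≤-reflexive (trans (cong₂ _+ℚ_ one one) (trans (sym (ℚ.*-distribʳ-+ (inv (2 * c)) (ι 1) (ι 1)))
      (trans (cong (_*ℚ inv (2 * c)) (sym (ι-+ 1 1))) (sym (inv-*-scale {2} (s≤s z≤n) 1≤c))))))
    where
    one : inv (2 * c) ≡ ι 1 *ℚ inv (2 * c)
    one = sym (trans (cong (_*ℚ inv (2 * c)) ι-1) (ℚ.*-identityˡ (inv (2 * c))))

  -- The summand 6 c makes the claim inductive: together with the first block it becomes the summand
  -- for 2 c.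
  toggleBase-≤ : ∀ c n → 6 * c + toggleBase c n ≤ 6 * c * 2 ^ n
  toggleBase-≤ c zero    = ≤-reflexive (trans (+-identityʳ (6 * c)) (sym (*-identityʳ (6 * c))))
  toggleBase-≤ c (suc n) = ≤-trans (≤-reflexive (lem c (toggleBase (2 * c) n)))
    (≤-trans (toggleBase-≤ (2 * c) n) (≤-reflexive (lem′ c (2 ^ n))))
    where
    lem : ∀ c b → 6 * c + (6 * c + b) ≡ 6 * (2 * c) + b
    lem = solve-∀
    lem′ : ∀ c p → 6 * (2 * c) * p ≡ 6 * c * (2 * p)
    lem′ = solve-∀

-- Choice of the scales and the size of the modulus.

module Moduli where

  open import Data.Nat.Base
  open Rationals
  open Sums
  open Primes
  open BinaryExpansions
  open Elimination
  open Sieving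

  n≤2^n : ∀ n → n ≤ 2 ^ n
  n≤2^n zero    = z≤n
  n≤2^n (suc n) = ≤-trans (+-mono-≤ (m^n>0 2 n) (n≤2^n n)) (≤-reflexive (cong (2 ^ n +_) (sym (+-identityʳ (2 ^ n)))))

  -- The number of doublings that bring x up to Y. `scale-to` supplies Y itself as fuel, which is
  -- enough because Y ≤ 2^Y.
  scaling : ℕ → ℕ → ℕ → ℕ
  scaling Y zero       x = 0
  scaling Y (suc fuel) x with Y ≤? x
  ... | yes _ = 0
  ... | no  _ = suc (scaling Y fuel (2 * x))

  scaling-spec : ∀ Y fuel x → x ≤ 2 * Y → Y ≤ x * 2 ^ fuel →
                 Y ≤ x * 2 ^ scaling Y fuel x × x * 2 ^ scaling Y fuel x ≤ 2 * Y
  scaling-spec Y zero       x x≤ Y≤ = Y≤ , ≤-trans (≤-reflexive (*-identityʳ x)) x≤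
  scaling-spec Y (suc fuel) x x≤ Y≤ with Y ≤? x
  ... | yes Y≤x = ≤-trans Y≤x (≤-reflexive (sym (*-identityʳ x))) , ≤-trans (≤-reflexive (*-identityʳ x)) x≤
  ... | no  Y≰x =
    let lo , hi = scaling-spec Y fuel (2 * x) (*-monoʳ-≤ 2 (<⇒≤ (≰⇒> Y≰x))) (≤-trans Y≤ (≤-reflexive (lem x (2 ^ fuel))))
    in ≤-trans lo (≤-reflexive (sym (lem x _))) , ≤-trans (≤-reflexive (lem x _)) hi
    where
    lem : ∀ x p → x * (2 * p) ≡ 2 * x * p
    lem = solve-∀

  scale-to : ∀ Y {x} → 1 ≤ x → x ≤ 2 * Y → Y ≤ x * 2 ^ scaling Y Y x × x * 2 ^ scaling Y Y x ≤ 2 * Y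
  scale-to Y {x} 1≤x x≤ = scaling-spec Y Y x x≤ (≤-trans (n≤2^n Y) (m≤n*m (2 ^ Y) x {{>-nonZero 1≤x}}))

  -- With D s ≤ L, what remains of L after 2s + 1 is taken away is still at least 32 ℓ 2^K (K + 2s +
  -- 2). The last factor is the number of dyadic blocks of primes above U, and the bound makes their
  -- multiples a proportion of order 1 / ℓ.
  constantD : ℕ → ℕ → ℕ
  constantD ℓ K = 3 + (64 * (ℓ * 2 ^ K) + 32 * (ℓ * 2 ^ K) * (K + 2))

  -- The scales: 2^L ≤ m < 2^(L+1) and s = ⌊L / D⌋; the prime powers in Q are about 2^s, and U = 2^k₀ = 2^(L - 2s - 1).
  module Parameters
    (g : ℕ) (g-prime : Prime g) (ℓ K k L s m : ℕ)
    (45<g : 45 < g) (g≤k : g ≤ k) (1≤ℓ : 1 ≤ ℓ)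
    (many : 4 * constantD ℓ K ≤ length (smallPrimes g k))
    (Ds≤L : constantD ℓ K * s ≤ L) (L<Ds : L < constantD ℓ K * suc s)
    (4P+3≤s : 4 * (3 + k) + 3 ≤ s) (P³≤s : (3 + k) * (3 + k) * (3 + k) ≤ s)
    (2^L≤m : 2 ^ L ≤ m) (m<2^L+1 : m < 2 ^ suc L)
    where

    private
      D = constantD ℓ K
      E = ℓ * 2 ^ K

    k₀ = L ∸ (s + s + 1)

    open Modulus g k s (2 ^ k₀) public

    1≤s : 1 ≤ s
    1≤s = ≤-trans (s≤s z≤n) 4P+3≤s

    private
      tail : (s + s + 1) + 32 * E * (K + (s + s) + 2) ≤ D * s
      tail = begin
        (s + s + 1) + 32 * E * (K + (s + s) + 2)                    ≡⟨ lem₁ s E K ⟩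
        (s + s + 64 * E * s) + 1 * (1 + 32 * E * (K + 2))           ≤⟨ +-monoʳ-≤ (s + s + 64 * E * s) (*-monoˡ-≤ (1 + 32 * E * (K + 2)) 1≤s) ⟩
        (s + s + 64 * E * s) + s * (1 + 32 * E * (K + 2))           ≡⟨ lem₂ s E K ⟩
        D * s                                                       ∎
        where
        open ≤-Reasoning
        lem₁ : ∀ s E K → (s + s + 1) + 32 * E * (K + (s + s) + 2) ≡ (s + s + 64 * E * s) + 1 * (1 + 32 * E * (K + 2))
        lem₁ = solve-∀
        lem₂ : ∀ s E K → (s + s + 64 * E * s) + s * (1 + 32 * E * (K + 2)) ≡ (3 + (64 * E + 32 * E * (K + 2))) * s
        lem₂ = solve-∀

    L≡ : L ≡ k₀ + (s + s + 1)
    L≡ = sym (m∸n+n≡m (≤-trans (m≤m+n (s + s + 1) _) (≤-trans tail Ds≤L)))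

    k₀-big : 32 * (ℓ * 2 ^ K) * (K + (s + s) + 2) ≤ k₀
    k₀-big = m+n≤o⇒m≤o∸n _ (≤-trans (≤-reflexive (+-comm _ (s + s + 1))) (≤-trans tail Ds≤L))

    s≤k₀ : s ≤ k₀
    s≤k₀ = ≤-trans (≤-trans (≤-trans (m≤m+n s s) (m≤n+m (s + s) K)) (m≤m+n (K + (s + s)) 2))
      (≤-trans (m≤n*m (K + (s + s) + 2) (32 * (ℓ * 2 ^ K)) {{>-nonZero (*-mono-≤ (s≤s {n = 31} z≤n) (*-mono-≤ 1≤ℓ (m^n>0 2 K)))}}) k₀-big)

    4s≤L : s + s + (s + s) ≤ L
    4s≤L = ≤-trans (≤-reflexive (lem s)) (≤-trans (*-monoˡ-≤ s 4≤D) Ds≤L)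
      where
      lem : ∀ s → s + s + (s + s) ≡ 4 * s
      lem = solve-∀
      4≤D : 4 ≤ D
      4≤D = s≤s (s≤s (s≤s (≤-trans (*-mono-≤ (*-mono-≤ (s≤s {n = 63} z≤n) 1≤ℓ) (m^n>0 2 K)) (≤-trans (≤-reflexive (*-assoc 64 ℓ (2 ^ K))) (m≤m+n (64 * E) _)))))

    s≤L : s ≤ L
    s≤L = ≤-trans (≤-trans (m≤m+n s s) (m≤m+n (s + s) (s + s))) 4s≤L

    2^L≡ : 2 ^ L ≡ 2 ^ k₀ * (2 ^ s * (2 ^ s * 2))
    2^L≡ = trans (cong (2 ^_) L≡) (trans (^-distribˡ-+-* 2 k₀ (s + s + 1)) (cong (2 ^ k₀ *_)
      (trans (^-distribˡ-+-* 2 (s + s) 1) (trans (cong (_* 2) (^-distribˡ-+-* 2 s s)) (*-assoc (2 ^ s) (2 ^ s) 2)))))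

    1≤m : 1 ≤ m
    1≤m = ≤-trans (m^n>0 2 L) 2^L≤m

    s≤m : s ≤ m
    s≤m = ≤-trans (≤-trans s≤L (n≤2^n L)) 2^L≤m

    P≤s : P ≤ s
    P≤s = ≤-trans (≤-trans (m≤m+n P (3 * P)) (m≤m+n (4 * P) 3)) 4P+3≤s

    P³≤2ˢ : P * P * P ≤ 2 ^ s
    P³≤2ˢ = ≤-trans P³≤s (n≤2^n s)

    P≤U : P ≤ 2 ^ k₀
    P≤U = ≤-trans P≤s (≤-trans s≤k₀ (n≤2^n k₀))

    U≤m : 2 ^ k₀ ≤ m
    U≤m = ≤-trans (^-monoʳ-≤ 2 (m∸n≤m L (s + s + 1))) 2^L≤m

    t : ℕ
    t = length qs

    t<P : t < P
    t<P = ≤-<-trans (≤-trans (≤-reflexive (List.length-map _ rs)) (≤-trans (List.length-filter _ (interval 3 k)) (≤-reflexive (length-interval 3 k))))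
      (s≤s (m≤n+m k 2))

    t<2ᴾ : t < 2 ^ P
    t<2ᴾ = <-≤-trans t<P (n≤2^n P)

    qs-prime-powers : ∀ {q} → q ∈ qs → SmallPrimePower q
    qs-prime-powers = q-prime-power P³≤2ˢ

    prime-odd : ∀ {p} → Prime p → 3 ≤ p → Coprime p 2
    prime-odd pp 3≤p = primes-coprime pp prime[2] (>⇒≢ 3≤p)

    H : ℕ → ℕ
    H p = scaling (2 ^ P * m) (2 ^ P * m) p

    -- As h - nz = L, the last expansion reaches up to 2^nz / 2^h = 2^-L. The excess s + P + 2 makes
    -- its lower end t / 2^h negligible against 1 / m, and P + 2 of it ensures H p ≤ h.
    h nz : ℕ
    nz = s + P + 2
    h = L + nz

    open Completion m s h P nz qs H public using (QsOK; PsOK; Shape; drift; lower; upper; cost₀; cost₁; Completed; complete)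

    qs-ok : All QsOK qs
    qs-ok = All.tabulate λ q∈ → ok (qs-prime-powers q∈)
      where
      ok : ∀ {q} → SmallPrimePower q → QsOK q
      ok {q} (r , e , pr , _ , 3≤r , r<P , 1≤e , refl , q≤ , <rq) =
          ≤-trans (≤-trans (n≤1+n 2) 3≤r) (≤-trans (≤-reflexive (sym (*-identityʳ r))) (^-monoʳ-≤ r {{>-nonZero (≤-trans (s≤s z≤n) 3≤r)}} 1≤e))
        , Coprimality.sym (coprime-^ʳ e (Coprimality.sym (prime-odd pr 3≤r)))
        , q≤
        , ≤-trans (<⇒≤ <rq) (≤-trans (≤-reflexive (*-comm r q)) (*-monoʳ-≤ q (≤-trans (<⇒≤ r<P) (n≤2^n P))))

    private
      power-product : ∀ {as x y} → All (λ a → x ≤ a * y) as → x ^ length as ≤ product as * y ^ length as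
      power-product []                        = ≤-refl
      power-product {a ∷ as} {x} {y} (h ∷ hs) = ≤-trans (*-mono-≤ h (power-product hs)) (≤-reflexive (lem a y (product as) (y ^ length as)))
        where
        lem : ∀ a y p z → a * y * (p * z) ≡ a * p * (y * z)
        lem = solve-∀

    -- There are at least 4 D prime powers, each at least 2^(s - P). As 4 P + 3 ≤ s, the exponent 4
    -- D (s - P) is at least 3 D (s + 1), which exceeds three times L.
    Q-big : m * m * m ≤ Q
    Q-big = ≤-trans (*-mono-≤ (*-mono-≤ m≤ m≤) m≤) (≤-trans (≤-reflexive (trans (cong (_* 2 ^ suc L) (sym (^-distribˡ-+-* 2 (suc L) (suc L)))) (sym (^-distribˡ-+-* 2 (suc L + suc L) (suc L)))))
        (≤-trans (^-monoʳ-≤ 2 exponent) (*-cancelʳ-≤ (2 ^ ((s ∸ P) * t)) Q ((2 ^ P) ^ t) {{>-nonZero (≤-trans (m^n>0 (2 ^ P) {{m^n≢0 2 P}} t) ≤-refl)}}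
          (≤-trans (≤-reflexive pow) (power-product (All.map (λ (_ , _ , _ , b) → b) qs-ok))))))
      where
      m≤ = <⇒≤ m<2^L+1
      pow : 2 ^ ((s ∸ P) * t) * (2 ^ P) ^ t ≡ (2 ^ s) ^ t
      pow = trans (cong₂ _*_ (refl {x = 2 ^ ((s ∸ P) * t)}) (^-*-assoc 2 P t)) (trans (sym (^-distribˡ-+-* 2 ((s ∸ P) * t) (P * t)))
        (trans (cong (2 ^_) (trans (sym (*-distribʳ-+ t (s ∸ P) P)) (cong (_* t) (m∸n+n≡m P≤s)))) (sym (^-*-assoc 2 s t))))
      4D≤t : 4 * D ≤ t
      4D≤t = ≤-trans many (≤-reflexive (sym (List.length-map _ rs)))
      exponent : suc L + suc L + suc L ≤ (s ∸ P) * t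
      exponent = begin
        suc L + suc L + suc L          ≤⟨ +-mono-≤ (+-mono-≤ L<Ds L<Ds) L<Ds ⟩
        D * suc s + D * suc s + D * suc s  ≡⟨ cong (λ z → D * suc z + D * suc z + D * suc z) (sym (m∸n+n≡m P≤s)) ⟩
        D * suc (s ∸ P + P) + D * suc (s ∸ P + P) + D * suc (s ∸ P + P)   ≡⟨ lem D (s ∸ P) P ⟩
        D * (3 * (s ∸ P)) + D * (3 * P + 3)   ≤⟨ +-monoʳ-≤ (D * (3 * (s ∸ P))) (*-monoʳ-≤ D (m+n≤o⇒m≤o∸n (3 * P + 3) (≤-trans (≤-reflexive (lem′ P)) 4P+3≤s))) ⟩
        D * (3 * (s ∸ P)) + D * (s ∸ P)       ≡⟨ lem″ D (s ∸ P) ⟩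
        (s ∸ P) * (4 * D)                     ≤⟨ *-monoʳ-≤ (s ∸ P) 4D≤t ⟩
        (s ∸ P) * t                           ∎
        where
        open ≤-Reasoning
        lem : ∀ D x P → D * suc (x + P) + D * suc (x + P) + D * suc (x + P) ≡ D * (3 * x) + D * (3 * P + 3)
        lem = solve-∀
        lem′ : ∀ P → 3 * P + 3 + P ≡ 4 * P + 3
        lem′ = solve-∀
        lem″ : ∀ D x → D * (3 * x) + D * x ≡ x * (4 * D)
        lem″ = solve-∀

    1≤Q : 1 ≤ Q
    1≤Q = ≥1-product (All.map proj₁ qs-ok)

    m<2ᴸ2 : m ≤ 2 * 2 ^ L
    m<2ᴸ2 = <⇒≤ m<2^L+1

    U≤Q : 2 ^ k₀ ≤ Q
    U≤Q = ≤-trans U≤m (≤-trans (≤-trans (m≤m*n m (m * m) {{>-nonZero (*-mono-≤ 1≤m 1≤m)}}) (≤-reflexive (sym (*-assoc m m m)))) Q-big)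

    2^-≤ : ∀ {a b} → 2 ^ a ≤ 2 ^ b → a ≤ b
    2^-≤ = 2^-cancel-≤

    H-spec : ∀ {p} → P ≤ p → p ≤ 2 ^ k₀ → 2 ^ P * m ≤ p * 2 ^ H p × p * 2 ^ H p ≤ 2 * (2 ^ P * m)
    H-spec {p} P≤p p≤U = scale-to (2 ^ P * m) (≤-trans (s≤s z≤n) P≤p)
      (≤-trans p≤U (≤-trans U≤m (≤-trans (m≤n*m m (2 ^ P) {{m^n≢0 2 P}}) (m≤n*m (2 ^ P * m) 2))))

    ps-ok : All PsOK ps
    ps-ok = All.map ok ps-spec
      where
      ok : ∀ {p} → Prime p × P ≤ p × p ≤ 2 ^ k₀ → PsOK p
      ok {p} (pp , P≤p , p≤U) = prime≥2 pp , prime-odd pp (≤-trans (m≤m+n 3 k) P≤p) , All.tabulate (λ q∈ → p⊥q (qs-prime-powers q∈))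
        , ≤-trans p≤U U≤Q , lo , hi , 2s≤H , H≤h
        where
        open ≤-Reasoning
        lo = proj₁ (H-spec P≤p p≤U)
        hi = proj₂ (H-spec P≤p p≤U)
        p⊥q : ∀ {q} → SmallPrimePower q → Coprime p q
        p⊥q (r , e , pr , _ , _ , r<P , _ , refl , _) = coprime-^ʳ e (primes-coprime pp pr (>⇒≢ (<-≤-trans r<P P≤p)))
        -- U = 2^k₀ lies 2s + 1 binary orders below 2^L ≤ m, so p ≤ U needs at least 2s doublings to
        -- reach m.
        2s≤H : s + s ≤ H p
        2s≤H = 2^-≤ (*-cancelˡ-≤ (2 ^ k₀) {{m^n≢0 2 k₀}} (begin
          2 ^ k₀ * 2 ^ (s + s)            ≡⟨ cong (2 ^ k₀ *_) (^-distribˡ-+-* 2 s s) ⟩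
          2 ^ k₀ * (2 ^ s * 2 ^ s)        ≤⟨ *-monoʳ-≤ (2 ^ k₀) (*-monoʳ-≤ (2 ^ s) (m≤m*n (2 ^ s) 2)) ⟩
          2 ^ k₀ * (2 ^ s * (2 ^ s * 2))  ≡⟨ 2^L≡ ⟨
          2 ^ L                           ≤⟨ 2^L≤m ⟩
          m                               ≤⟨ m≤n*m m (2 ^ P) {{m^n≢0 2 P}} ⟩
          2 ^ P * m                       ≤⟨ lo ⟩
          p * 2 ^ H p                     ≤⟨ *-monoˡ-≤ (2 ^ H p) p≤U ⟩
          2 ^ k₀ * 2 ^ H p                ∎))
        H≤h : H p ≤ h
        H≤h = 2^-≤ (begin
          2 ^ H p                        ≤⟨ m≤n*m (2 ^ H p) p {{>-nonZero (≤-trans (s≤s z≤n) P≤p)}} ⟩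
          p * 2 ^ H p                    ≤⟨ hi ⟩
          2 * (2 ^ P * m)                ≤⟨ *-monoʳ-≤ 2 (*-monoʳ-≤ (2 ^ P) m<2ᴸ2) ⟩
          2 * (2 ^ P * (2 * 2 ^ L))      ≡⟨ lem (2 ^ P) (2 ^ L) ⟩
          2 ^ L * (2 ^ P * 2 ^ 2)        ≡⟨ trans (cong (2 ^ L *_) (sym (^-distribˡ-+-* 2 P 2))) (sym (^-distribˡ-+-* 2 L (P + 2))) ⟩
          2 ^ (L + (P + 2))              ≤⟨ ^-monoʳ-≤ 2 (+-monoʳ-≤ L (≤-trans (m≤n+m (P + 2) s) (≤-reflexive (sym (+-assoc s P 2))))) ⟩
          2 ^ h                          ∎)
          where
          lem : ∀ x y → 2 * (x * (2 * y)) ≡ y * (x * 4)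
          lem = solve-∀

    h∸nz : h ∸ nz ≡ L
    h∸nz = m+n∸n≡m L nz

    g⊥M : Coprime g M
    g⊥M = coprime-*ʳ (coprime-^ʳ s (primes-coprime g-prime prime[2] (>⇒≢ (≤-trans (m≤m+n 3 43) 45<g))))
      (coprime-*ʳ (coprime-product (go ps-spec)) (coprime-product (All.tabulate λ q∈ → g⊥q (qs-prime-powers q∈))))
      where
      go : ∀ {xs} → All (λ p → Prime p × P ≤ p × p ≤ 2 ^ k₀) xs → All (Coprime g) xs
      go []                     = []
      go ((pp , P≤p , _) ∷ hs) = primes-coprime g-prime pp (<⇒≢ (<-≤-trans (s≤s (≤-trans g≤k (m≤n+m k 2))) P≤p)) ∷ go hs
      g⊥q : ∀ {q} → SmallPrimePower q → Coprime g q
      g⊥q (r , e , pr , r≢g , _ , _ , _ , refl , _) = coprime-^ʳ e (primes-coprime g-prime pr (λ e → r≢g (sym e)))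

    odd-WQ : Coprime 2 (W * Q)
    odd-WQ = coprime-*ʳ (coprime-product (go ps-ok)) (coprime-product (go′ qs-ok))
      where
      go : ∀ {xs} → All PsOK xs → All (Coprime 2) xs
      go []                   = []
      go ((_ , odd , _) ∷ hs) = Coprimality.sym odd ∷ go hs
      go′ : ∀ {xs} → All QsOK xs → All (Coprime 2) xs
      go′ []                   = []
      go′ ((_ , odd , _) ∷ hs) = Coprimality.sym odd ∷ go′ hs

    -- A number up to P has no room for a square w² with w ≥ P, nor for a prime above U ≥ P; of the
    -- exceptions in `nondivisor` only the multiples of g remain.
    small∣M : ∀ {n} → 1 ≤ n → n ≤ P → ¬ g ∣ n → n ∣ M
    small∣M {n} 1≤n n≤P g∤n with n ∣? M
    ... | yes n∣M = n∣M
    ... | no  n∤M with nondivisor P³≤2ˢ 1≤n n∤M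
    ...   | inj₁ g∣n = ⊥-elim (g∤n g∣n)
    ...   | inj₂ (inj₁ (w , P≤w , ww∣n)) = ⊥-elim (<⇒≱ (m<m*n P P (s≤s (s≤s z≤n)))
              (≤-trans (*-mono-≤ P≤w P≤w) (≤-trans (∣⇒≤ {{>-nonZero 1≤n}} ww∣n) n≤P)))
    ...   | inj₂ (inj₂ (p , pp , U<p , p∣n)) = ⊥-elim (<⇒≱ U<p (≤-trans (∣⇒≤ {{>-nonZero 1≤n}} p∣n) (≤-trans n≤P P≤U)))

    -- The factor o has no prime divisor below P and q is a power of a single prime, so 3 and 5
    -- cannot both occur. This separates the corrective fractions from the toggles, whose scale is a
    -- multiple of 15.
    15∤Shape : ∀ {v} → Shape ps v → ¬ 15 ∣ v
    15∤Shape {v} (o , q , j , o∈ , q∈ , _ , refl) 15∣v = clash q∈ (∣q prime[3] (s≤s (s≤s (s≤s z≤n))) 3<P (∣-trans (divides 5 refl) 15∣v))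
                                                                (∣q prime[5] (s≤s (s≤s (s≤s z≤n))) 5<P (∣-trans (divides 3 refl) 15∣v))
      where
      prime[3] : Prime 3
      prime[3] = from-yes (prime? 3)
      prime[5] : Prime 5
      prime[5] = from-yes (prime? 5)
      5<P : 5 < P
      5<P = ≤-trans (≤-trans (m≤m+n 6 39) (<⇒≤ 45<g)) (≤-trans g≤k (m≤n+m k 3))
      3<P : 3 < P
      3<P = ≤-trans (m≤m+n 4 2) 5<P
      ∣q : ∀ {r} → Prime r → 3 ≤ r → r < P → r ∣ o * q * 2 ^ j → r ∣ q
      ∣q {r} pr 3≤r r<P r∣ with euclidsLemma (o * q) (2 ^ j) pr r∣
      ... | inj₂ r∣2ʲ = ⊥-elim (>⇒≢ 3≤r (prime-∣-prime pr prime[2] (prime-∣-^ j pr r∣2ʲ)))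
      ... | inj₁ r∣oq with euclidsLemma o q pr r∣oq
      ...   | inj₂ r∣q = r∣q
      ...   | inj₁ r∣o = ⊥-elim (∤o o∈ r∣o)
        where
        ∤o : (o ≡ 1 ⊎ o ∈ ps) → r ∣ o → ⊥
        ∤o (inj₁ refl) r∣1 = >⇒≢ (≤-trans (s≤s (s≤s z≤n)) 3≤r) (∣1⇒≡1 r∣1)
        ∤o (inj₂ o∈ps) r∣p = let pp , P≤p , _ = All.lookup ps-spec o∈ps in <⇒≢ (<-≤-trans r<P P≤p) (prime-∣-prime pr pp r∣p)
      clash : (q ≡ 1 ⊎ q ∈ qs) → 3 ∣ q → 5 ∣ q → ⊥
      clash (inj₁ refl) 3∣1 _   = <⇒≢ (s≤s (s≤s z≤n)) (sym (∣1⇒≡1 3∣1))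
      clash (inj₂ q∈)   3∣q 5∣q with qs-prime-powers q∈
      ... | r , e , pr , _ , _ , _ , _ , refl , _ with prime-∣-prime prime[3] pr (prime-∣-^ e prime[3] 3∣q) | prime-∣-prime prime[5] pr (prime-∣-^ e prime[5] 5∣q)
      ...   | refl | ()

    Shape-coprime-g : ∀ {v} → Shape ps v → Coprime g v
    Shape-coprime-g {v} (o , q , j , o∈ , q∈ , _ , refl) = coprime-*ʳ (coprime-*ʳ (g⊥o o∈) (g⊥q q∈)) (coprime-^ʳ j (primes-coprime g-prime prime[2] (>⇒≢ (≤-trans (m≤m+n 3 43) 45<g))))
      where
      g⊥o : ∀ {o} → (o ≡ 1 ⊎ o ∈ ps) → Coprime g o
      g⊥o (inj₁ refl) = coprime-1ʳ
      g⊥o (inj₂ o∈)   = let pp , P≤p , _ = All.lookup ps-spec o∈ in primes-coprime g-prime pp (<⇒≢ (<-≤-trans (s≤s (≤-trans g≤k (m≤n+m k 2))) P≤p))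
      g⊥q : ∀ {q} → (q ≡ 1 ⊎ q ∈ qs) → Coprime g q
      g⊥q (inj₁ refl) = coprime-1ʳ
      g⊥q (inj₂ q∈)   = let r , e , pr , r≢g , _ , _ , _ , q≡ , _ = qs-prime-powers q∈ in
        subst (Coprime g) (sym q≡) (coprime-^ʳ e (primes-coprime g-prime pr (λ e → r≢g (sym e))))

    -- Together with `M-2-power` this separates the corrective fractions from the chosen divisors of
    -- M, because W Q is odd.
    Shape-2-power : ∀ {v} → Shape ps v → 2 ^ suc s ∣ v
    Shape-2-power {v} (o , q , j , _ , _ , s<j , refl) = ∣-trans (divides (2 ^ (j ∸ suc s))
      (trans (cong (2 ^_) (sym (m∸n+n≡m s<j))) (^-distribˡ-+-* 2 (j ∸ suc s) (suc s)))) (n∣m*n (o * q))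

    M-2-power : ∀ {v} → v ∣ M → ¬ 2 ^ suc s ∣ v
    M-2-power {v} v∣M 2∣v = >⇒≢ {2} {1} (s≤s (s≤s z≤n)) (odd-WQ (∣-refl , *-cancelˡ-∣ (2 ^ s) {{m^n≢0 2 s}}
      (subst (_∣ 2 ^ s * (W * Q)) (*-comm 2 (2 ^ s)) (∣-trans 2∣v v∣M))))

-- Construction of a partition of every large number.

module Constructions where

  open import Data.Nat.Base
  open Rationals
  open Sums
  open Primes
  open BinaryExpansions
  open Elimination
  open Sieving
  open Toggles
  open Moduli
  open Exponential using (harmonic)

  interval-++ : ∀ m a b → interval m (a + b) ≡ interval (m + a) b ++ interval m a
  interval-++ m a zero    = cong (interval m) (+-identityʳ a)
  interval-++ m a (suc b) = trans (cong (interval m) (+-suc a b)) (cong₂ _∷_ (sym (+-assoc m a b)) (interval-++ m a b))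

  R-≤-length : ∀ {m as} → 1 ≤ m → All (m ≤_) as → R as ≤ℚ ι (length as) *ℚ inv m
  R-≤-length {m} 1≤m []                     = ℚ.≤-reflexive (sym (trans (cong (_*ℚ inv m) ι-0) (ℚ.*-zeroˡ (inv m))))
  R-≤-length {m} {a ∷ as} 1≤m (h ∷ hs) = ℚ.≤-trans (ℚ.+-mono-≤ (inv-anti 1≤m h) (R-≤-length 1≤m hs))
    (ℚ.≤-reflexive (trans (cong (_+ℚ ι (length as) *ℚ inv m) (sym (trans (cong (_*ℚ inv m) ι-1) (ℚ.*-identityˡ (inv m)))))
      (trans (sym (ℚ.*-distribʳ-+ (inv m) (ι 1) (ι (length as)))) (cong (_*ℚ inv m) (sym (ι-+ 1 (length as)))))))

  inflate : ∀ {q x d D} → d ∣ D → q is x ÷ d → ∃ λ y → q is y ÷ D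
  inflate {x = x} {d} (divides k D≡) eq = x * k , ÷-cong refl (trans (*-comm d k) (sym D≡)) (÷-scale k eq)

  R-÷ : ∀ {D as} → All (λ a → 1 ≤ a × a ∣ D) as → ∃ λ y → R as is y ÷ D
  R-÷ {D} []                 = 0 , ÷-zero {D}
  R-÷ {D} ((1≤a , a∣D) ∷ hs) = let x , ex = inflate a∣D (÷-unit 1≤a) ; y , ey = R-÷ hs in x + y , ÷-+ ex ey

  ÷-*-inv : ∀ {q x d} g → 1 ≤ g → q is x ÷ d → (inv g *ℚ q) is x ÷ (d * g)
  ÷-*-inv {q} {x} {d} g 1≤g (cleared h) = cleared (trans (cong (inv g *ℚ q *ℚ_) (ι-* d g))
      (trans (solve 4 (λ i q d g → i :* q :* (d :* g) := (g :* i) :* (q :* d)) refl (inv g) q (ι d) (ι g))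
      (trans (cong₂ _*ℚ_ (ι-inv 1≤g) h) (ℚ.*-identityˡ (ι x)))))
    where open +-*-Solver

  ι1* : ∀ x → ι 1 *ℚ x ≡ x
  ι1* x = trans (cong (_*ℚ x) ι-1) (ℚ.*-identityˡ x)

  module Construction
    (g : ℕ) (g-prime : Prime g) (ℓ K k L s m : ℕ)
    (45<g : 45 < g) (g≤k : g ≤ k) (1≤ℓ : 1 ≤ ℓ)
    (many : 4 * constantD ℓ K ≤ length (smallPrimes g k))
    (Ds≤L : constantD ℓ K * s ≤ L) (L<Ds : L < constantD ℓ K * suc s)
    (4P+3≤s : 4 * (3 + k) + 3 ≤ s) (P³≤s : (3 + k) * (3 + k) * (3 + k) ≤ s)
    (2^L≤m : 2 ^ L ≤ m) (m<2^L+1 : m < 2 ^ suc L)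
    (α : ℚ) (a₀ b₀ : ℕ) (1≤a₀ : 1 ≤ a₀) (1≤b₀ : 1 ≤ b₀) (α≡ : α is a₀ ÷ b₀) (a₀<g : a₀ < g) (b₀<g : b₀ < g)
    (b₀2g≤P : b₀ * (g + g) ≤ 3 + k)
    (g-big : 16 * (ℓ * 2 ^ K) ≤ g) (k-big : 16 * (ℓ * 2 ^ K) ≤ 2 + k)
    (64ℓ≤s : 64 * ℓ ≤ s) (16b₀≤s : 16 * b₀ ≤ s) (ℓ+2P+5≤s : ℓ + (3 + k) + (3 + k) + 5 ≤ s)
    (lin≤s : 2 * ℓ * (4 + 180 * 2 ^ g + 570 * g) ≤ s) (gg≤s : g * g ≤ s)
    (w : ℕ) (X≤Cm : m + w ≤ 2 ^ K * m) (enough : α +ℚ inv ℓ ≤ℚ harmonic m w)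
    where

    open Parameters g g-prime ℓ K k L s m 45<g g≤k 1≤ℓ many Ds≤L L<Ds 4P+3≤s P³≤s 2^L≤m m<2^L+1

    private
      C = 2 ^ K
      B = 64 * ℓ * m

    1≤g : 1 ≤ g
    1≤g = ≤-trans (s≤s z≤n) 45<g

    0<α : 0ℚ <ℚ α
    0<α = subst (0ℚ <ℚ_) (sym (÷⇒≡ 1≤b₀ α≡)) (0<*ℚ (0<ι 1≤a₀) (inv>0 1≤b₀))

    private instance
      4ℓ≢0 : NonZero (4 * ℓ)
      4ℓ≢0 = >-nonZero (*-mono-≤ (s≤s {n = 3} z≤n) 1≤ℓ)

    -- Greedy selection from m upwards could leave a gap of 1 / m, which may be the whole width 2^-L
    -- of the window. Starting at m + η lowers the gap by a fixed proportion, and the omitted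
    -- numbers cost at most 1 / (4 ℓ) of the sum of reciprocals.
    η : ℕ
    η = m / (4 * ℓ)

    η≤ : η * (4 * ℓ) ≤ m
    η≤ = m/n*n≤m m (4 * ℓ)

    4ℓ≤m : 4 * ℓ ≤ m
    4ℓ≤m = ≤-trans (*-monoˡ-≤ ℓ (m≤m+n 4 60)) (≤-trans 64ℓ≤s s≤m)

    1≤η : 1 ≤ η
    1≤η = m≥n⇒m/n>0 {m} {4 * ℓ} 4ℓ≤m

    ≤η : m ≤ η * (8 * ℓ)
    ≤η = ≤-trans (≤-reflexive (m≡m%n+[m/n]*n m (4 * ℓ))) (≤-trans (+-monoˡ-≤ (η * (4 * ℓ)) (<⇒≤ (m%n<n m (4 * ℓ))))
      (≤-trans (+-monoˡ-≤ (η * (4 * ℓ)) (m≤n*m (4 * ℓ) η {{>-nonZero 1≤η}})) (≤-reflexive (lem η ℓ))))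
      where
      lem : ∀ e l → e * (4 * l) + e * (4 * l) ≡ e * (8 * l)
      lem = solve-∀

    η≤w : η ≤ w
    η≤w = ≮⇒≥ λ w<η → ℚ.<-irrefl refl (ℚ.<-≤-trans 0<α (0≤-⇒≤ℚ′ (ℚ.≤-trans enough (ℚ.≤-trans
        (R-≤-length 1≤m (All.map proj₁ (interval-bounds m w)))
        (subst (ι (length (interval m w)) *ℚ inv m ≤ℚ_) (ι1* (inv ℓ)) (frac-≤ (length (interval m w)) m 1 ℓ 1≤m 1≤ℓ
          (≤-trans (*-monoˡ-≤ ℓ (≤-trans (≤-reflexive (length-interval m w)) (<⇒≤ w<η)))
            (≤-trans (*-monoʳ-≤ η (m≤n*m ℓ 4)) (≤-trans η≤ (≤-reflexive (sym (*-identityˡ m))))))))))))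
      where
      open +-*-Solver
      0≤-⇒≤ℚ′ : ∀ {a b} → a +ℚ b ≤ℚ b → a ≤ℚ 0ℚ
      0≤-⇒≤ℚ′ {a} {b} h = ≤-by (b -ℚ (a +ℚ b)) (≤⇒0≤-ℚ h) (solve 2 (λ a b → con 0ℚ := a :+ (b :- (a :+ b))) refl a b)

    w′ m″ : ℕ
    w′ = w ∸ η
    m″ = m + η

    1≤m″ : 1 ≤ m″
    1≤m″ = ≤-trans 1≤m (m≤m+n m η)

    X≡ : m″ + w′ ≡ m + w
    X≡ = trans (+-assoc m η w′) (cong (m +_) (m+[n∸m]≡n η≤w))

    split-interval : interval m w ≡ interval m″ w′ ++ interval m η
    split-interval = trans (cong (interval m) (sym (m+[n∸m]≡n η≤w))) (interval-++ m η w′)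

    xs : List ℕ
    xs = filter (_∣? M) (interval m″ w′)

    xs-spec : All (λ n → n ∣ M × m″ ≤ n) xs
    xs-spec = All.zipWith (λ (d , l , _) → d , l) (All.all-filter (_∣? M) (interval m″ w′) , All.filter⁺ (_∣? M) (interval-bounds m″ w′))

    private
      j = K + (s + s) + 2

      X≤2^ : m″ + w′ ≤ 2 ^ (k₀ + j)
      X≤2^ = begin
        m″ + w′                    ≡⟨ X≡ ⟩
        m + w                      ≤⟨ X≤Cm ⟩
        2 ^ K * m                  ≤⟨ *-monoʳ-≤ (2 ^ K) m<2ᴸ2 ⟩
        2 ^ K * 2 ^ suc L          ≡⟨ ^-distribˡ-+-* 2 K (suc L) ⟨
        2 ^ (K + suc L)            ≡⟨ cong (λ z → 2 ^ (K + suc z)) L≡ ⟩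
        2 ^ (K + suc (k₀ + (s + s + 1)))  ≡⟨ cong (2 ^_) (lem K k₀ s) ⟩
        2 ^ (k₀ + j)               ∎
        where
        open ≤-Reasoning
        lem : ∀ K a s → K + suc (a + (s + s + 1)) ≡ a + (K + (s + s) + 2)
        lem = solve-∀

      counted = nondivisors-count g k s k₀ P³≤2ˢ m″ 1≤m″ w′ j X≤2^

    bad : ℕ
    bad = count (λ n → ¬? (n ∣? M)) (interval m″ w′)

    -- Each of the three kinds of exceptions accounts for at most m / (16 ℓ): the numbers counted
    -- lie below 2^K m, and g, 2 + k and k₀ were chosen large enough to absorb the factor 2^K.
    bad-small : bad * (16 * ℓ) ≤ 3 * m
    bad-small = let a , b , c , bad≤ , ag≤ , bP≤ , ck≤ = counted in combine a b c bad≤ ag≤ bP≤ ck≤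
      where
      open ≤-Reasoning
      instance
        _ = m^n≢0 2 K
        _ = >-nonZero {j} (≤-trans (s≤s z≤n) (m≤n+m 2 (K + (s + s))))
      lem : ∀ a b c z → (a + (b + c)) * z ≡ a * z + b * z + c * z
      lem = solve-∀
      lem′ : ∀ m → m + m + m ≡ 3 * m
      lem′ = solve-∀
      linear : ∀ {a d} → 16 * (ℓ * C) ≤ d → a * d ≤ m″ + w′ → a * (16 * ℓ) ≤ m
      linear {a} {d} big h = *-cancelʳ-≤ (a * (16 * ℓ)) m C (begin
        a * (16 * ℓ) * C       ≡⟨ shape a ℓ C ⟩
        a * (16 * (ℓ * C))     ≤⟨ *-monoʳ-≤ a big ⟩
        a * d                  ≤⟨ h ⟩
        m″ + w′                ≡⟨ X≡ ⟩
        m + w                  ≤⟨ X≤Cm ⟩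
        C * m                  ≡⟨ *-comm C m ⟩
        m * C                  ∎)
        where
        shape : ∀ a l c → a * (16 * l) * c ≡ a * (16 * (l * c))
        shape = solve-∀
      c≤ : ∀ {c} → c * k₀ ≤ 2 * (m″ + w′) * j → c * (16 * ℓ) ≤ m
      c≤ {c} ck≤ = *-cancelʳ-≤ (c * (16 * ℓ)) m (2 * C * j) {{m*n≢0 (2 * C) j {{m*n≢0 2 C}}}} (begin
        c * (16 * ℓ) * (2 * C * j)    ≡⟨ shape c ℓ C j ⟩
        c * (32 * (ℓ * C) * j)        ≤⟨ *-monoʳ-≤ c k₀-big ⟩
        c * k₀                        ≤⟨ ck≤ ⟩
        2 * (m″ + w′) * j             ≡⟨ cong (λ z → 2 * z * j) X≡ ⟩
        2 * (m + w) * j               ≤⟨ *-monoˡ-≤ j (*-monoʳ-≤ 2 X≤Cm) ⟩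
        2 * (C * m) * j               ≡⟨ shape′ C m j ⟩
        m * (2 * C * j)               ∎)
        where
        shape : ∀ c l C j → c * (16 * l) * (2 * C * j) ≡ c * (32 * (l * C) * j)
        shape = solve-∀
        shape′ : ∀ C m j → 2 * (C * m) * j ≡ m * (2 * C * j)
        shape′ = solve-∀
      combine : ∀ a b c → bad ≤ a + (b + c) → a * g ≤ m″ + w′ → b * (2 + k) ≤ m″ + w′ → c * k₀ ≤ 2 * (m″ + w′) * j → bad * (16 * ℓ) ≤ 3 * m
      combine a b c bad≤ ag≤ bP≤ ck≤ = begin
        bad * (16 * ℓ)                                     ≤⟨ *-monoˡ-≤ (16 * ℓ) bad≤ ⟩
        (a + (b + c)) * (16 * ℓ)                           ≡⟨ lem a b c (16 * ℓ) ⟩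
        a * (16 * ℓ) + b * (16 * ℓ) + c * (16 * ℓ)         ≤⟨ +-mono-≤ (+-mono-≤ (linear {a} g-big ag≤) (linear {b} k-big bP≤)) (c≤ {c} ck≤) ⟩
        m + m + m                                          ≡⟨ lem′ m ⟩
        3 * m                                              ∎

    -- `enough` leaves 1 / ℓ to spare. The numbers lost, η at the lower end and the nondivisors, are
    -- at most m / ℓ in all, and each has a reciprocal of at most 1 / m.
    α≤Rxs : α ≤ℚ R xs
    α≤Rxs = ℚ-cancel (begin
        α +ℚ inv ℓ                                           ≤⟨ enough ⟩
        R (interval m w)                                     ≡⟨ trans (cong R split-interval) (∑-++ inv (interval m″ w′) (interval m η)) ⟩
        R (interval m″ w′) +ℚ R (interval m η)               ≤⟨ ℚ.+-mono-≤ (R-filter (_∣? M) 1≤m″ (All.map proj₁ (interval-bounds m″ w′))) (R-≤-length 1≤m (All.map proj₁ (interval-bounds m η))) ⟩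
        R xs +ℚ ι bad *ℚ inv m″ +ℚ ι (length (interval m η)) *ℚ inv m   ≤⟨ ℚ.+-mono-≤ (ℚ.+-monoʳ-≤ (R xs) (*ℚ-monoˡ (0≤ι bad) (inv-anti 1≤m (m≤m+n m η)))) (ℚ.≤-reflexive (cong (λ z → ι z *ℚ inv m) (length-interval m η))) ⟩
        R xs +ℚ ι bad *ℚ inv m +ℚ ι η *ℚ inv m               ≡⟨ trans (ℚ.+-assoc (R xs) (ι bad *ℚ inv m) (ι η *ℚ inv m)) (cong (R xs +ℚ_) (trans (sym (ℚ.*-distribʳ-+ (inv m) (ι bad) (ι η))) (cong (_*ℚ inv m) (sym (ι-+ bad η))))) ⟩
        R xs +ℚ ι (bad + η) *ℚ inv m                         ≤⟨ ℚ.+-monoʳ-≤ (R xs) (subst (ι (bad + η) *ℚ inv m ≤ℚ_) (ι1* (inv ℓ)) (frac-≤ (bad + η) m 1 ℓ 1≤m 1≤ℓ small)) ⟩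
        R xs +ℚ inv ℓ                                        ∎)
      where
      open ℚ.≤-Reasoning
      ℚ-cancel : ∀ {a b c} → a +ℚ c ≤ℚ b +ℚ c → a ≤ℚ b
      ℚ-cancel {a} {b} {c} h = ≤-by (b +ℚ c -ℚ (a +ℚ c)) (≤⇒0≤-ℚ h) (solve 3 (λ a b c → b := a :+ (b :+ c :- (a :+ c))) refl a b c)
        where open +-*-Solver
      small : (bad + η) * ℓ ≤ 1 * m
      small = *-cancelʳ-≤ ((bad + η) * ℓ) (1 * m) 16 (≤-trans (≤-reflexive (lem bad η ℓ))
        (≤-trans (+-mono-≤ bad-small (*-monoʳ-≤ 4 η≤)) (≤-trans (m≤m+n (3 * m + 4 * m) (9 * m)) (≤-reflexive (lem′ m)))))
        where
        lem : ∀ b e l → (b + e) * l * 16 ≡ b * (16 * l) + 4 * (e * (4 * l))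
        lem = solve-∀
        lem′ : ∀ m → 3 * m + 4 * m + 9 * m ≡ 1 * m * 16
        lem′ = solve-∀

    Dn : ℕ
    Dn = W * (Q * 2 ^ h)

    -- `Dn` has 2^h where M has 2^s, and h - s = L + P + 2.
    M-lift : ∀ {n x} → x ≤ L + P + 2 → n ∣ M → n * 2 ^ x ∣ Dn
    M-lift {n} {x} x≤ n∣M = ∣-trans (*-monoˡ-∣ (2 ^ x) n∣M) (divides (2 ^ (L + P + 2 ∸ x)) (begin
        W * (Q * 2 ^ h)                                              ≡⟨ cong (λ z → W * (Q * 2 ^ z)) h≡ ⟩
        W * (Q * 2 ^ ((L + P + 2 ∸ x) + (s + x)))                    ≡⟨ cong (λ z → W * (Q * z)) (trans (^-distribˡ-+-* 2 (L + P + 2 ∸ x) (s + x)) (cong (2 ^ (L + P + 2 ∸ x) *_) (^-distribˡ-+-* 2 s x))) ⟩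
        W * (Q * (2 ^ (L + P + 2 ∸ x) * (2 ^ s * 2 ^ x)))            ≡⟨ lem W Q (2 ^ (L + P + 2 ∸ x)) (2 ^ s) (2 ^ x) ⟩
        2 ^ (L + P + 2 ∸ x) * (M * 2 ^ x)                            ∎))
      where
      open ≡-Reasoning
      lem : ∀ W Q y s x → W * (Q * (y * (s * x))) ≡ y * (s * (W * Q) * x)
      lem = solve-∀
      h≡ : h ≡ (L + P + 2 ∸ x) + (s + x)
      h≡ = trans (lem₁ L s P) (trans (cong (s +_) (sym (m∸n+n≡m x≤))) (lem₂ s (L + P + 2 ∸ x) x))
        where
        lem₁ : ∀ L s P → L + (s + P + 2) ≡ s + (L + P + 2)
        lem₁ = solve-∀
        lem₂ : ∀ s y x → s + (y + x) ≡ y + (s + x)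
        lem₂ = solve-∀

    M∣Dn : ∀ {n} → n ∣ M → n ∣ Dn
    M∣Dn {n} n∣M = subst (_∣ Dn) (*-identityʳ n) (M-lift {n} {0} z≤n n∣M)

    g≤P : g ≤ P
    g≤P = ≤-trans g≤k (m≤n+m k 3)

    -- The unit fraction 1 / e removes the prime g from the denominator of α / g.
    He : ℕ
    He = scaling m m (g * g)

    private
      He-spec = scale-to m {g * g} (*-mono-≤ 1≤g 1≤g) (≤-trans gg≤s (≤-trans s≤m (m≤n*m m 2)))

      A₀ = a₀ * 2 ^ He

      small∤ : ∀ {x} → 1 ≤ x → x < g → ¬ g ∣ x
      small∤ 1≤x x<g g∣x = <⇒≱ x<g (∣⇒≤ {{>-nonZero 1≤x}} g∣x)

      g⊥2 : Coprime g 2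
      g⊥2 = primes-coprime g-prime prime[2] (>⇒≢ (≤-trans (m≤m+n 3 43) 45<g))

      A₀⊥g : Coprime A₀ g
      A₀⊥g = Coprimality.sym (coprime-*ʳ (prime-coprime g-prime (small∤ 1≤a₀ a₀<g)) (coprime-^ʳ He g⊥2))

      -- The target is -b₀ modulo g, so that g divides A₀ i + b₀, the numerator of α / g + 1 / e
      -- over b₀ g i 2^He. The multiple A₀ g of g in it guarantees that A₀ v does not exceed the
      -- target.
      solved = congruence {A₀} {g} 1≤g A₀⊥g (b₀ * (g ∸ 1) + A₀ * g)
      v = proj₁ solved
      v<g = proj₁ (proj₂ solved)
      y₀ = proj₂ (proj₂ solved) (≤-trans (*-monoʳ-≤ A₀ (<⇒≤ v<g)) (m≤n+m (A₀ * g) (b₀ * (g ∸ 1))))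

    i : ℕ
    i = g + v

    g∣ : g ∣ A₀ * i + b₀
    g∣ = subst (g ∣_) (lem A₀ g v b₀) (∣m∣n⇒∣m+n (n∣m*n A₀) (∣m+n∣m⇒∣n {g} {proj₁ y₀ * g} {A₀ * v + b₀}
        (subst (g ∣_) eq (n∣m*n (b₀ + A₀))) (n∣m*n (proj₁ y₀))))
      where
      lem : ∀ A g v b → A * g + (A * v + b) ≡ A * (g + v) + b
      lem = solve-∀
      eq : (b₀ + A₀) * g ≡ proj₁ y₀ * g + (A₀ * v + b₀)
      eq = trans (trans (cong ((b₀ + A₀) *_) (sym (m+[n∸m]≡n 1≤g))) (trans (lem₁ b₀ A₀ (g ∸ 1)) (cong (λ z → b₀ * (g ∸ 1) + A₀ * z + b₀) (m+[n∸m]≡n 1≤g))))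
        (trans (cong (_+ b₀) (proj₂ y₀)) (lem₂ (A₀ * v) (proj₁ y₀ * g) b₀))
        where
        lem₁ : ∀ b A j → (b + A) * (1 + j) ≡ b * j + A * (1 + j) + b
        lem₁ = solve-∀
        lem₂ : ∀ x y b → x + y + b ≡ y + (x + b)
        lem₂ = solve-∀

    u : ℕ
    u = quotient g∣

    -- Since g² 2^He lies between m and 2 m and i between g and 2 g, this number lies between m and
    -- 4 m, below all the multiples of g that come from the supplied partition.
    e : ℕ
    e = g * i * 2 ^ He

    1≤i : 1 ≤ i
    1≤i = ≤-trans 1≤g (m≤m+n g v)

    m≤e : m ≤ e
    m≤e = ≤-trans (proj₁ He-spec) (*-monoˡ-≤ (2 ^ He) (*-monoʳ-≤ g (m≤m+n g v)))

    e<4m : e < 4 * m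
    e<4m = <-≤-trans (*-monoˡ-< (2 ^ He) {{m^n≢0 2 He}} (*-monoʳ-< g {{>-nonZero 1≤g}} (+-monoʳ-< g v<g)))
      (≤-trans (≤-reflexive (lem g (2 ^ He))) (≤-trans (*-monoʳ-≤ 2 (proj₂ He-spec)) (≤-reflexive (sym (*-assoc 2 2 m)))))
      where
      lem : ∀ g x → g * (g + g) * x ≡ 2 * (g * g * x)
      lem = solve-∀

    1≤e : 1 ≤ e
    1≤e = ≤-trans 1≤m m≤e

    g-part : (inv g *ℚ α +ℚ inv e) is u ÷ (b₀ * i * 2 ^ He)
    g-part = ÷-unscale 1≤g (÷-cong (_∣_.equality g∣) refl (÷-+
        (÷-cong (lem₁ a₀ i (2 ^ He)) (lem₂ b₀ g i (2 ^ He)) (÷-scale (i * 2 ^ He) (÷-*-inv g 1≤g α≡)))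
        (÷-cong (*-identityˡ b₀) (lem₃ g i (2 ^ He) b₀) (÷-scale b₀ (÷-unit 1≤e)))))
      where
      lem₁ : ∀ a i x → a * (i * x) ≡ a * x * i
      lem₁ = solve-∀
      lem₂ : ∀ b g i x → b * g * (i * x) ≡ b * i * x * g
      lem₂ = solve-∀
      lem₃ : ∀ g i x b → g * i * x * b ≡ b * i * x * g
      lem₃ = solve-∀

    g∤i : ¬ g ∣ i
    g∤i g∣i = small∤ 1≤b₀ b₀<g (∣m+n∣m⇒∣n {g} {A₀ * i} {b₀} g∣ (∣-trans g∣i (n∣m*n A₀)))

    b₀i∣M : b₀ * i ∣ M
    b₀i∣M = small∣M (*-mono-≤ 1≤b₀ 1≤i) (≤-trans (*-monoʳ-≤ b₀ (+-monoʳ-≤ g (<⇒≤ v<g))) b₀2g≤P) ∤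
      where
      ∤ : ¬ g ∣ b₀ * i
      ∤ d with euclidsLemma b₀ i g-prime d
      ... | inj₁ g∣b₀ = small∤ 1≤b₀ b₀<g g∣b₀
      ... | inj₂ g∣i  = g∤i g∣i

    b₀∣M : b₀ ∣ M
    b₀∣M = ∣-trans (m∣m*n i) b₀i∣M

    He≤ : He ≤ L + P + 2
    He≤ = 2^-≤ (begin
        2 ^ He               ≤⟨ m≤n*m (2 ^ He) (g * g) {{>-nonZero (*-mono-≤ 1≤g 1≤g)}} ⟩
        g * g * 2 ^ He       ≤⟨ proj₂ He-spec ⟩
        2 * m                ≤⟨ *-monoʳ-≤ 2 m<2ᴸ2 ⟩
        2 ^ (2 + L)          ≤⟨ ^-monoʳ-≤ 2 (≤-trans (≤-reflexive (+-comm 2 L)) (+-monoˡ-≤ 2 (m≤m+n L P))) ⟩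
        2 ^ (L + P + 2)      ∎)
      where open ≤-Reasoning

    -- The power 2^(L + 1) puts the toggles above m and gives them more factors 2 than any divisor
    -- of M has; the factor 15 distinguishes them from the corrective fractions.
    c : ℕ
    c = 15 * 2 ^ suc L

    1≤c : 1 ≤ c
    1≤c = *-mono-≤ (s≤s {n = 14} z≤n) (m^n>0 2 (suc L))

    m≤c : m ≤ c
    m≤c = ≤-trans (<⇒≤ m<2^L+1) (m≤n*m (2 ^ suc L) 15)

    c≤30m : c ≤ 30 * m
    c≤30m = ≤-trans (≤-reflexive (sym (*-assoc 15 2 (2 ^ L)))) (*-monoʳ-≤ 30 2^L≤m)

    -- Up to a power of 2 this number is 45, which divides M as a number up to P that is not a
    -- multiple of g. This is one source of the condition 45 < g.
    toggle-∣ : 6 * c * 2 ^ g ∣ Dn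
    toggle-∣ = subst (_∣ Dn) (trans (cong (45 *_) (^-distribˡ-+-* 2 (2 + L) g)) (lem (2 ^ L) (2 ^ g)))
      (M-lift {45} {2 + L + g} (≤-trans (≤-reflexive (lem′ L g)) (+-monoˡ-≤ 2 (+-monoʳ-≤ L g≤P)))
        (small∣M (s≤s z≤n) (≤-trans (<⇒≤ 45<g) g≤P) (small∤ (s≤s z≤n) 45<g)))
      where
      lem : ∀ x y → 45 * (2 * (2 * x) * y) ≡ 6 * (15 * (2 * x)) * y
      lem = solve-∀
      lem′ : ∀ L g → 2 + L + g ≡ L + g + 2
      lem′ = solve-∀

    σ : ℚ
    σ = inv g *ℚ α +ℚ inv e +ℚ toggleSum c g

    private
      drift≤ : ∀ {p} → PsOK p → drift p ≤ℚ inv m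
      drift≤ {p} (2≤p , _ , _ , _ , lo , _) = subst (drift p ≤ℚ_) (ι1* (inv m)) (frac-≤ t (p * 2 ^ H p) 1 m
        (*-mono-≤ (≤-trans (n≤1+n 1) 2≤p) (m^n>0 2 (H p))) 1≤m
        (≤-trans (*-monoˡ-≤ m (<⇒≤ t<2ᴾ)) (≤-trans lo (≤-reflexive (sym (*-identityˡ _))))))

      invQ≤ : inv Q ≤ℚ inv m
      invQ≤ = inv-anti 1≤m (≤-trans (≤-trans (m≤m*n m (m * m) {{>-nonZero (*-mono-≤ 1≤m 1≤m)}}) (≤-reflexive (sym (*-assoc m m m)))) Q-big)

      t64ℓm≤ : t * B ≤ 2 ^ h
      t64ℓm≤ = begin
        t * (64 * ℓ * m)                      ≤⟨ *-mono-≤ (<⇒≤ t<2ᴾ) (*-mono-≤ (≤-trans 64ℓ≤s (n≤2^n s)) m<2ᴸ2) ⟩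
        2 ^ P * (2 ^ s * (2 * 2 ^ L))         ≤⟨ m≤m*n _ 2 ⟩
        2 ^ P * (2 ^ s * (2 * 2 ^ L)) * 2     ≡⟨ lem (2 ^ P) (2 ^ s) (2 ^ L) ⟩
        2 ^ L * (2 ^ s * 2 ^ P * 2 ^ 2)       ≡⟨ trans (cong (λ z → 2 ^ L * (z * 2 ^ 2)) (sym (^-distribˡ-+-* 2 s P))) (trans (cong (2 ^ L *_) (sym (^-distribˡ-+-* 2 (s + P) 2))) (sym (^-distribˡ-+-* 2 L nz))) ⟩
        2 ^ h                                 ∎
        where
        open ≤-Reasoning
        lem : ∀ p s l → p * (s * (2 * l)) * 2 ≡ l * (s * p * 4)
        lem = solve-∀

      1≤B : 1 ≤ B
      1≤B = *-mono-≤ (*-mono-≤ (s≤s {n = 63} z≤n) 1≤ℓ) 1≤m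

      lower[]≤B : lower [] ≤ℚ inv B
      lower[]≤B = subst (lower [] ≤ℚ_) (ι1* (inv B)) (frac-≤ t (2 ^ h) 1 B (m^n>0 2 h) 1≤B (≤-trans t64ℓm≤ (≤-reflexive (sym (*-identityˡ (2 ^ h))))))

      m≤B : m ≤ B
      m≤B = m≤n*m m (64 * ℓ) {{>-nonZero (*-mono-≤ (s≤s {n = 63} z≤n) 1≤ℓ)}}

      lower≤ : ∀ {ps} → All PsOK ps → lower ps ≤ℚ ι (length ps + length ps + 1) *ℚ inv m
      lower≤ []                  = ℚ.≤-trans lower[]≤B (ℚ.≤-trans (inv-anti 1≤m m≤B) (ℚ.≤-reflexive (sym (ι1* (inv m)))))
      lower≤ {p ∷ ps} (ok ∷ oks) = ℚ.≤-trans (ℚ.+-mono-≤ (ℚ.+-mono-≤ (drift≤ ok) invQ≤) (lower≤ oks)) (ℚ.≤-reflexive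
        (trans (cong (λ z → z +ℚ z +ℚ ι (length ps + length ps + 1) *ℚ inv m) (sym (ι1* (inv m))))
        (trans (solve 3 (λ a b i → a :* i :+ a :* i :+ b :* i := (a :+ a :+ b) :* i) refl (ι 1) (ι (length ps + length ps + 1)) (inv m))
          (cong (_*ℚ inv m) (trans (cong (_+ℚ ι (length ps + length ps + 1)) (sym (ι-+ 1 1))) (trans (sym (ι-+ 2 (length ps + length ps + 1)))
            (cong ι (lem (length ps)))))))))
        where
        open +-*-Solver
        lem : ∀ l → 2 + (l + l + 1) ≡ suc l + suc l + 1
        lem = solve-∀

    -- The share α / g is at most half of α. All the rest is at most 2 |ps| + 3 times 1 / m, and
    -- |ps| ≤ U is smaller than m by the factor 2^(2s + 1), so it fits into the other half.
    small-parts : σ +ℚ lower ps ≤ℚ α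
    small-parts = begin
        inv g *ℚ α +ℚ inv e +ℚ toggleSum c g +ℚ lower ps     ≤⟨ ℚ.+-mono-≤ (ℚ.+-mono-≤ (ℚ.+-mono-≤ (*ℚ-monoʳ (ℚ.<⇒≤ 0<α) (inv-anti (s≤s z≤n) (≤-trans (m≤m+n 2 44) 45<g)))
                                                                  (inv-anti 1≤m m≤e)) (ℚ.≤-trans (toggleSum-≤ c 1≤c g) (inv-anti 1≤m m≤c))) (lower≤ ps-ok) ⟩
        inv 2 *ℚ α +ℚ inv m +ℚ inv m +ℚ ι l *ℚ inv m         ≡⟨ trans (cong (λ z → inv 2 *ℚ α +ℚ z +ℚ z +ℚ ι l *ℚ inv m) (sym (ι1* (inv m))))
                                                                  (trans (solve 4 (λ x a b i → x :+ a :* i :+ a :* i :+ b :* i := x :+ (a :+ a :+ b) :* i) refl (inv 2 *ℚ α) (ι 1) (ι l) (inv m))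
                                                                  (cong (λ z → inv 2 *ℚ α +ℚ z *ℚ inv m) (trans (cong (_+ℚ ι l) (sym (ι-+ 1 1))) (sym (ι-+ 2 l))))) ⟩
        inv 2 *ℚ α +ℚ ι (2 + l) *ℚ inv m                     ≤⟨ ℚ.+-monoʳ-≤ (inv 2 *ℚ α) (frac-≤ (2 + l) m a₀ (b₀ * 2) 1≤m (*-mono-≤ 1≤b₀ (s≤s z≤n)) count-small) ⟩
        inv 2 *ℚ α +ℚ ι a₀ *ℚ inv (b₀ * 2)                   ≡⟨ cong (inv 2 *ℚ α +ℚ_) (sym (÷⇒≡ (*-mono-≤ 1≤b₀ (s≤s z≤n)) (÷-*-inv 2 (s≤s z≤n) α≡))) ⟩
        inv 2 *ℚ α +ℚ inv 2 *ℚ α                             ≡⟨ trans (sym (ℚ.*-distribʳ-+ α (inv 2) (inv 2))) (trans (cong (_*ℚ α) halves) (ℚ.*-identityˡ α)) ⟩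
        α                                                    ∎
      where
      open ℚ.≤-Reasoning
      open +-*-Solver
      l = length ps + length ps + 1
      halves : inv 2 +ℚ inv 2 ≡ 1ℚ
      halves = trans (cong₂ _+ℚ_ (sym (ι1* (inv 2))) (sym (ι1* (inv 2)))) (trans (sym (ℚ.*-distribʳ-+ (inv 2) (ι 1) (ι 1)))
        (trans (cong (_*ℚ inv 2) (sym (ι-+ 1 1))) (ι-inv {2} (s≤s z≤n))))
      count-small : (2 + l) * (b₀ * 2) ≤ a₀ * m
      count-small = ≤-trans (*-monoˡ-≤ (b₀ * 2) (+-monoʳ-≤ 2 (+-monoˡ-≤ 1 (+-mono-≤ length-ps length-ps))))
        (≤-trans (*-monoˡ-≤ (b₀ * 2) (≤-trans (≤-reflexive (lem (2 ^ k₀))) (+-monoʳ-≤ (2 * 2 ^ k₀) (*-monoʳ-≤ 3 (m^n>0 2 k₀)))))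
        (≤-trans (≤-reflexive (lem′ (2 ^ k₀) b₀)) (≤-trans (*-monoʳ-≤ (2 ^ k₀) (≤-trans (*-monoˡ-≤ b₀ (m≤m+n 10 6)) (≤-trans 16b₀≤s (n≤2^n s))))
        (≤-trans (*-monoʳ-≤ (2 ^ k₀) (m≤m*n (2 ^ s) (2 ^ s * 2) {{m*n≢0 (2 ^ s) 2 {{m^n≢0 2 s}}}})) (≤-trans (≤-reflexive (sym 2^L≡)) (≤-trans 2^L≤m (m≤n*m m a₀ {{>-nonZero 1≤a₀}})))))))
        where
        lem : ∀ x → 2 + (x + x + 1) ≡ 2 * x + 3 * 1
        lem = solve-∀
        lem′ : ∀ x b → (2 * x + 3 * x) * (b * 2) ≡ x * (10 * b)
        lem′ = solve-∀

    -- The drifts cancel between the two ends. In units of 1 / B, where B = 64 ℓ m, the terms |ps| /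
    -- Q and `lower []` cost at most one unit each and 1 / (m + η) at most 64 ℓ - 4, because η ≥ m /
    -- (8 ℓ). The total stays below 64 ℓ units, which are 1 / m ≤ 2^-L = `upper []`.
    margin : lower ps +ℚ inv m″ <ℚ upper ps
    margin = gap ps (inv m″) (ℚ.≤-<-trans (ℚ.+-mono-≤ (ℚ.+-mono-≤ count≤ m″≤) lower[]≤B) strict)
      where
      open +-*-Solver
      gap : ∀ ps δ → ι (length ps) *ℚ inv Q +ℚ δ +ℚ lower [] <ℚ upper [] → lower ps +ℚ δ <ℚ upper ps
      gap []       δ h = ℚ.≤-<-trans (ℚ.≤-reflexive (trans (ℚ.+-comm (lower []) δ) (cong (_+ℚ lower []) (sym (trans (cong (λ z → z *ℚ inv Q +ℚ δ) ι-0)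
                           (trans (cong (_+ℚ δ) (ℚ.*-zeroˡ (inv Q))) (ℚ.+-identityˡ δ))))))) h
      gap (p ∷ ps) δ h = ℚ.≤-<-trans (ℚ.≤-reflexive (solve 4 (λ d q l δ → d :+ q :+ l :+ δ := d :+ (l :+ (δ :+ q))) refl (drift p) (inv Q) (lower ps) δ))
        (ℚ.+-monoʳ-< (drift p) (gap ps (δ +ℚ inv Q) (ℚ.≤-<-trans (ℚ.≤-reflexive (trans
          (solve 4 (λ a q δ l → a :* q :+ (δ :+ q) :+ l := (con 1ℚ :+ a) :* q :+ δ :+ l) refl (ι (length ps)) (inv Q) δ (lower []))
          (cong (λ z → z *ℚ inv Q +ℚ δ +ℚ lower []) (trans (cong (_+ℚ ι (length ps)) (sym ι-1)) (sym (ι-+ 1 (length ps))))))) h)))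
      count≤ : ι (length ps) *ℚ inv Q ≤ℚ ι 1 *ℚ inv B
      count≤ = frac-≤ (length ps) Q 1 B 1≤Q 1≤B (≤-trans (*-mono-≤ (≤-trans length-ps U≤m) (*-monoˡ-≤ m (≤-trans 64ℓ≤s s≤m)))
        (≤-trans (≤-reflexive (trans (sym (*-assoc m m m)) refl)) (≤-trans Q-big (≤-reflexive (sym (*-identityˡ Q))))))
      4≤64ℓ : 4 ≤ 64 * ℓ
      4≤64ℓ = ≤-trans (m≤m+n 4 60) (m≤m*n 64 ℓ {{>-nonZero 1≤ℓ}})
      m″≤ : inv m″ ≤ℚ ι (64 * ℓ ∸ 4) *ℚ inv B
      m″≤ = subst (_≤ℚ ι (64 * ℓ ∸ 4) *ℚ inv B) (ι1* (inv m″)) (frac-≤ 1 m″ (64 * ℓ ∸ 4) B 1≤m″ 1≤B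
        (+-cancelˡ-≤ (4 * m″) (1 * B) ((64 * ℓ ∸ 4) * m″) (≤-trans (+-monoˡ-≤ (1 * B) key) (≤-reflexive
          (trans (lem ℓ m η) (trans (cong (_* m″) (sym (m+[n∸m]≡n 4≤64ℓ))) (*-distribʳ-+ m″ 4 (64 * ℓ ∸ 4))))))))
        where
        key : 4 * m″ ≤ 64 * ℓ * η
        key = ≤-trans (*-monoʳ-≤ 4 (+-mono-≤ ≤η (m≤m*n η (8 * ℓ) {{>-nonZero (*-mono-≤ (s≤s {n = 7} z≤n) 1≤ℓ)}}))) (≤-reflexive (lem′ η ℓ))
          where
          lem′ : ∀ e l → 4 * (e * (8 * l) + e * (8 * l)) ≡ 64 * l * e
          lem′ = solve-∀
        lem : ∀ l m e → 64 * l * e + 1 * (64 * l * m) ≡ 64 * l * (m + e)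
        lem = solve-∀
      strict : ι 1 *ℚ inv B +ℚ ι (64 * ℓ ∸ 4) *ℚ inv B +ℚ inv B <ℚ upper []
      strict = ℚ.≤-<-trans (ℚ.≤-reflexive (trans (cong (λ z → ι 1 *ℚ inv B +ℚ ι (64 * ℓ ∸ 4) *ℚ inv B +ℚ z) (sym (ι1* (inv B))))
          (trans (solve 3 (λ a b i → a :* i :+ b :* i :+ a :* i := (a :+ b :+ a) :* i) refl (ι 1) (ι (64 * ℓ ∸ 4)) (inv B))
            (cong (_*ℚ inv B) (trans (cong (_+ℚ ι 1) (sym (ι-+ 1 (64 * ℓ ∸ 4)))) (sym (ι-+ (1 + (64 * ℓ ∸ 4)) 1)))))))
        (frac-< (1 + (64 * ℓ ∸ 4) + 1) B (2 ^ nz) (2 ^ h) 1≤B (m^n>0 2 h) (begin-strict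
          (1 + (64 * ℓ ∸ 4) + 1) * 2 ^ h         <⟨ *-monoˡ-< (2 ^ h) {{m^n≢0 2 h}} {1 + (64 * ℓ ∸ 4) + 1} {64 * ℓ} short ⟩
          64 * ℓ * 2 ^ h                         ≡⟨ cong (64 * ℓ *_) (^-distribˡ-+-* 2 L nz) ⟩
          64 * ℓ * (2 ^ L * 2 ^ nz)              ≤⟨ *-monoʳ-≤ (64 * ℓ) (*-monoˡ-≤ (2 ^ nz) 2^L≤m) ⟩
          64 * ℓ * (m * 2 ^ nz)                  ≡⟨ lem (64 * ℓ) m (2 ^ nz) ⟩
          2 ^ nz * B                             ∎))
        where
        open ≤-Reasoning
        lem : ∀ l m x → l * (m * x) ≡ x * (l * m)
        lem = solve-∀
        short : 1 + (64 * ℓ ∸ 4) + 1 < 64 * ℓ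
        short = ≤-trans (≤-reflexive (trans (cong suc (+-comm (1 + (64 * ℓ ∸ 4)) 1)) refl)) (≤-trans (n≤1+n _) (≤-reflexive (m+[n∸m]≡n 4≤64ℓ)))

    private
      0≤lower : ∀ ps → 0ℚ ≤ℚ lower ps
      0≤lower []       = 0≤*ℚ (0≤ι t) (0≤inv (2 ^ h))
      0≤lower (p ∷ ps) = 0≤+ℚ (0≤+ℚ (0≤*ℚ (0≤ι t) (0≤inv (p * 2 ^ H p))) (0≤inv Q)) (0≤lower ps)

      0≤toggleSum : ∀ c n → 0ℚ ≤ℚ toggleSum c n
      0≤toggleSum c zero    = ℚ.≤-refl
      0≤toggleSum c (suc n) = 0≤+ℚ (0≤inv (6 * c)) (0≤toggleSum (2 * c) n)

      0≤σ : 0ℚ ≤ℚ σ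
      0≤σ = 0≤+ℚ (0≤+ℚ (0≤*ℚ (0≤inv g) (ℚ.<⇒≤ 0<α)) (0≤inv e)) (0≤toggleSum c g)

    -- The share of the divisors of M: at least `lower ps` has to be left for the corrections.
    θ : ℚ
    θ = α -ℚ (σ +ℚ lower ps)

    private
      θ≤α : θ ≤ℚ α
      θ≤α = ≤-by (σ +ℚ lower ps) (0≤+ℚ 0≤σ (0≤lower ps)) (solve 2 (λ a b → a := a :- b :+ b) refl α (σ +ℚ lower ps))
        where open +-*-Solver

      chosen = greedy xs (All.map proj₂ xs-spec) 1≤m″ θ (≤⇒0≤-ℚ small-parts) (ℚ.≤-trans θ≤α α≤Rxs)

    A : List ℕ
    A = take (proj₁ chosen) xs

    RA≤θ : R A ≤ℚ θ
    RA≤θ = proj₁ (proj₂ chosen)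

    θ≤RA+ : θ ≤ℚ R A +ℚ inv m″
    θ≤RA+ = proj₂ (proj₂ chosen)

    A-spec : All (λ n → n ∣ M × m″ ≤ n) A
    A-spec = All.take⁺ (proj₁ chosen) xs-spec

    A-unique : Unique A
    A-unique = Unique.take⁺ (proj₁ chosen) (Unique.filter⁺ (_∣? M) (interval-unique m″ w′))

    sum-A : sum A ≤ sum (interval m w)
    sum-A = ≤-trans (sum-take-≤ (proj₁ chosen) xs) (≤-trans (sum-filter-≤ (_∣? M) (interval m″ w′))
      (≤-trans (m≤m+n (sum (interval m″ w′)) (sum (interval m η))) (≤-reflexive (sym (trans (cong sum split-interval)
        (ListAction.sum-++ (interval m″ w′) (interval m η)))))))

    τ : ℚ
    τ = α -ℚ (σ +ℚ R A)

    low : lower ps ≤ℚ τ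
    low = ≤-by (θ -ℚ R A) (≤⇒0≤-ℚ RA≤θ) (solve 4 (λ a s l r → a :- (s :+ r) := l :+ (a :- (s :+ l) :- r)) refl α σ (lower ps) (R A))
      where open +-*-Solver

    high : τ <ℚ upper ps
    high = ℚ.≤-<-trans (≤-by (R A +ℚ inv m″ -ℚ θ) (≤⇒0≤-ℚ θ≤RA+)
      (solve 5 (λ a s l r i → l :+ i := a :- (s :+ r) :+ (r :+ i :- (a :- (s :+ l)))) refl α σ (lower ps) (R A) (inv m″))) margin
      where open +-*-Solver

    τ-÷ : ∃ λ y → τ is y ÷ Dn
    τ-÷ =
      let A′ , eα = inflate (M∣Dn b₀∣M) α≡
          B₁ , e₁ = inflate (M-lift He≤ b₀i∣M) g-part
          B₂ , e₂ = inflate toggle-∣ (proj₂ (toggleSum-÷ c 1≤c g))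
          B₃ , e₃ = R-÷ {Dn} (All.map (λ (d , l) → ≤-trans 1≤m″ l , M∣Dn d) A-spec)
          eσ = ÷-+ (÷-+ e₁ e₂) e₃
      in A′ ∸ (B₁ + B₂ + B₃) , ÷-- (÷-cong (sym (m+[n∸m]≡n (÷-≤⇒≤ eσ eα total))) refl eα) eσ
      where
      total : σ +ℚ R A ≤ℚ α
      total = 0≤-⇒≤ℚ (ℚ.≤-trans (0≤lower ps) low)

    private
      completed = complete 1≤m qs-coprime qs-ok t<2ᴾ P≤s (+-monoˡ-≤ nz s≤L)
        (≤-trans (m≤m+n (s + s) (s + s)) (≤-trans 4s≤L (m≤m+n L nz)))
        (subst (λ z → m ≤ 2 ^ suc z) (sym h∸nz) (<⇒≤ m<2^L+1)) fits ps ps-ok ps-coprime τ (proj₁ τ-÷) (proj₂ τ-÷) low high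
        where
        open ≤-Reasoning
        fits : 2 ^ P * m ≤ 2 ^ h
        fits = begin
          2 ^ P * m              ≤⟨ *-monoʳ-≤ (2 ^ P) (<⇒≤ m<2^L+1) ⟩
          2 ^ P * 2 ^ suc L      ≡⟨ ^-distribˡ-+-* 2 P (suc L) ⟨
          2 ^ (P + suc L)        ≤⟨ ^-monoʳ-≤ 2 (≤-trans (m≤m+n (P + suc L) (s + 1)) (≤-reflexive (lem P L s))) ⟩
          2 ^ h                  ∎
          where
          lem : ∀ P L s → P + suc L + (s + 1) ≡ L + (s + P + 2)
          lem = solve-∀

    F : List ℕ
    F = proj₁ completed

    R-F : R F ≡ τ
    R-F = proj₁ (proj₂ completed)

    F-unique : Unique F
    F-unique = proj₁ (proj₂ (proj₂ completed))

    F-large : All (m ≤_) F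
    F-large = proj₁ (proj₂ (proj₂ (proj₂ completed)))

    F-shape : All (Shape ps) F
    F-shape = proj₁ (proj₂ (proj₂ (proj₂ (proj₂ completed))))

    private
      ℓ2^≤ : ∀ {a} → ℓ * 2 ^ a ≤ 2 ^ (ℓ + a)
      ℓ2^≤ {a} = ≤-trans (*-monoˡ-≤ (2 ^ a) (n≤2^n ℓ)) (≤-reflexive (sym (^-distribˡ-+-* 2 ℓ a)))

      -- There are at most 2^k₀ primes, which is 2^L divided by 2^(2s + 1), and each costs 2^s m up
      -- to a factor that depends on P only. The second 2^s absorbs this factor together with ℓ.
      cost₁-small : length ps * cost₁ * (4 * ℓ) ≤ m * m
      cost₁-small = begin
        length ps * cost₁ * (4 * ℓ)                                                  ≤⟨ *-monoˡ-≤ (4 * ℓ) (*-mono-≤ length-ps (*-monoˡ-≤ (2 * 2 ^ s * (2 * (2 ^ P * m))) t<2ᴾ)) ⟩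
        2 ^ k₀ * (2 ^ P * (2 * 2 ^ s * (2 * (2 ^ P * m)))) * (4 * ℓ)                ≡⟨ lem (2 ^ k₀) (2 ^ P) (2 ^ s) m ℓ ⟩
        2 ^ k₀ * (2 ^ s * (ℓ * (2 ^ P * 2 ^ P * 2 ^ 3) * 2)) * m                     ≡⟨ cong (λ z → 2 ^ k₀ * (2 ^ s * (ℓ * z * 2)) * m) (trans (cong (_* 2 ^ 3) (sym (^-distribˡ-+-* 2 P P))) (sym (^-distribˡ-+-* 2 (P + P) 3))) ⟩
        2 ^ k₀ * (2 ^ s * (ℓ * 2 ^ (P + P + 3) * 2)) * m                             ≤⟨ *-monoˡ-≤ m (*-monoʳ-≤ (2 ^ k₀) (*-monoʳ-≤ (2 ^ s) (*-monoˡ-≤ 2 (≤-trans (ℓ2^≤ {P + P + 3}) (^-monoʳ-≤ 2 exponent))))) ⟩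
        2 ^ k₀ * (2 ^ s * (2 ^ s * 2)) * m                                           ≡⟨ cong (_* m) 2^L≡ ⟨
        2 ^ L * m                                                                    ≤⟨ *-monoˡ-≤ m 2^L≤m ⟩
        m * m                                                                        ∎
        where
        open ≤-Reasoning
        lem : ∀ u p s m l → u * (p * (2 * s * (2 * (p * m)))) * (4 * l) ≡ u * (s * (l * (p * p * 8) * 2)) * m
        lem = solve-∀
        exponent : ℓ + (P + P + 3) ≤ s
        exponent = ≤-trans (≤-trans (m≤m+n (ℓ + (P + P + 3)) 2) (≤-reflexive (lem′ ℓ P))) ℓ+2P+5≤s
          where
          lem′ : ∀ l P → l + (P + P + 3) + 2 ≡ l + P + P + 5
          lem′ = solve-∀

      cost₀-small : cost₀ * (4 * ℓ) ≤ m * m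
      cost₀-small = begin
        cost₀ * (4 * ℓ)                                  ≤⟨ *-monoˡ-≤ (4 * ℓ) (*-monoˡ-≤ (1 * 2 ^ (suc h + s)) t<2ᴾ) ⟩
        2 ^ P * (1 * 2 ^ (suc h + s)) * (4 * ℓ)          ≡⟨ lem (2 ^ P) (2 ^ (suc h + s)) ℓ ⟩
        ℓ * (2 ^ P * 2 ^ (suc h + s) * 2 ^ 2)            ≡⟨ cong (ℓ *_) (trans (cong (_* 2 ^ 2) (sym (^-distribˡ-+-* 2 P (suc h + s)))) (sym (^-distribˡ-+-* 2 (P + (suc h + s)) 2))) ⟩
        ℓ * 2 ^ (P + (suc h + s) + 2)                    ≤⟨ ℓ2^≤ {P + (suc h + s) + 2} ⟩
        2 ^ (ℓ + (P + (suc h + s) + 2))                  ≤⟨ ^-monoʳ-≤ 2 exponent ⟩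
        2 ^ (L + L)                                      ≡⟨ ^-distribˡ-+-* 2 L L ⟩
        2 ^ L * 2 ^ L                                    ≤⟨ *-mono-≤ 2^L≤m 2^L≤m ⟩
        m * m                                            ∎
        where
        open ≤-Reasoning
        lem : ∀ p x l → p * (1 * x) * (4 * l) ≡ l * (p * x * 4)
        lem = solve-∀
        exponent : ℓ + (P + (suc h + s) + 2) ≤ L + L
        exponent = begin
          ℓ + (P + (suc h + s) + 2)           ≡⟨ lem′ ℓ P L s ⟩
          L + ((ℓ + P + P + 5) + (s + s))     ≤⟨ +-monoʳ-≤ L (+-monoˡ-≤ (s + s) (≤-trans ℓ+2P+5≤s (m≤m+n s s))) ⟩
          L + (s + s + (s + s))               ≤⟨ +-monoʳ-≤ L 4s≤L ⟩
          L + L                               ∎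
          where
          lem′ : ∀ l P L s → l + (P + (suc (L + (s + P + 2)) + s) + 2) ≡ L + ((l + P + P + 5) + (s + s))
          lem′ = solve-∀

      halved : ∀ {a b z} → a * z ≤ b → ∀ {a′} → a′ * z ≤ b → (a + a′) * z ≤ 2 * b
      halved {a} {b} {z} h {a′} h′ = ≤-trans (≤-reflexive (*-distribʳ-+ z a a′)) (≤-trans (+-mono-≤ h h′) (≤-reflexive (cong (b +_) (sym (+-identityʳ b)))))

    sum-F : sum F * (2 * ℓ) ≤ m * m
    sum-F = *-cancelˡ-≤ 2 (≤-trans (≤-reflexive (lem (sum F) ℓ)) (≤-trans (*-monoˡ-≤ (4 * ℓ) (proj₂ (proj₂ (proj₂ (proj₂ (proj₂ completed))))))
      (halved {length ps * cost₁} {m * m} {4 * ℓ} cost₁-small {cost₀} cost₀-small)))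
      where
      lem : ∀ f l → 2 * (f * (2 * l)) ≡ f * (4 * l)
      lem = solve-∀

    linear-part : (e + toggleBase c g + 19 * c * g) * (2 * ℓ) ≤ m * m
    linear-part = begin
        (e + toggleBase c g + 19 * c * g) * (2 * ℓ)                        ≤⟨ *-monoˡ-≤ (2 * ℓ) (+-mono-≤ (+-mono-≤ (<⇒≤ e<4m)
                                                                                (≤-trans (m≤n+m (toggleBase c g) (6 * c)) (≤-trans (toggleBase-≤ c g) (*-monoˡ-≤ (2 ^ g) (*-monoʳ-≤ 6 c≤30m)))))
                                                                                (*-monoˡ-≤ g (*-monoʳ-≤ 19 c≤30m))) ⟩
        (4 * m + 6 * (30 * m) * 2 ^ g + 19 * (30 * m) * g) * (2 * ℓ)       ≡⟨ lem m (2 ^ g) g ℓ ⟩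
        2 * ℓ * (4 + 180 * 2 ^ g + 570 * g) * m                            ≤⟨ *-monoˡ-≤ m (≤-trans lin≤s s≤m) ⟩
        m * m                                                              ∎
      where
      open ≤-Reasoning
      lem : ∀ m x g l → (4 * m + 6 * (30 * m) * x + 19 * (30 * m) * g) * (2 * l) ≡ 2 * l * (4 + 180 * x + 570 * g) * m
      lem = solve-∀

    base-sum : ℕ
    base-sum = e + toggleBase c g + (sum A + sum F)

    base-sum-≤ : (base-sum + 19 * c * g) * ℓ ≤ sum (interval m w) * ℓ + m * m
    base-sum-≤ = *-cancelˡ-≤ 2 (begin
        2 * ((base-sum + 19 * c * g) * ℓ)                                        ≡⟨ lem e (toggleBase c g) (sum A) (sum F) (19 * c * g) ℓ ⟩
        2 * (sum A * ℓ) + (e + toggleBase c g + 19 * c * g + sum F) * (2 * ℓ)    ≤⟨ +-mono-≤ (*-monoʳ-≤ 2 (*-monoˡ-≤ ℓ sum-A)) (halved {e + toggleBase c g + 19 * c * g} {m * m} {2 * ℓ} linear-part {sum F} sum-F) ⟩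
        2 * (sum (interval m w) * ℓ) + 2 * (m * m)                               ≡⟨ *-distribˡ-+ 2 (sum (interval m w) * ℓ) (m * m) ⟨
        2 * (sum (interval m w) * ℓ + m * m)                                     ∎)
      where
      open ≤-Reasoning
      lem : ∀ e b a f x l → 2 * ((e + b + (a + f) + x) * l) ≡ 2 * (a * l) + (e + b + x + f) * (2 * l)
      lem = solve-∀

    19c⊥g : Coprime (19 * c) g
    19c⊥g = Coprimality.sym (coprime-*ʳ (prime-coprime g-prime (small∤ (s≤s z≤n) (≤-trans (m≤m+n 20 26) 45<g)))
      (coprime-*ʳ (prime-coprime g-prime (small∤ (s≤s z≤n) (≤-trans (m≤m+n 16 30) 45<g))) (coprime-^ʳ (suc L) g⊥2)))

    module _ (m′ N : ℕ) (4m≤gm′ : 4 * m ≤ g * m′) (supply : EventuallyPartitionable α m′ N) where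

      module _ (n : ℕ) (n-big : sum (interval m w) * ℓ + m * m + g * N * ℓ ≤ n * ℓ) where

        private
          room : base-sum + 19 * c * g + g * N ≤ n
          room = *-cancelʳ-≤ (base-sum + 19 * c * g + g * N) n ℓ {{>-nonZero 1≤ℓ}}
            (≤-trans (≤-reflexive (*-distribʳ-+ ℓ (base-sum + 19 * c * g) (g * N))) (≤-trans (+-monoˡ-≤ (g * N * ℓ) base-sum-≤) n-big))

          E₀≤n : base-sum ≤ n
          E₀≤n = ≤-trans (≤-trans (m≤m+n base-sum (19 * c * g)) (m≤m+n _ (g * N))) room

          -- The toggles realise 19 c x for every x < 2^g, and g ≤ 2^g, so x can be chosen to make
          -- the rest of n a multiple g y. The lower bound on n then leaves y ≥ N, and the supplied
          -- partition of y takes that rest.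
          residue = congruence {19 * c} {g} 1≤g 19c⊥g (n ∸ base-sum)
          x = proj₁ residue
          x<g = proj₁ (proj₂ residue)

          19cx≤ : 19 * c * x ≤ 19 * c * g
          19cx≤ = *-monoʳ-≤ (19 * c) (<⇒≤ x<g)

          room′ : 19 * c * g + g * N ≤ n ∸ base-sum
          room′ = m+n≤o⇒m≤o∸n (19 * c * g + g * N) (≤-trans (≤-reflexive (lem (19 * c * g) (g * N) base-sum)) room)
            where
            lem : ∀ x y b → x + y + b ≡ b + x + y
            lem = solve-∀

          quo = proj₂ (proj₂ residue) (≤-trans 19cx≤ (≤-trans (m≤m+n _ (g * N)) room′))
          y = proj₁ quo

          n≡ : n ≡ g * y + (e + (toggleBase c g + 19 * c * x + (sum A + sum F)))
          n≡ = trans (sym (m+[n∸m]≡n E₀≤n)) (trans (cong (base-sum +_) (proj₂ quo)) (lem e (toggleBase c g) (sum A + sum F) (19 * c * x) y g))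
            where
            lem : ∀ e b s x y g → e + b + s + (x + y * g) ≡ g * y + (e + (b + x + s))
            lem = solve-∀

          N≤y : N ≤ y
          N≤y = *-cancelˡ-≤ g {{>-nonZero 1≤g}} (+-cancelˡ-≤ (19 * c * g) (g * N) (g * y) (≤-trans room′
            (≤-trans (≤-reflexive (proj₂ quo)) (+-mono-≤ 19cx≤ (≤-reflexive (*-comm y g))))))

          S = proj₁ (supply y N≤y)
          S-large = proj₂ (supply y N≤y)

          toggled = toggles c 1≤c g x (<-≤-trans x<g (n≤2^n g))
          T = proj₁ toggled
          R-T = proj₁ (proj₂ toggled)
          sum-T = proj₁ (proj₂ (proj₂ toggled))
          T-unique = proj₁ (proj₂ (proj₂ (proj₂ toggled)))
          T-shape = proj₁ (proj₂ (proj₂ (proj₂ (proj₂ toggled))))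
          T-∣ = proj₂ (proj₂ (proj₂ (proj₂ (proj₂ toggled))))

          rest list : List ℕ
          rest = T ++ (A ++ F)
          list = map (g *_) (parts S) ++ (e ∷ rest)

          m′≤ : ∀ {a} → a ∈ parts S → 4 * m ≤ g * a
          m′≤ a∈ = ≤-trans 4m≤gm′ (*-monoʳ-≤ g (All.lookup S-large a∈))

          m≤4m : m ≤ 4 * m
          m≤4m = m≤n*m m 4

          list-large : All (m ≤_) list
          list-large = All.++⁺ (All.map⁺ (All.tabulate (λ a∈ → ≤-trans m≤4m (m′≤ a∈))))
            (m≤e ∷ All.++⁺ (All.map (λ sh → ≤-trans m≤c (ToggleShape⇒≤ {c} sh)) T-shape)
              (All.++⁺ (All.map (λ (_ , l) → ≤-trans (m≤m+n m η) l) A-spec) F-large))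

          g-free : ∀ {v} → v ∈ rest → Coprime g v
          g-free v∈ = case (∈.∈-++⁻ T v∈)
            where
            g⊥30c : Coprime g (30 * (c * 2 ^ g))
            g⊥30c = coprime-*ʳ (prime-coprime g-prime (small∤ (s≤s z≤n) (≤-trans (m≤m+n 31 15) 45<g)))
              (coprime-*ʳ (coprime-*ʳ (prime-coprime g-prime (small∤ (s≤s z≤n) (≤-trans (m≤m+n 16 30) 45<g))) (coprime-^ʳ (suc L) g⊥2)) (coprime-^ʳ g g⊥2))
            case′ : ∀ {v} → v ∈ A ⊎ v ∈ F → Coprime g v
            case′ (inj₁ v∈A) = coprime-∣ g⊥M ∣-refl (proj₁ (All.lookup A-spec v∈A))
            case′ (inj₂ v∈F) = Shape-coprime-g (All.lookup F-shape v∈F)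
            case : ∀ {v} → v ∈ T ⊎ v ∈ A ++ F → Coprime g v
            case (inj₁ v∈T) = coprime-∣ g⊥30c ∣-refl (All.lookup T-∣ v∈T)
            case (inj₂ v∈′) = case′ (∈.∈-++⁻ A v∈′)

          not-multiple : ∀ {v} → v ∈ rest → ¬ g ∣ v
          not-multiple v∈ g∣v = <⇒≢ (≤-trans (s≤s (s≤s z≤n)) 45<g) (sym (g-free v∈ (∣-refl , g∣v)))

          rest-unique : Unique rest
          rest-unique = Unique.++⁺ T-unique (Unique.++⁺ A-unique F-unique
              (λ (v∈A , v∈F) → M-2-power (proj₁ (All.lookup A-spec v∈A)) (Shape-2-power (All.lookup F-shape v∈F))))
            λ (v∈T , v∈′) → T-apart (All.lookup T-shape v∈T) (∈.∈-++⁻ A v∈′)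
            where
            T-apart : ∀ {v} → ToggleShape c v → v ∈ A ⊎ v ∈ F → ⊥
            T-apart sh (inj₁ v∈A) = M-2-power (proj₁ (All.lookup A-spec v∈A))
              (∣-trans (∣-trans (divides (2 ^ (L ∸ s)) (trans (cong (λ z → 2 ^ suc z) (sym (m∸n+n≡m s≤L))) (trans (cong (2 ^_) (sym (+-suc (L ∸ s) s))) (^-distribˡ-+-* 2 (L ∸ s) (suc s)))))
                (n∣m*n 15)) (ToggleShape⇒∣ {c} sh))
            T-apart sh (inj₂ v∈F) = 15∤Shape (All.lookup F-shape v∈F) (∣-trans (m∣m*n (2 ^ suc L)) (ToggleShape⇒∣ {c} sh))

          list-unique : Unique list
          list-unique = Unique.++⁺ (Unique.map⁺ (λ {a} {b} → *-cancelˡ-≡ a b g {{>-nonZero 1≤g}}) (distinct S))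
            (All.tabulate (λ { v∈ refl → not-multiple v∈ (∣-trans (m∣m*n i) (m∣m*n (2 ^ He))) }) ∷ rest-unique)
            λ (v∈S , v∈) → apart (∈.∈-map⁻ (g *_) v∈S) v∈
            where
            apart : ∀ {v} → (∃ λ a → a ∈ parts S × v ≡ g * a) → v ∈ e ∷ rest → ⊥
            apart (a , a∈ , v≡) (here v≡e) = <⇒≢ (<-≤-trans e<4m (m′≤ a∈)) (trans (sym v≡e) v≡)
            apart (a , a∈ , refl) (there v∈) = not-multiple v∈ (m∣m*n a)

          sum-list : sum list ≡ n
          sum-list = trans (ListAction.sum-++ (map (g *_) (parts S)) (e ∷ rest))
            (trans (cong₂ _+_ (trans (sum-map-* g (parts S)) (cong (g *_) (sum≡n S)))
              (cong (e +_) (trans (ListAction.sum-++ T (A ++ F)) (cong₂ _+_ sum-T (ListAction.sum-++ A F))))) (sym n≡))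

          list-positive : All NonZero list
          list-positive = All.map (λ m≤v → >-nonZero (≤-trans 1≤m m≤v)) list-large

          R-list : R list ≡ α
          R-list = trans (∑-++ inv (map (g *_) (parts S)) (e ∷ rest))
            (trans (cong₂ _+ℚ_ (trans (R-map-* 1≤g (All.map (λ {a} nz → >-nonZero⁻¹ a {{nz}}) (positive-parts S)))
                (cong (inv g *ℚ_) (trans (sym (reciprocalSum≡R (positive-parts S))) (reciprocals≡α S))))
              (cong (inv e +ℚ_) (trans (∑-++ inv T (A ++ F)) (cong₂ _+ℚ_ R-T (trans (∑-++ inv A F) (cong (R A +ℚ_) R-F))))))
            (solve 5 (λ a b t r α → a :+ (b :+ (t :+ (r :+ (α :- (a :+ b :+ t :+ r))))) := α) refl (inv g *ℚ α) (inv e) (toggleSum c g) (R A) α))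
            where open +-*-Solver

        partition : ∃ λ (p : Partition α n) → m -Large p
        partition = record
          { parts = list ; distinct = list-unique ; positive-parts = list-positive ; sum≡n = sum-list
          ; reciprocals≡α = trans (reciprocalSum≡R list-positive) R-list } , list-large

-- The recurrence for the threshold, and its upper and lower bounds.

module Bounds where

  open import Data.Nat.Base
  open import Data.Nat.Induction using (<-rec)
  open Rationals
  open Sums
  open Primes
  open BinaryExpansions
  open Sieving
  open Moduli
  open Constructions
  open Exponential

  R-≥-length : ∀ {b as} → All (λ a → 1 ≤ a × a ≤ b) as → ι (length as) *ℚ inv b ≤ℚ R as
  R-≥-length {b} []                     = ℚ.≤-reflexive (trans (cong (_*ℚ inv b) ι-0) (ℚ.*-zeroˡ (inv b)))
  R-≥-length {b} {a ∷ as} ((1≤a , a≤b) ∷ hs) = ℚ.≤-trans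
    (ℚ.≤-reflexive (trans (cong (_*ℚ inv b) (ι-+ 1 (length as))) (trans (ℚ.*-distribʳ-+ (inv b) (ι 1) (ι (length as))) (cong (_+ℚ ι (length as) *ℚ inv b) (ι1* (inv b))))))
    (ℚ.+-mono-≤ (inv-anti 1≤a a≤b) (R-≥-length hs))

  -- Each doubling of the upper end y adds y numbers below 2 y, hence at least 1 / 2. This gives an
  -- explicit exponent K, with all intervals in use ending below 2^K m.
  harmonic-unbounded : ∀ m → 1 ≤ m → ∀ j → ∃ λ b → m + b ≡ 2 ^ j * m × ι j *ℚ inv 2 ≤ℚ harmonic m b
  harmonic-unbounded m 1≤m zero    = 0 , refl , ℚ.≤-reflexive (trans (cong (_*ℚ inv 2) ι-0) (ℚ.*-zeroˡ (inv 2)))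
  harmonic-unbounded m 1≤m (suc j) =
    let b , eq , h = harmonic-unbounded m 1≤m j
        y = m + b
        1≤y = ≤-trans 1≤m (m≤m+n m b)
    in b + y , trans (sym (+-assoc m b y)) (trans (cong (λ z → z + z) eq) (double (2 ^ j) m))
     , ℚ.≤-trans (ℚ.≤-reflexive (trans (cong (_*ℚ inv 2) (ι-+ 1 j)) (trans (ℚ.*-distribʳ-+ (inv 2) (ι 1) (ι j)) (cong (_+ℚ ι j *ℚ inv 2) (ι1* (inv 2))))))
       (ℚ.≤-trans (ℚ.+-mono-≤ (half y 1≤y) h) (ℚ.≤-reflexive (sym (trans (cong R (interval-++ m b y)) (∑-++ inv (interval y y) (interval m b))))))
    where
    double : ∀ x m → x * m + x * m ≡ 2 * x * m
    double = solve-∀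
    half : ∀ y → 1 ≤ y → inv 2 ≤ℚ R (interval y y)
    half y 1≤y = ℚ.≤-trans (ℚ.≤-trans (ℚ.≤-reflexive (sym (ι1* (inv 2))))
        (ℚ.≤-trans (frac-≤ 1 2 y (2 * y) (s≤s z≤n) (*-mono-≤ (s≤s {n = 1} z≤n) 1≤y) (≤-reflexive (trans (*-identityˡ (2 * y)) (*-comm 2 y))))
          (ℚ.≤-reflexive (cong (λ z → ι z *ℚ inv (2 * y)) (sym (length-interval y y))))))
      (R-≥-length (All.map (λ (l , u) → ≤-trans 1≤y l , ≤-trans (<⇒≤ u) (≤-reflexive (cong (y +_) (sym (+-identityʳ y))))) (interval-bounds y y)))

  crossing : ∀ m q → 0ℚ <ℚ q → ∀ b → q ≤ℚ harmonic m b → ∃ λ w → w < b × harmonic m w ≤ℚ q × q ≤ℚ harmonic m (suc w)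
  crossing m q 0<q zero    h = ⊥-elim (ℚ.<-irrefl refl (ℚ.<-≤-trans 0<q h))
  crossing m q 0<q (suc b) h = go (ℚ.≤-total q (harmonic m b))
    where
    go : q ≤ℚ harmonic m b ⊎ harmonic m b ≤ℚ q → ∃ λ w → w < suc b × harmonic m w ≤ℚ q × q ≤ℚ harmonic m (suc w)
    go (inj₁ q≤) = let w , w<b , r = crossing m q 0<q b q≤ in w , m<n⇒m<1+n w<b , r
    go (inj₂ ≤q) = b , n<1+n b , ≤q , h

  log₂-between : ∀ m → 1 ≤ m → ∃ λ L → 2 ^ L ≤ m × m < 2 ^ suc L
  log₂-between (suc m) _ = power-between (s≤s (s≤s z≤n)) m

  components : ∀ {a b c d e f g s} → a + (b + (c + (d + (e + (f + g))))) ≤ s →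
               a ≤ s × b ≤ s × c ≤ s × d ≤ s × e ≤ s × f ≤ s × g ≤ s
  components {a} {b} {c} {d} {e} {f} h₀ =
    let h₁ = m+n≤o⇒n≤o a h₀ ; h₂ = m+n≤o⇒n≤o b h₁ ; h₃ = m+n≤o⇒n≤o c h₂ ; h₄ = m+n≤o⇒n≤o d h₃ ; h₅ = m+n≤o⇒n≤o e h₄
    in m+n≤o⇒m≤o a h₀ , m+n≤o⇒m≤o b h₁ , m+n≤o⇒m≤o c h₂ , m+n≤o⇒m≤o d h₃ , m+n≤o⇒m≤o e h₄ , m+n≤o⇒m≤o f h₅ , m+n≤o⇒n≤o f h₅

  quotient-between : ∀ L D → 1 ≤ D → ∃ λ s → D * s ≤ L × L < D * suc s × (∀ {Z} → D * Z ≤ L → Z ≤ s)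
  quotient-between L D 1≤D = L / D , ≤-trans (≤-reflexive (*-comm D (L / D))) (m/n*n≤m L D)
    , <-≤-trans (subst (_< D + L / D * D) (sym (m≡m%n+[m/n]*n L D)) (+-monoˡ-< (L / D * D) (m%n<n L D))) (≤-reflexive (*-comm (suc (L / D)) D))
    , λ {Z} h → ≤-trans (≤-reflexive (sym (m*n/n≡m Z D))) (/-monoˡ-≤ D (≤-trans (≤-reflexive (*-comm Z D)) h))
    where
    instance
      _ = >-nonZero 1≤D

  α+1≤half : ∀ {α a₀ b₀} → 1 ≤ b₀ → α is a₀ ÷ b₀ → α +ℚ 1ℚ ≤ℚ ι (2 + 2 * a₀) *ℚ inv 2
  α+1≤half {α} {a₀} {b₀} 1≤b₀ α≡ = ℚ.≤-trans (ℚ.+-monoˡ-≤ 1ℚ (ℚ.≤-trans (ℚ.≤-reflexive (÷⇒≡ 1≤b₀ α≡))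
      (frac-≤ a₀ b₀ (2 * a₀) 2 1≤b₀ (s≤s z≤n) (≤-trans (≤-reflexive (*-comm a₀ 2)) (m≤m*n (2 * a₀) b₀ {{>-nonZero 1≤b₀}})))))
    (ℚ.≤-reflexive (trans (ℚ.+-comm (ι (2 * a₀) *ℚ inv 2) 1ℚ) (trans (cong (_+ℚ ι (2 * a₀) *ℚ inv 2) (sym (ι-inv {2} (s≤s z≤n))))
      (trans (sym (ℚ.*-distribʳ-+ (inv 2) (ι 2) (ι (2 * a₀)))) (cong (_*ℚ inv 2) (sym (ι-+ 2 (2 * a₀))))))))

  module Asymptotics (α : ℚ) (a₀ b₀ : ℕ) (1≤a₀ : 1 ≤ a₀) (1≤b₀ : 1 ≤ b₀) (α≡ : α is a₀ ÷ b₀)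
                     (K : ℕ) (α+1≤ : α +ℚ 1ℚ ≤ℚ ι K *ℚ inv 2) where

    0<α : 0ℚ <ℚ α
    0<α = subst (0ℚ <ℚ_) (sym (÷⇒≡ 1≤b₀ α≡)) (0<*ℚ (0<ι 1≤a₀) (inv>0 1≤b₀))

    invℓ≤1 : ∀ {ℓ} → 1 ≤ ℓ → inv ℓ ≤ℚ 1ℚ
    invℓ≤1 {ℓ} 1≤ℓ = subst (inv ℓ ≤ℚ_) inv-1 (inv-anti (s≤s z≤n) 1≤ℓ)

    cross : ∀ m → 1 ≤ m → ∀ q → 0ℚ <ℚ q → q ≤ℚ α +ℚ 1ℚ →
            ∃ λ w → m + suc w ≤ 2 ^ K * m × harmonic m w ≤ℚ q × q ≤ℚ harmonic m (suc w)
    cross m 1≤m q 0<q q≤ =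
      let b , eq , h = harmonic-unbounded m 1≤m K
          w , w<b , lo , hi = crossing m q 0<q b (ℚ.≤-trans q≤ (ℚ.≤-trans α+1≤ h))
      in w , ≤-trans (+-monoʳ-≤ m w<b) (≤-reflexive eq) , lo , hi

    GoodPrime : ℕ → ℕ → Set
    GoodPrime ℓ g = Prime g × 45 < g × a₀ < g × b₀ < g × 16 * (ℓ * 2 ^ K) ≤ g

    -- The condition on n is n ≥ Σ + m² / ℓ + g N, multiplied by ℓ.
    Constructible : ℕ → ℕ → ℕ → Set
    Constructible ℓ g m = ∀ w → m + w ≤ 2 ^ K * m → α +ℚ inv ℓ ≤ℚ harmonic m w →
      ∀ m′ N → 4 * m ≤ g * m′ → EventuallyPartitionable α m′ N →
      ∀ n → sum (interval m w) * ℓ + m * m + g * N * ℓ ≤ n * ℓ → ∃ λ (p : Partition α n) → m -Large p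

    construction : ∀ ℓ g → 1 ≤ ℓ → GoodPrime ℓ g → ∃ λ M₀ → ∀ m → M₀ ≤ m → Constructible ℓ g m
    construction ℓ g 1≤ℓ (g-prime , 45<g , a₀<g , b₀<g , g-big) = with-primes (smallPrimes-many g G (m≤m+n g _) (4 * D))
      where
      D = constantD ℓ K
      G = g + (b₀ * (g + g) + 16 * (ℓ * 2 ^ K))
      with-primes : (∃ λ k → G ≤ k × 4 * D ≤ length (smallPrimes g k)) → ∃ λ M₀ → ∀ m → M₀ ≤ m → Constructible ℓ g m
      with-primes (k , G≤k , many) = 2 ^ (D * Z) , λ m M₀≤m → with-log m M₀≤m (log₂-between m (≤-trans (m^n>0 2 (D * Z)) M₀≤m))
        where
        P = 3 + k
        -- All lower bounds required of s, added up. Since s is the quotient of L by D, they all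
        -- hold as soon as m ≥ 2^(D Z).
        Z = 4 * P + 3 + (P * P * P + (64 * ℓ + (16 * b₀ + (ℓ + P + P + 5 + (2 * ℓ * (4 + 180 * 2 ^ g + 570 * g) + g * g)))))
        with-log : ∀ m → 2 ^ (D * Z) ≤ m → (∃ λ L → 2 ^ L ≤ m × m < 2 ^ suc L) → Constructible ℓ g m
        with-log m M₀≤m (L , 2^L≤m , m<2^L+1) = with-quotient (quotient-between L D (s≤s z≤n))
          where
          DZ≤L : D * Z ≤ L
          DZ≤L = ≤-pred (≰⇒> λ h → <⇒≱ m<2^L+1 (≤-trans (^-monoʳ-≤ 2 h) M₀≤m))
          with-quotient : (∃ λ s → D * s ≤ L × L < D * suc s × (∀ {Z} → D * Z ≤ L → Z ≤ s)) → Constructible ℓ g m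
          with-quotient (s , Ds≤L , L<Ds , largest) with-w X≤ enough m′ N 4m≤ supply n n-big =
            let z₁ , z₂ , z₃ , z₄ , z₅ , z₆ , z₇ = components {4 * P + 3} {P * P * P} {64 * ℓ} {16 * b₀} {ℓ + P + P + 5}
                                                     {2 * ℓ * (4 + 180 * 2 ^ g + 570 * g)} {g * g} (largest DZ≤L)
            in Construction.partition g g-prime ℓ K k L s m 45<g
                 (≤-trans (m≤m+n g _) G≤k) 1≤ℓ many Ds≤L L<Ds z₁ z₂ 2^L≤m m<2^L+1 α a₀ b₀ 1≤a₀ 1≤b₀ α≡ a₀<g b₀<g
                 (≤-trans (≤-trans (m≤m+n (b₀ * (g + g)) _) (m≤n+m _ g)) (≤-trans G≤k (m≤n+m k 3)))
                 g-big
                 (≤-trans (≤-trans (m≤n+m (16 * (ℓ * 2 ^ K)) (b₀ * (g + g))) (m≤n+m _ g)) (≤-trans G≤k (m≤n+m k 2)))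
                 z₃ z₄ z₅ z₆ z₇ with-w X≤ enough m′ N 4m≤ supply n n-big

    module Thresholds (n : ℕ → ℕ) (threshold : ∀ m → 1 ≤ m → IsThreshold α m (n m)) where

      Recurrence : ℕ → ℕ → ℕ → Set
      Recurrence ℓ g M₀ = ∀ m → 1 ≤ m → M₀ ≤ m → ∀ m′ → 1 ≤ m′ → 4 * m ≤ g * m′ →
        ∃ λ w → m + suc w ≤ 2 ^ K * m × harmonic m w ≤ℚ α +ℚ inv ℓ ×
        n m * ℓ ≤ sum (interval m (suc w)) * ℓ + (m * m + ℓ) + g * n m′ * ℓ

      recurrence : ∀ ℓ g → 1 ≤ ℓ → GoodPrime ℓ g → ∃ λ M₀ → Recurrence ℓ g M₀
      recurrence ℓ g 1≤ℓ good = proj₁ built , λ m 1≤m M₀≤m m′ 1≤m′ 4m≤ →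
        let w , X≤ , lo , hi = cross m 1≤m (α +ℚ inv ℓ) (ℚ.<-≤-trans 0<α (≤-by (inv ℓ) (0≤inv ℓ) refl)) (ℚ.+-monoʳ-≤ α (invℓ≤1 1≤ℓ))
            Σ = sum (interval m (suc w))
            r = suc (m * m / ℓ)
            N = n m′
            bound = Σ + r + g * N
        in w , X≤ , lo
         , ≤-trans (*-monoˡ-≤ ℓ (IsThreshold.least (threshold m 1≤m) bound (≤-trans (s≤s z≤n) (≤-trans (m≤n+m r Σ) (m≤m+n (Σ + r) (g * N))))
             (λ n′ b≤ → proj₂ built m M₀≤m (suc w) X≤ hi m′ N 4m≤ (IsThreshold.eventually (threshold m′ 1≤m′)) n′
                (≤-trans (+-monoˡ-≤ (g * N * ℓ) (+-monoʳ-≤ (Σ * ℓ) (≤r {m * m})))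
                  (≤-trans (≤-reflexive (sym (distribute Σ r (g * N) ℓ))) (*-monoˡ-≤ ℓ b≤))))))
           (≤-trans (≤-reflexive (distribute Σ r (g * N) ℓ)) (+-monoˡ-≤ (g * N * ℓ) (+-monoʳ-≤ (Σ * ℓ) (r≤ {m * m}))))
        where
        built = construction ℓ g 1≤ℓ good
        instance
          _ = >-nonZero 1≤ℓ
        distribute : ∀ a b c l → (a + b + c) * l ≡ a * l + b * l + c * l
        distribute = solve-∀
        ≤r : ∀ {x} → x ≤ suc (x / ℓ) * ℓ
        ≤r {x} = ≤-trans (≤-reflexive (m≡m%n+[m/n]*n x ℓ)) (+-monoˡ-≤ (x / ℓ * ℓ) (<⇒≤ (m%n<n x ℓ)))
        r≤ : ∀ {x} → suc (x / ℓ) * ℓ ≤ x + ℓ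
        r≤ {x} = ≤-trans (+-monoʳ-≤ ℓ (m/n*n≤m x ℓ)) (≤-reflexive (+-comm ℓ x))

      -- The choice of m′. Rounding up keeps g m′ at 4 m or more, as the separation from `e`
      -- demands; for g ≤ m it adds at most another m.
      next : ℕ → (g : ℕ) → .{{NonZero g}} → ℕ
      next m g = suc (4 * m / g)

      next-≥ : ∀ m g .{{_ : NonZero g}} → 4 * m ≤ g * next m g
      next-≥ m g = ≤-trans (≤-reflexive (m≡m%n+[m/n]*n (4 * m) g)) (≤-trans (+-monoˡ-≤ (4 * m / g * g) (<⇒≤ (m%n<n (4 * m) g))) (≤-reflexive (*-comm (next m g) g)))

      next-≤ : ∀ m g .{{_ : NonZero g}} → g ≤ m → g * next m g ≤ 5 * m
      next-≤ m g g≤m = ≤-trans (≤-reflexive (*-comm g (next m g))) (+-mono-≤ g≤m (m/n*n≤m (4 * m) g))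

      next-square : ∀ m g .{{_ : NonZero g}} → g ≤ m → g * (g * (next m g * next m g)) ≤ 25 * (m * m)
      next-square m g g≤m = ≤-trans (≤-reflexive (lem₁ g (next m g))) (≤-trans (*-mono-≤ (next-≤ m g g≤m) (next-≤ m g g≤m)) (≤-reflexive (lem₂ m)))
        where
        lem₁ : ∀ g x → g * (g * (x * x)) ≡ g * x * (g * x)
        lem₁ = solve-∀
        lem₂ : ∀ m → 5 * m * (5 * m) ≡ 25 * (m * m)
        lem₂ = solve-∀

      twice-sum-≤ : ∀ m k → 2 * sum (interval m k) + m * m ≤ (m + k) * (m + k)
      twice-sum-≤ m k = ≤-trans (m≤m+n _ k) (≤-reflexive (+-cancelʳ-≡ m _ _ (sum-interval m k)))

      good-prime : ∀ ℓ B → ∃ λ g → GoodPrime ℓ g × B ≤ g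
      good-prime ℓ B =
        let g , pg , big = prime-above (45 + (a₀ + (b₀ + (16 * (ℓ * 2 ^ K) + B))))
            ≤₁ = m+n≤o⇒n≤o 45 (<⇒≤ big)
            ≤₂ = m+n≤o⇒n≤o a₀ ≤₁
            ≤₃ = m+n≤o⇒n≤o b₀ ≤₂
        in g , (pg , ≤-trans (s≤s (m≤m+n 45 _)) big
             , ≤-trans (s≤s (≤-trans (m≤m+n a₀ _) (m≤n+m _ 45))) big
             , ≤-trans (s≤s (≤-trans (≤-trans (m≤m+n b₀ _) (m≤n+m _ a₀)) (m≤n+m _ 45))) big
             , m+n≤o⇒m≤o (16 * (ℓ * 2 ^ K)) ≤₃) , m+n≤o⇒n≤o (16 * (ℓ * 2 ^ K)) ≤₃

      total : ℕ → ℕ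
      total zero    = 0
      total (suc M) = n M + total M

      ≤total : ∀ {m M} → m < M → n m ≤ total M
      ≤total {m} {suc M} m<1+M with m<1+n⇒m<n∨m≡n m<1+M
      ... | inj₁ m<M  = ≤-trans (≤total m<M) (m≤n+m (total M) (n M))
      ... | inj₂ refl = m≤m+n (n m) (total m)

      -- Strong induction: g n(m′) ≤ g C m′² ≤ 25 C m² / g, which is at most half of C m² once g ≥
      -- 50. The other half pays for the interval and the error terms, and `total M₁` in C takes
      -- care of the small m.
      quadratic : ∃ λ C → ∀ m → 1 ≤ m → n m ≤ C * (m * m)
      quadratic = with-prime (good-prime 1 50)
        where
        with-prime : (∃ λ g → GoodPrime 1 g × 50 ≤ g) → ∃ λ C → ∀ m → 1 ≤ m → n m ≤ C * (m * m)
        with-prime (g , good , 50≤g) = with-recurrence (recurrence 1 g (s≤s z≤n) good)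
          where
          with-recurrence : (∃ λ M₀ → Recurrence 1 g M₀) → ∃ λ C → ∀ m → 1 ≤ m → n m ≤ C * (m * m)
          with-recurrence (M₀ , rec) = C , <-rec (λ m → 1 ≤ m → n m ≤ C * (m * m)) step
            where
            instance
              g≢0 : NonZero g
              g≢0 = >-nonZero (≤-trans (s≤s z≤n) 50≤g)
            M₁ = M₀ + (g + 2)
            y = 2 ^ K
            C = total M₁ + 2 * (y * y + 2)
            step : ∀ m → (∀ {m′} → m′ < m → 1 ≤ m′ → n m′ ≤ C * (m′ * m′)) → 1 ≤ m → n m ≤ C * (m * m)
            step m ih 1≤m = go (≤-<-connex M₁ m)
              where
              open ≤-Reasoning
              instance
                _ = >-nonZero (*-mono-≤ 1≤m 1≤m)
              go : M₁ ≤ m ⊎ m < M₁ → n m ≤ C * (m * m)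
              go (inj₂ m<M₁) = ≤-trans (≤total m<M₁) (≤-trans (m≤m+n (total M₁) _) (m≤m*n C (m * m)))
              go (inj₁ M₁≤m) = *-cancelˡ-≤ 2 (begin
                  2 * n m                                          ≡⟨ cong (2 *_) (sym (*-identityʳ (n m))) ⟩
                  2 * (n m * 1)                                    ≤⟨ *-monoʳ-≤ 2 (proj₂ (proj₂ (proj₂ stepped))) ⟩
                  2 * (Σ * 1 + (m * m + 1) + g * n m′ * 1)         ≡⟨ lem₁ Σ (m * m) (g * n m′) ⟩
                  2 * Σ + 2 * (m * m + 1) + 2 * (g * n m′)         ≤⟨ +-mono-≤ (+-mono-≤ Σ≤ (*-monoʳ-≤ 2 (+-monoʳ-≤ (m * m) (*-mono-≤ 1≤m 1≤m)))) gN≤ ⟩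
                  y * y * (m * m) + 2 * (m * m + m * m) + C * (m * m)  ≡⟨ lem₂ (y * y) (m * m) C ⟩
                  (y * y + 4) * (m * m) + C * (m * m)              ≤⟨ +-monoˡ-≤ (C * (m * m)) (*-monoˡ-≤ (m * m) C-big) ⟩
                  C * (m * m) + C * (m * m)                        ≡⟨ cong (C * (m * m) +_) (sym (+-identityʳ (C * (m * m)))) ⟩
                  2 * (C * (m * m))                                ∎)
                where
                g≤m : g ≤ m
                g≤m = ≤-trans (m≤m+n g 2) (≤-trans (m≤n+m (g + 2) M₀) M₁≤m)
                m′ = next m g
                stepped = rec m 1≤m (≤-trans (m≤m+n M₀ (g + 2)) M₁≤m) m′ (s≤s z≤n) (next-≥ m g)
                w = proj₁ stepped
                Σ = sum (interval m (suc w))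
                m′<m : m′ < m
                m′<m = *-cancelˡ-< 50 m′ m (begin-strict
                  50 * m′      ≤⟨ *-monoˡ-≤ m′ 50≤g ⟩
                  g * m′       ≤⟨ next-≤ m g g≤m ⟩
                  5 * m        <⟨ *-monoˡ-< m {{>-nonZero 1≤m}} (m≤m+n 6 44) ⟩
                  50 * m       ∎)
                Σ≤ : 2 * Σ ≤ y * y * (m * m)
                Σ≤ = ≤-trans (m≤m+n (2 * Σ) (m * m)) (≤-trans (twice-sum-≤ m (suc w)) (≤-trans (*-mono-≤ (proj₁ (proj₂ stepped)) (proj₁ (proj₂ stepped))) (≤-reflexive (lem₃ y m))))
                  where
                  lem₃ : ∀ y m → y * m * (y * m) ≡ y * y * (m * m)
                  lem₃ = solve-∀
                gN≤ : 2 * (g * n m′) ≤ C * (m * m)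
                gN≤ = *-cancelˡ-≤ g (begin
                  g * (2 * (g * n m′))                        ≤⟨ *-monoʳ-≤ g (*-monoʳ-≤ 2 (*-monoʳ-≤ g (ih m′<m (s≤s z≤n)))) ⟩
                  g * (2 * (g * (C * (m′ * m′))))             ≡⟨ lem₄ g C (m′ * m′) ⟩
                  2 * C * (g * (g * (m′ * m′)))               ≤⟨ *-monoʳ-≤ (2 * C) (next-square m g g≤m) ⟩
                  2 * C * (25 * (m * m))                      ≡⟨ lem₅ C (m * m) ⟩
                  50 * (C * (m * m))                          ≤⟨ *-monoˡ-≤ (C * (m * m)) 50≤g ⟩
                  g * (C * (m * m))                           ∎)
                  where
                  lem₄ : ∀ g C x → g * (2 * (g * (C * x))) ≡ 2 * C * (g * (g * x))
                  lem₄ = solve-∀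
                  lem₅ : ∀ C x → 2 * C * (25 * x) ≡ 50 * (C * x)
                  lem₅ = solve-∀
                C-big : y * y + 4 ≤ C
                C-big = ≤-trans (≤-trans (+-monoˡ-≤ 4 (m≤n*m (y * y) 2)) (≤-reflexive (lem₆ (y * y)))) (m≤n+m _ (total M₁))
                  where
                  lem₆ : ∀ x → 2 * x + 4 ≡ 2 * (x + 2)
                  lem₆ = solve-∀
                lem₁ : ∀ a b c → 2 * (a * 1 + (b + 1) + c * 1) ≡ 2 * a + 2 * (b + 1) + 2 * c
                lem₁ = solve-∀
                lem₂ : ∀ a b c → a * b + 2 * (b + b) + c * b ≡ (a + 4) * b + c * b
                lem₂ = solve-∀

      -- With C known, a prime g above 25 C ℓ turns g n(m′) into an error of at most m² / ℓ, of the
      -- same order as that of the construction.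
      upper-bound : ∀ ℓ → 1 ≤ ℓ → ∃ λ M₀ → ∀ m → 1 ≤ m → M₀ ≤ m →
        ∃ λ w → m + suc w ≤ 2 ^ K * m × harmonic m w ≤ℚ α +ℚ inv ℓ × n m * ℓ ≤ sum (interval m (suc w)) * ℓ + 3 * (m * m)
      upper-bound ℓ 1≤ℓ = with-quadratic quadratic
        where
        Claim : Set
        Claim = ∃ λ M₀ → ∀ m → 1 ≤ m → M₀ ≤ m →
          ∃ λ w → m + suc w ≤ 2 ^ K * m × harmonic m w ≤ℚ α +ℚ inv ℓ × n m * ℓ ≤ sum (interval m (suc w)) * ℓ + 3 * (m * m)
        with-quadratic : (∃ λ C → ∀ m → 1 ≤ m → n m ≤ C * (m * m)) → Claim
        with-quadratic (C , n≤) = with-prime (good-prime ℓ (25 * (C * ℓ) + 1))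
          where
          with-prime : (∃ λ g → GoodPrime ℓ g × 25 * (C * ℓ) + 1 ≤ g) → Claim
          with-prime (g , good , big) = with-recurrence (recurrence ℓ g 1≤ℓ good)
            where
            open ≤-Reasoning
            instance
              g≢0 : NonZero g
              g≢0 = >-nonZero (≤-trans (m≤n+m 1 (25 * (C * ℓ))) big)
            lem : ∀ a b → a + (b + b) + b ≡ a + 3 * b
            lem = solve-∀
            gN≤ : ∀ m → g ≤ m → g * n (next m g) * ℓ ≤ m * m
            gN≤ m g≤m = *-cancelˡ-≤ g (begin
                g * (g * n m′ * ℓ)                       ≤⟨ *-monoʳ-≤ g (*-monoˡ-≤ ℓ (*-monoʳ-≤ g (n≤ m′ (s≤s z≤n)))) ⟩
                g * (g * (C * (m′ * m′)) * ℓ)            ≡⟨ lem₄ g C (m′ * m′) ℓ ⟩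
                C * ℓ * (g * (g * (m′ * m′)))            ≤⟨ *-monoʳ-≤ (C * ℓ) (next-square m g g≤m) ⟩
                C * ℓ * (25 * (m * m))                   ≡⟨ lem₅ (C * ℓ) (m * m) ⟩
                25 * (C * ℓ) * (m * m)                   ≤⟨ *-monoˡ-≤ (m * m) (≤-trans (m≤m+n (25 * (C * ℓ)) 1) big) ⟩
                g * (m * m)                              ∎)
              where
              m′ = next m g
              lem₄ : ∀ g C x l → g * (g * (C * x) * l) ≡ C * l * (g * (g * x))
              lem₄ = solve-∀
              lem₅ : ∀ C x → C * (25 * x) ≡ 25 * C * x
              lem₅ = solve-∀
            with-recurrence : (∃ λ M₀ → Recurrence ℓ g M₀) → Claim
            with-recurrence (M₀ , rec) = M₀ + (g + ℓ) , λ m 1≤m M₀≤m →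
              let g≤m = ≤-trans (≤-trans (m≤m+n g ℓ) (m≤n+m (g + ℓ) M₀)) M₀≤m
                  ℓ≤m = ≤-trans (≤-trans (m≤n+m ℓ g) (m≤n+m (g + ℓ) M₀)) M₀≤m
                  w , X≤ , lo , hi = rec m 1≤m (≤-trans (m≤m+n M₀ _) M₀≤m) (next m g) (s≤s z≤n) (next-≥ m g)
              in w , X≤ , lo , ≤-trans hi (≤-trans (+-mono-≤ (+-monoʳ-≤ (sum (interval m (suc w)) * ℓ) (+-monoʳ-≤ (m * m) (≤-trans ℓ≤m (m≤m*n m m {{>-nonZero 1≤m}})))) (gN≤ m g≤m))
                   (≤-reflexive (lem (sum (interval m (suc w)) * ℓ) (m * m))))

      -- The threshold itself is a number with an m-large partition, so the bound for a single
      -- partition applies, with w the last length before the reciprocals reach α.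
      lower-bound : ∀ m → 1 ≤ m → ∃ λ w → m + suc w ≤ 2 ^ K * m × α ≤ℚ harmonic m (suc w) × sum (interval m w) ≤ n m
      lower-bound m 1≤m =
        let w , X≤ , lo , hi = cross m 1≤m α 0<α (≤-by 1ℚ 0≤1ℚ refl)
            p , large = IsThreshold.eventually (threshold m 1≤m) (n m) ≤-refl
        in w , X≤ , hi , subst (sum (interval m w) ≤_) (sum≡n p) (sum-lower-bound {m} {w} 1≤m (distinct p) large
             (subst (harmonic m w ≤ℚ_) (trans (sym (reciprocals≡α p)) (reciprocalSum≡R (positive-parts p))) lo))

-- Passage to the limit and the error term as a real number.

module Limits where

  open import Data.Integer.Base using (+_)
  open import Data.Nat.Base
  open ℚ-Lemmas using (archimedes; half>0)
  open Product-Lemmas using (divide; ∣*∣≤)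
  open +-*-Solver
  open Rationals
  open Sums
  open Primes
  open BinaryExpansions
  open Exponential
  open Constructions using (ι1*)
  open Bounds

  large-natural : ∀ c δ → 0ℚ <ℚ δ → ∃ λ N → ∀ i → N ≤ i → c ≤ℚ ι i *ℚ δ
  large-natural c δ 0<δ = let N , h = archimedes c δ 0<δ in
    N , λ i N≤i → subst (λ z → c ≤ℚ z *ℚ δ) (sym (ι≡natℚ i)) (h i N≤i)

  ∣∣-≤ : ∀ {p ε} → p ≤ℚ ε → -ℚ p ≤ℚ ε → ∣ p ∣ℚ ≤ℚ ε
  ∣∣-≤ {p} {ε} h h′ = go (ℚ.∣p∣≡p∨∣p∣≡-p p)
    where
    go : ∣ p ∣ℚ ≡ p ⊎ ∣ p ∣ℚ ≡ -ℚ p → ∣ p ∣ℚ ≤ℚ ε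
    go (inj₁ eq) = subst (_≤ℚ ε) (sym eq) h
    go (inj₂ eq) = subst (_≤ℚ ε) (sym eq) h′

  module Estimate (α : ℚ) (a₀ b₀ : ℕ) (1≤a₀ : 1 ≤ a₀) (1≤b₀ : 1 ≤ b₀) (α≡ : α is a₀ ÷ b₀)
                  (K : ℕ) (α+1≤ : α +ℚ 1ℚ ≤ℚ ι K *ℚ inv 2)
                  (n : ℕ → ℕ) (threshold : ∀ m → 1 ≤ m → IsThreshold α m (n m)) where

    open Asymptotics α a₀ b₀ 1≤a₀ 1≤b₀ α≡ K α+1≤
    open Thresholds n threshold

    E : ℕ → ℚ
    E = expSum (α +ℚ α)

    0≤α = ℚ.<⇒≤ 0<α

    -- Harmonic sums replace any estimate of e: once the reciprocals from 2 to b + 1 add up to α +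
    -- 1, `expSum-harmonic-upper` with m = 1 bounds all truncations by (1 + b)².
    exp-bounded : ∃ λ c → ∀ q → 0ℚ ≤ℚ q → q ≤ℚ (α +ℚ 1ℚ) +ℚ (α +ℚ 1ℚ) → ∀ N → expSum q N ≤ℚ ι c
    exp-bounded =
      let b , _ , h = harmonic-unbounded 2 (s≤s z≤n) K
          big = ℚ.≤-trans α+1≤ h
      in (1 + b) * (1 + b) , λ q 0≤q q≤ N → ℚ.≤-trans (expSum-mono 0≤q (ℚ.≤-trans q≤ (ℚ.+-mono-≤ big big)) N)
        (ℚ.≤-trans (ℚ.≤-reflexive (sym (trans (cong (expSum (harmonic 2 b +ℚ harmonic 2 b) N *ℚ_) (trans (cong₂ _*ℚ_ ι-1 ι-1) (ℚ.*-identityˡ 1ℚ)))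
            (ℚ.*-identityʳ _))))
          (ℚ.≤-trans (expSum-harmonic-upper 1 (s≤s z≤n) b N) (ℚ.≤-reflexive (sym (ι-* (1 + b) (1 + b))))))

    upper-estimate : ∀ δ → 0ℚ <ℚ δ → ∃ λ M → ∀ m → 1 ≤ m → M ≤ m → ∃ λ N₀ → ∀ N → N₀ ≤ N →
      ι (2 * n m) +ℚ ι (m * m) ≤ℚ ι (m * m) *ℚ E N +ℚ δ *ℚ ι (m * m)
    upper-estimate δ 0<δ = with-bound exp-bounded
      where
      Claim : Set
      Claim = ∃ λ M → ∀ m → 1 ≤ m → M ≤ m → ∃ λ N₀ → ∀ N → N₀ ≤ N →
        ι (2 * n m) +ℚ ι (m * m) ≤ℚ ι (m * m) *ℚ E N +ℚ δ *ℚ ι (m * m)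
      with-bound : (∃ λ c → ∀ q → 0ℚ ≤ℚ q → q ≤ℚ (α +ℚ 1ℚ) +ℚ (α +ℚ 1ℚ) → ∀ N → expSum q N ≤ℚ ι c) → Claim
      -- Origin of 2 c + 7: the exponent exceeds 2 α by 2 / ℓ, which costs 2 c / ℓ; the error 3 m²
      -- of `upper-bound` enters twice; and one more m² pays for x + 1 in place of x.
      with-bound (c , bounded) = with-ℓ (large-natural (ι (2 * c + 7)) δ 0<δ)
        where
        with-ℓ : (∃ λ N → ∀ i → N ≤ i → ι (2 * c + 7) ≤ℚ ι i *ℚ δ) → Claim
        with-ℓ (ℓ′ , ℓ-big) = with-upper (upper-bound ℓ (s≤s z≤n))
          where
          ℓ = suc ℓ′
          u = inv ℓ
          0≤u = 0≤inv ℓ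
          u-small : ι (2 * c + 7) *ℚ u ≤ℚ δ
          u-small = ÷-≤⇒ {ℓ} {ι (2 * c + 7)} (s≤s z≤n) (ℚ.≤-trans (ℓ-big ℓ (n≤1+n ℓ′)) (ℚ.≤-reflexive (ℚ.*-comm (ι ℓ) δ)))
          with-upper : (∃ λ M₀ → ∀ m → 1 ≤ m → M₀ ≤ m → ∃ λ w → m + suc w ≤ 2 ^ K * m × harmonic m w ≤ℚ α +ℚ inv ℓ ×
                         n m * ℓ ≤ sum (interval m (suc w)) * ℓ + 3 * (m * m)) → Claim
          with-upper (M₀ , bound) = M₀ + 2 * 2 ^ K * ℓ , λ m 1≤m M≤m →
              let w , X≤ , h≤ , nℓ≤ = bound m 1≤m (≤-trans (m≤m+n M₀ _) M≤m)
              in suc (w + w) , conclude m 1≤m (≤-trans (m≤n+m _ M₀) M≤m) w X≤ h≤ nℓ≤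
            where
            conclude : ∀ m → 1 ≤ m → 2 * 2 ^ K * ℓ ≤ m → ∀ w → m + suc w ≤ 2 ^ K * m → harmonic m w ≤ℚ α +ℚ u →
              n m * ℓ ≤ sum (interval m (suc w)) * ℓ + 3 * (m * m) → ∀ N → suc (w + w) ≤ N →
              ι (2 * n m) +ℚ ι (m * m) ≤ℚ ι (m * m) *ℚ E N +ℚ δ *ℚ ι (m * m)
            conclude m 1≤m m-big w X≤ h≤ nℓ≤ N N₀≤N = ℚ.≤-trans divided
              (ℚ.≤-trans (ℚ.+-monoˡ-≤ (ι (7 * (m * m)) *ℚ u) squares) (ℚ.≤-trans (ℚ.≤-reflexive collect)
                (ℚ.+-monoʳ-≤ (ι mm *ℚ E N) (*ℚ-monoʳ (0≤ι mm) u-small))))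
              where
              x = m + w
              mm = m * m
              Σ = sum (interval m (suc w))
              counted : (2 * n m + mm) * ℓ ≤ x * x * ℓ + 7 * mm
              counted = begin
                (2 * n m + mm) * ℓ                              ≡⟨ lem₁ (n m) mm ℓ ⟩
                2 * (n m * ℓ) + mm * ℓ                          ≤⟨ +-monoˡ-≤ (mm * ℓ) (*-monoʳ-≤ 2 nℓ≤) ⟩
                2 * (Σ * ℓ + 3 * mm) + mm * ℓ                   ≡⟨ lem₂ Σ ℓ mm ⟩
                (2 * Σ + mm) * ℓ + 6 * mm                       ≤⟨ +-monoˡ-≤ (6 * mm) (*-monoˡ-≤ ℓ (twice-sum-≤ m (suc w))) ⟩
                (m + suc w) * (m + suc w) * ℓ + 6 * mm          ≡⟨ cong (λ z → z * z * ℓ + 6 * mm) (+-suc m w) ⟩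
                suc x * suc x * ℓ + 6 * mm                      ≡⟨ lem₃ x ℓ mm ⟩
                x * x * ℓ + (x + suc x) * ℓ + 6 * mm            ≤⟨ +-monoˡ-≤ (6 * mm) (+-monoʳ-≤ (x * x * ℓ) cross-term) ⟩
                x * x * ℓ + mm + 6 * mm                         ≡⟨ +-assoc (x * x * ℓ) mm (6 * mm) ⟩
                x * x * ℓ + 7 * mm                              ∎
                where
                open ≤-Reasoning
                X≤′ : suc x ≤ 2 ^ K * m
                X≤′ = subst (_≤ 2 ^ K * m) (+-suc m w) X≤
                cross-term : (x + suc x) * ℓ ≤ mm
                cross-term = ≤-trans (*-monoˡ-≤ ℓ (+-mono-≤ (≤-trans (n≤1+n x) X≤′) X≤′)) (≤-trans (≤-reflexive (lem₄ (2 ^ K) m ℓ)) (*-monoˡ-≤ m m-big))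
                  where
                  lem₄ : ∀ y m l → (y * m + y * m) * l ≡ 2 * y * l * m
                  lem₄ = solve-∀
                lem₁ : ∀ n m l → (2 * n + m) * l ≡ 2 * (n * l) + m * l
                lem₁ = solve-∀
                lem₂ : ∀ s l m → 2 * (s * l + 3 * m) + m * l ≡ (2 * s + m) * l + 6 * m
                lem₂ = solve-∀
                lem₃ : ∀ x l m → suc x * suc x * l + 6 * m ≡ x * x * l + (x + suc x) * l + 6 * m
                lem₃ = solve-∀
              divided : ι (2 * n m) +ℚ ι mm ≤ℚ ι (x * x) +ℚ ι (7 * mm) *ℚ u
              divided = *ℚ-cancelʳ-≤ (0<ι {ℓ} (s≤s z≤n)) (subst₂ _≤ℚ_
                (trans (ι-* (2 * n m + mm) ℓ) (cong (_*ℚ ι ℓ) (ι-+ (2 * n m) mm)))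
                (trans (ι-+ (x * x * ℓ) (7 * mm)) (trans (cong₂ _+ℚ_ (ι-* (x * x) ℓ) (sym (÷-cancel {ℓ} (ι (7 * mm)) (s≤s z≤n))))
                  (sym (ℚ.*-distribʳ-+ (ι ℓ) (ι (x * x)) (ι (7 * mm) *ℚ u)))))
                (ι-mono-≤ counted))
              β+ = (u +ℚ u) +ℚ (α +ℚ α)
              0≤2α = 0≤+ℚ 0≤α 0≤α
              β+≤ : β+ ≤ℚ (α +ℚ 1ℚ) +ℚ (α +ℚ 1ℚ)
              β+≤ = ℚ.≤-trans (ℚ.+-monoˡ-≤ (α +ℚ α) (ℚ.+-mono-≤ (invℓ≤1 {ℓ} (s≤s z≤n)) (invℓ≤1 {ℓ} (s≤s z≤n))))
                (ℚ.≤-reflexive (solve 1 (λ a → con 1ℚ :+ con 1ℚ :+ (a :+ a) := a :+ con 1ℚ :+ (a :+ con 1ℚ)) refl α))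
              E-near : expSum (harmonic m w +ℚ harmonic m w) (suc (w + w)) ≤ℚ E N +ℚ (u +ℚ u) *ℚ ι c
              E-near = ℚ.≤-trans (expSum-≤ (0≤+ℚ (0≤harmonic m w) (0≤harmonic m w)) N₀≤N)
                (ℚ.≤-trans (expSum-mono (0≤+ℚ (0≤harmonic m w) (0≤harmonic m w)) (ℚ.≤-trans (ℚ.+-mono-≤ h≤ h≤)
                    (ℚ.≤-reflexive (solve 2 (λ a u → a :+ u :+ (a :+ u) := u :+ u :+ (a :+ a)) refl α u))) N)
                (ℚ.≤-trans (expSum-upper (0≤+ℚ 0≤u 0≤u) 0≤2α N)
                  (ℚ.+-monoʳ-≤ (E N) (*ℚ-monoˡ (0≤+ℚ 0≤u 0≤u) (bounded β+ (0≤+ℚ (0≤+ℚ 0≤u 0≤u) 0≤2α) β+≤ N)))))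
              squares : ι (x * x) ≤ℚ ι mm *ℚ (E N +ℚ (u +ℚ u) *ℚ ι c)
              squares = ℚ.≤-trans (ℚ.≤-reflexive (ι-* x x)) (ℚ.≤-trans (expSum-harmonic-lower m 1≤m w)
                (ℚ.≤-trans (ℚ.≤-reflexive (cong (_*ℚ expSum (harmonic m w +ℚ harmonic m w) (suc (w + w))) (sym (ι-* m m)))) (*ℚ-monoˡ (0≤ι mm) E-near)))
              collect : ι mm *ℚ (E N +ℚ (u +ℚ u) *ℚ ι c) +ℚ ι (7 * mm) *ℚ u ≡ ι mm *ℚ E N +ℚ ι (2 * c + 7) *ℚ u *ℚ ι mm
              collect = trans (cong (λ z → ι mm *ℚ (E N +ℚ (u +ℚ u) *ℚ ι c) +ℚ z *ℚ u) (ι-* 7 mm))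
                (trans (solve 5 (λ m e u c s → m :* (e :+ (u :+ u) :* c) :+ s :* m :* u := m :* e :+ (c :+ c :+ s) :* u :* m) refl (ι mm) (E N) u (ι c) (ι 7))
                  (cong (λ z → ι mm *ℚ E N +ℚ z *ℚ u *ℚ ι mm) (sym (trans (ι-+ (2 * c) 7) (cong (_+ℚ ι 7) (trans (cong (λ z → ι (c + z)) (+-identityʳ c)) (ι-+ c c)))))))

    lower-estimate : ∀ δ → 0ℚ <ℚ δ → ∃ λ M → ∀ m → M ≤ m → ∀ N →
      ι (m * m) *ℚ E N ≤ℚ ι (2 * n m) +ℚ ι (m * m) +ℚ δ *ℚ ι (m * m)
    lower-estimate δ 0<δ = with-bound exp-bounded
      where
      Claim : Set
      Claim = ∃ λ M → ∀ m → M ≤ m → ∀ N → ι (m * m) *ℚ E N ≤ℚ ι (2 * n m) +ℚ ι (m * m) +ℚ δ *ℚ ι (m * m)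
      with-bound : (∃ λ c → ∀ q → 0ℚ ≤ℚ q → q ≤ℚ (α +ℚ 1ℚ) +ℚ (α +ℚ 1ℚ) → ∀ N → expSum q N ≤ℚ ι c) → Claim
      with-bound (c , bounded) = with-M (large-natural (ι (2 ^ K + 2 * c)) δ 0<δ)
        where
        conclude : ∀ m₁ → 1 ≤ m₁ → ι (2 ^ K + 2 * c) ≤ℚ ι (suc m₁) *ℚ δ → ∀ w → suc m₁ + suc w ≤ 2 ^ K * suc m₁ →
          α ≤ℚ harmonic (suc m₁) (suc w) → sum (interval (suc m₁) w) ≤ n (suc m₁) → ∀ N →
          ι (suc m₁ * suc m₁) *ℚ E N ≤ℚ ι (2 * n (suc m₁)) +ℚ ι (suc m₁ * suc m₁) +ℚ δ *ℚ ι (suc m₁ * suc m₁)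
        conclude m₁ 1≤m₁ m-big w X≤ α≤ Σ≤ N = ℚ.≤-trans (*ℚ-monoʳ 0≤E (ι-mono-≤ squares)) (ℚ.≤-trans (ℚ.≤-reflexive (trans (cong (_*ℚ E N) (ι-+ (m₁ * m₁) (2 * m)))
              (ℚ.*-distribʳ-+ (E N) (ι (m₁ * m₁)) (ι (2 * m)))))
            (ℚ.≤-trans (ℚ.+-mono-≤ main (*ℚ-monoˡ (0≤ι (2 * m)) E≤c)) (ℚ.≤-trans (ℚ.≤-reflexive collect)
              (ℚ.+-monoʳ-≤ (ι (2 * n m) +ℚ ι mm) (ℚ.≤-trans (*ℚ-monoʳ (0≤ι m) m-big) (ℚ.≤-reflexive (trans
                (solve 2 (λ m d → m :* d :* m := d :* (m :* m)) refl (ι m) δ) (cong (δ *ℚ_) (sym (ι-* m m))))))))))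
          where
          m = suc m₁
          mm = m * m
          0≤2α = 0≤+ℚ 0≤α 0≤α
          0≤E : 0ℚ ≤ℚ E N
          0≤E = 0≤expSum 0≤2α N
          E≤c : E N ≤ℚ ι c
          E≤c = bounded (α +ℚ α) 0≤2α (ℚ.+-mono-≤ α≤α+1 α≤α+1) N
            where
            α≤α+1 : α ≤ℚ α +ℚ 1ℚ
            α≤α+1 = ≤-by 1ℚ 0≤1ℚ refl
          -- `expSum-harmonic-upper` yields the square of the predecessor of m; the difference is
          -- linear in m and is absorbed by δ m².
          squares : mm ≤ m₁ * m₁ + 2 * m
          squares = ≤-trans (n≤1+n mm) (≤-reflexive (lem m₁))
            where
            lem : ∀ a → suc (suc a * suc a) ≡ a * a + 2 * suc a
            lem = solve-∀
          X = m + w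
          X² : X * X ≡ 2 * sum (interval m w) + mm + w
          X² = sym (+-cancelʳ-≡ m _ _ (sum-interval m w))
          main : ι (m₁ * m₁) *ℚ E N ≤ℚ ι (2 * n m) +ℚ ι mm +ℚ ι (2 ^ K * m)
          main = ℚ.≤-trans (ℚ.≤-reflexive (trans (ℚ.*-comm (ι (m₁ * m₁)) (E N)) (cong (E N *ℚ_) (ι-* m₁ m₁))))
            (ℚ.≤-trans (*ℚ-monoʳ (0≤*ℚ (0≤ι m₁) (0≤ι m₁)) (expSum-mono 0≤2α (ℚ.+-mono-≤ α≤ α≤) N))
            (ℚ.≤-trans (expSum-harmonic-upper m₁ 1≤m₁ (suc w) N)
            (ℚ.≤-trans (ℚ.≤-reflexive (trans (cong (λ z → ι z *ℚ ι z) (+-suc m₁ w)) (trans (sym (ι-* X X)) (cong ι X²))))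
            (ℚ.≤-trans (ι-mono-≤ (+-mono-≤ (+-monoˡ-≤ mm (*-monoʳ-≤ 2 Σ≤)) w≤)) (ℚ.≤-reflexive (trans (ι-+ (2 * n m + mm) (2 ^ K * m)) (cong (_+ℚ ι (2 ^ K * m)) (ι-+ (2 * n m) mm))))))))
            where
            w≤ : w ≤ 2 ^ K * m
            w≤ = ≤-trans (≤-trans (n≤1+n w) (m≤n+m (suc w) m)) X≤
          collect : ι (2 * n m) +ℚ ι mm +ℚ ι (2 ^ K * m) +ℚ ι (2 * m) *ℚ ι c ≡ ι (2 * n m) +ℚ ι mm +ℚ ι (2 ^ K + 2 * c) *ℚ ι m
          collect = trans (ℚ.+-assoc (ι (2 * n m) +ℚ ι mm) (ι (2 ^ K * m)) _) (cong (ι (2 * n m) +ℚ ι mm +ℚ_)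
            (trans (cong (ι (2 ^ K * m) +ℚ_) (sym (ι-* (2 * m) c))) (trans (sym (ι-+ (2 ^ K * m) (2 * m * c))) (trans (cong ι (lem (2 ^ K) m c)) (ι-* (2 ^ K + 2 * c) m)))))
            where
            lem : ∀ y m c → y * m + 2 * m * c ≡ (y + 2 * c) * m
            lem = solve-∀
        with-M : (∃ λ N → ∀ i → N ≤ i → ι (2 ^ K + 2 * c) ≤ℚ ι i *ℚ δ) → Claim
        with-M (M , big) = M + 2 , go
          where
          go : ∀ m → M + 2 ≤ m → ∀ N → ι (m * m) *ℚ E N ≤ℚ ι (2 * n m) +ℚ ι (m * m) +ℚ δ *ℚ ι (m * m)
          go zero          h = λ _ → ⊥-elim (<⇒≱ (s≤s z≤n) (m+n≤o⇒n≤o M h))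
          go (suc zero)    h = λ _ → ⊥-elim (<⇒≱ (s≤s (s≤s z≤n)) (m+n≤o⇒n≤o M h))
          go (suc (suc m)) h = let w , X≤ , α≤ , Σ≤ = lower-bound (suc (suc m)) (s≤s z≤n)
                               in conclude (suc m) (s≤s z≤n) (big (suc (suc m)) (m+n≤o⇒m≤o M h)) w X≤ α≤ Σ≤

  -- N₀ may depend on m, because the upper estimate needs a truncation beyond 2 w. This is harmless:
  -- the limit in the truncation index is taken for each real number `o m` separately, with a
  -- precision δ that does not depend on it.
  TwoSided : ℚ → (ℕ → ℕ) → Set
  TwoSided α n = ∀ δ → 0ℚ <ℚ δ → ∃ λ M → ∀ m → M ≤ m → ∃ λ N₀ → ∀ N → N₀ ≤ N →
    ι (2 * n m) +ℚ ι (m * m) ≤ℚ ι (m * m) *ℚ expSum (α +ℚ α) N +ℚ δ *ℚ ι (m * m) ×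
    ι (m * m) *ℚ expSum (α +ℚ α) N ≤ℚ ι (2 * n m) +ℚ ι (m * m) +ℚ δ *ℚ ι (m * m)

  module Limit (α : ℚ) (0<α : 0ℚ <ℚ α) (n : ℕ → ℕ)
    (estimate : TwoSided α n) where

    β : ℚ
    β = + 2 /ℚ 1 *ℚ α

    two : + 2 /ℚ 1 ≡ 1ℚ +ℚ 1ℚ
    two = trans (sym (ι≡natℚ 2)) (trans (ι-+ 1 1) (cong₂ _+ℚ_ ι-1 ι-1))

    β≡ : β ≡ α +ℚ α
    β≡ = trans (cong (_*ℚ α) two) (solve 1 (λ a → (con 1ℚ :+ con 1ℚ) :* a := a :+ a) refl α)

    0<β : 0ℚ <ℚ β
    0<β = subst (0ℚ <ℚ_) (sym β≡) (subst (_<ℚ α +ℚ α) (ℚ.+-identityˡ 0ℚ) (ℚ.+-mono-< 0<α 0<α))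

    -- The index is raised to 2 so that every approximation of e^β - 1 is positive.
    D : ℕ → ℚ
    D i = expSum β (2 ⊔ i) -ℚ 1ℚ

    β≤D : ∀ i → β ≤ℚ D i
    β≤D i = ℚ.≤-trans (≤-by ((expSum β 2) -ℚ (1ℚ +ℚ β)) (≤⇒0≤-ℚ start) (solve 2 (λ e b → e :- con 1ℚ := b :+ (e :- (con 1ℚ :+ b))) refl (expSum β 2) β))
      (ℚ.+-monoˡ-≤ (-ℚ 1ℚ) (expSum-≤ (ℚ.<⇒≤ 0<β) (m≤m⊔n 2 i)))
      where
      start : 1ℚ +ℚ β ≤ℚ expSum β 2
      start = subst₂ _≤ℚ_ (trans (cong ((1ℚ +ℚ β) *ℚ_) (expSum-1 0ℚ)) (ℚ.*-identityʳ (1ℚ +ℚ β))) (cong (λ z → expSum z 2) (ℚ.+-identityʳ β))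
        (expSum-lower {β} {0ℚ} (ℚ.<⇒≤ 0<β) ℚ.≤-refl 1)

    0<D : ∀ i → 0ℚ <ℚ D i
    0<D i = ℚ.<-≤-trans 0<β (β≤D i)

    -- Approximations of 1 / (e^β - 1), inverted index by index. By `β≤D` they are bounded by B = 1
    -- / β uniformly, which gives the Cauchy property.
    r : ℕ → ℚ
    r i = proj₁ (divide (0<D i) 0<1ℚ)

    0<r : ∀ i → 0ℚ <ℚ r i
    0<r i = proj₁ (proj₂ (divide (0<D i) 0<1ℚ))

    D*r : ∀ i → D i *ℚ r i ≡ 1ℚ
    D*r i = proj₂ (proj₂ (divide (0<D i) 0<1ℚ))

    B : ℚ
    B = proj₁ (divide 0<β 0<1ℚ)

    0<B : 0ℚ <ℚ B
    0<B = proj₁ (proj₂ (divide 0<β 0<1ℚ))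

    r≤B : ∀ i → r i ≤ℚ B
    r≤B i = *ℚ-cancelˡ-≤ 0<β (ℚ.≤-trans (*ℚ-monoʳ (ℚ.<⇒≤ (0<r i)) (β≤D i))
      (ℚ.≤-reflexive (trans (D*r i) (sym (proj₂ (proj₂ (divide 0<β 0<1ℚ)))))))

    r-cauchy : IsCauchy r
    r-cauchy ε 0<ε =
      let η , 0<η , BBη = divide (0<*ℚ 0<B 0<B) 0<ε
          N , h = cauchy (exp β) η 0<η
      in N , λ i j N≤i N≤j → subst (∣ r i -ℚ r j ∣ℚ ≤ℚ_) BBη (subst (λ z → ∣ z ∣ℚ ≤ℚ B *ℚ B *ℚ η) (sym (difference i j))
        (∣*∣≤ (r i *ℚ r j) (D j -ℚ D i) (0<*ℚ 0<B 0<B)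
          (subst (_≤ℚ B *ℚ B) (sym (ℚ.0≤p⇒∣p∣≡p (0≤*ℚ (ℚ.<⇒≤ (0<r i)) (ℚ.<⇒≤ (0<r j))))) (*ℚ-mono (ℚ.<⇒≤ (0<r i)) (r≤B i) (ℚ.<⇒≤ (0<r j)) (r≤B j)))
          (subst (λ z → ∣ z ∣ℚ ≤ℚ η) (solve 2 (λ a b → a :- b := (a :- con 1ℚ) :- (b :- con 1ℚ)) refl (expSum β (2 ⊔ j)) (expSum β (2 ⊔ i)))
            (h (2 ⊔ j) (2 ⊔ i) (≤-trans N≤j (m≤n⊔m 2 j)) (≤-trans N≤i (m≤n⊔m 2 i))))))
      where
      difference : ∀ i j → r i -ℚ r j ≡ r i *ℚ r j *ℚ (D j -ℚ D i)
      difference i j = sym (trans (solve 4 (λ a b x y → a :* b :* (y :- x) := a :* (y :* b) :- b :* (x :* a)) refl (r i) (r j) (D i) (D j))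
        (trans (cong₂ (λ y z → r i *ℚ y -ℚ r j *ℚ z) (D*r j) (D*r i)) (cong₂ _-ℚ_ (ℚ.*-identityʳ (r i)) (ℚ.*-identityʳ (r j)))))

    -- The claimed equation solved for the error term, so the equation is automatic and all the
    -- content lies in the convergence to 0.
    o : ℕ → ℝ
    o m = fromℚ (ι (n m) *ℚ inv (m * m)) *ℝ mkℝ r r-cauchy -ℝ fromℚ ½

    ½+½ : ½ +ℚ ½ ≡ 1ℚ
    ½+½ = refl

    o-small : ∀ m → 1 ≤ m → ∀ δ ε i → 0ℚ <ℚ δ → B *ℚ δ ≡ ε →
      ι (2 * n m) +ℚ ι (m * m) ≤ℚ ι (m * m) *ℚ expSum β (2 ⊔ i) +ℚ δ *ℚ ι (m * m) →
      ι (m * m) *ℚ expSum β (2 ⊔ i) ≤ℚ ι (2 * n m) +ℚ ι (m * m) +ℚ δ *ℚ ι (m * m) →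
      ∣ approx (o m) i ∣ℚ ≤ℚ ε
    o-small m 1≤m δ ε i 0<δ Bδ up down = subst (λ z → ∣ z ∣ℚ ≤ℚ ε) (sym shape)
        (ℚ.≤-trans (∣*∣≤ (½ *ℚ (r i *ℚ v)) (ι (2 * n m) -ℚ μ *ℚ D i) {½ *ℚ (r i *ℚ v)} {δ *ℚ μ} 0<κ (ℚ.≤-reflexive (ℚ.0≤p⇒∣p∣≡p (ℚ.<⇒≤ 0<κ)))
          (∣∣-≤ (≤-by (μ *ℚ e +ℚ δ *ℚ μ -ℚ (ι (2 * n m) +ℚ μ)) (≤⇒0≤-ℚ up)
                   (solve 4 (λ t u e d → d :* u := (t :- u :* (e :- con 1ℚ)) :+ (u :* e :+ d :* u :- (t :+ u))) refl (ι (2 * n m)) μ e δ))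
                 (≤-by (ι (2 * n m) +ℚ μ +ℚ δ *ℚ μ -ℚ μ *ℚ e) (≤⇒0≤-ℚ down)
                   (solve 4 (λ t u e d → d :* u := :- (t :- u :* (e :- con 1ℚ)) :+ (t :+ u :+ d :* u :- u :* e)) refl (ι (2 * n m)) μ e δ))))
        bound)
      where
      μ = ι (m * m)
      v = inv (m * m)
      e = expSum β (2 ⊔ i)
      1≤mm = *-mono-≤ 1≤m 1≤m
      0<½ : 0ℚ <ℚ ½
      0<½ = ℚ.positive⁻¹ ½
      0<κ : 0ℚ <ℚ ½ *ℚ (r i *ℚ v)
      0<κ = 0<*ℚ 0<½ (0<*ℚ (0<r i) (inv>0 1≤mm))
      2n : ι (2 * n m) ≡ ι (n m) +ℚ ι (n m)
      2n = trans (cong (λ z → ι (n m + z)) (+-identityʳ (n m))) (ι-+ (n m) (n m))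
      -- This form exhibits 2 n - m² D, the quantity that the two-sided estimate bounds by δ m².
      shape : approx (o m) i ≡ ½ *ℚ (r i *ℚ v) *ℚ (ι (2 * n m) -ℚ μ *ℚ D i)
      shape = sym (trans (cong (λ z → ½ *ℚ (r i *ℚ v) *ℚ (z -ℚ μ *ℚ D i)) 2n)
        (trans (solve 6 (λ h r v t u d → h :* (r :* v) :* (t :+ t :- u :* d) := (h :+ h) :* (t :* v :* r) :- h :* (u :* v) :* (d :* r)) refl ½ (r i) v (ι (n m)) μ (D i))
        (trans (cong₂ (λ a b → (½ +ℚ ½) *ℚ (ι (n m) *ℚ v *ℚ r i) -ℚ ½ *ℚ a *ℚ b) (ι-inv 1≤mm) (D*r i))
          (trans (cong (λ z → z *ℚ (ι (n m) *ℚ v *ℚ r i) -ℚ ½ *ℚ 1ℚ *ℚ 1ℚ) ½+½)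
            (solve 1 (λ x → con 1ℚ :* x :- con ½ :* con 1ℚ :* con 1ℚ := x :- con ½) refl (ι (n m) *ℚ v *ℚ r i))))))
      bound : ½ *ℚ (r i *ℚ v) *ℚ (δ *ℚ μ) ≤ℚ ε
      bound = ℚ.≤-trans (ℚ.≤-reflexive (trans (solve 5 (λ h r v d u → h :* (r :* v) :* (d :* u) := h :* (r :* d) :* (u :* v)) refl ½ (r i) v δ μ)
          (trans (cong (½ *ℚ (r i *ℚ δ) *ℚ_) (ι-inv 1≤mm)) (ℚ.*-identityʳ (½ *ℚ (r i *ℚ δ))))))
        (ℚ.≤-trans (≤-by (½ *ℚ (r i *ℚ δ)) (0≤*ℚ (ℚ.<⇒≤ 0<½) 0≤rδ) (sym (trans (sym (ℚ.*-distribʳ-+ (r i *ℚ δ) ½ ½)) (trans (cong (_*ℚ (r i *ℚ δ)) ½+½) (ℚ.*-identityˡ (r i *ℚ δ))))))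
          (ℚ.≤-trans (*ℚ-monoʳ (ℚ.<⇒≤ 0<δ) (r≤B i)) (ℚ.≤-reflexive Bδ)))
        where
        0≤rδ = 0≤*ℚ (ℚ.<⇒≤ (0<r i)) (ℚ.<⇒≤ 0<δ)

    o⟶0 : o ⟶ 0ℝ
    o⟶0 ε 0<ε =
      let δ , 0<δ , Bδ = divide 0<B 0<ε
          M , h = estimate δ 0<δ
      in M + 1 , λ m M≤m ε′ 0<ε′ →
         let N₀ , k = h m (≤-trans (m≤m+n M 1) M≤m)
         in N₀ , λ i N₀≤i →
            let up , down = k (2 ⊔ i) (≤-trans N₀≤i (m≤n⊔m 2 i))
            in ℚ.≤-trans (subst (λ z → ∣ z ∣ℚ ≤ℚ ε) (sym (trans (cong (approx (o m) i +ℚ_) refl) (ℚ.+-identityʳ (approx (o m) i))))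
                 (o-small m (≤-trans (m≤n+m 1 M) M≤m) δ ε i 0<δ Bδ
                   (subst (λ b → ι (2 * n m) +ℚ ι (m * m) ≤ℚ ι (m * m) *ℚ expSum b (2 ⊔ i) +ℚ δ *ℚ ι (m * m)) (sym β≡) up)
                   (subst (λ b → ι (m * m) *ℚ expSum b (2 ⊔ i) ≤ℚ ι (2 * n m) +ℚ ι (m * m) +ℚ δ *ℚ ι (m * m)) (sym β≡) down)))
               (≤-by ε′ (ℚ.<⇒≤ 0<ε′) refl)

    o-equation : ∀ m → 1 ≤ m → fromℕ (n m) ≃ℝ (fromℚ ½ +ℝ o m) *ℝ (exp β -ℝ 1ℝ) *ℝ fromℕ (m ^ 2)
    -- From index 2 on the maximum in `D` is the index itself, and the approximations of the two
    -- sides coincide exactly.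
    o-equation m 1≤m ε 0<ε = 2 , λ i 2≤i → subst (λ z → ∣ z ∣ℚ ≤ℚ ε) (sym (zero-difference i 2≤i)) (ℚ.<⇒≤ 0<ε)
      where
      1≤mm = *-mono-≤ 1≤m 1≤m
      zero-difference : ∀ i → 2 ≤ i → approx (fromℕ (n m)) i -ℚ approx ((fromℚ ½ +ℝ o m) *ℝ (exp β -ℝ 1ℝ) *ℝ fromℕ (m ^ 2)) i ≡ 0ℚ
      zero-difference i 2≤i = trans (cong₂ _-ℚ_ (sym (ι≡natℚ (n m))) value) (ℚ.+-inverseʳ (ι (n m)))
        where
        c = ι (n m) *ℚ inv (m * m)
        value : (½ +ℚ (c *ℚ r i -ℚ ½)) *ℚ (expSum β i -ℚ 1ℚ) *ℚ (+ (m ^ 2) /ℚ 1) ≡ ι (n m)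
        value = trans (cong₂ (λ a b → (½ +ℚ (c *ℚ r i -ℚ ½)) *ℚ (expSum β a -ℚ 1ℚ) *ℚ b) (sym (m≤n⇒m⊔n≡n 2≤i)) (trans (sym (ι≡natℚ (m ^ 2))) (cong (λ z → ι (m * z)) (*-identityʳ m))))
          (trans (solve 6 (λ h t v r d u → (h :+ (t :* v :* r :- h)) :* d :* u := t :* (u :* v) :* (d :* r)) refl ½ (ι (n m)) (inv (m * m)) (r i) (D i) (ι (m * m)))
          (trans (cong₂ (λ a b → ι (n m) *ℚ a *ℚ b) (ι-inv 1≤mm) (D*r i)) (trans (ℚ.*-identityʳ (ι (n m) *ℚ 1ℚ)) (ℚ.*-identityʳ (ι (n m))))))

  two-sided : ∀ α → 0ℚ <ℚ α → (n : ℕ → ℕ) → (∀ m → 1 ≤ m → IsThreshold α m (n m)) → TwoSided α n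
  two-sided α 0<α n threshold = with-fraction (positive-fraction 0<α)
    where
    with-K : ∀ a₀ b₀ → 1 ≤ a₀ → 1 ≤ b₀ → α is a₀ ÷ b₀ → (∃ λ K → α +ℚ 1ℚ ≤ℚ ι K *ℚ inv 2) → TwoSided α n
    with-K a₀ b₀ 1≤a₀ 1≤b₀ α≡ (K , α+1≤) δ 0<δ = combine (upper-estimate δ 0<δ) (lower-estimate δ 0<δ)
      where
      open Estimate α a₀ b₀ 1≤a₀ 1≤b₀ α≡ K α+1≤ n threshold
      combine : (∃ λ M → ∀ m → 1 ≤ m → M ≤ m → ∃ λ N₀ → ∀ N → N₀ ≤ N →
                   ι (2 * n m) +ℚ ι (m * m) ≤ℚ ι (m * m) *ℚ E N +ℚ δ *ℚ ι (m * m)) →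
                (∃ λ M → ∀ m → M ≤ m → ∀ N → ι (m * m) *ℚ E N ≤ℚ ι (2 * n m) +ℚ ι (m * m) +ℚ δ *ℚ ι (m * m)) → _
      combine (M₁ , up) (M₂ , down) = 1 + (M₁ + M₂) , λ m M≤m →
        let N₀ , h = up m (m+n≤o⇒m≤o 1 M≤m) (m+n≤o⇒m≤o M₁ (m+n≤o⇒n≤o 1 M≤m))
        in N₀ , λ N N₀≤N → h N N₀≤N , down m (m+n≤o⇒n≤o M₁ (m+n≤o⇒n≤o 1 M≤m)) N
    with-fraction : (∃ λ a → ∃ λ b → 1 ≤ a × 1 ≤ b × α *ℚ ι b ≡ ι a) → TwoSided α n
    with-fraction (a₀ , b₀ , 1≤a₀ , 1≤b₀ , eq) =
      with-K a₀ b₀ 1≤a₀ 1≤b₀ (cleared eq) (2 + 2 * a₀ , α+1≤half {α} 1≤b₀ (cleared eq))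

  asymptotics : (α : ℚ) → 0ℚ <ℚ α → (n : ℕ → ℕ) → (∀ m → 1 ≤ m → IsThreshold α m (n m)) →
    ∃ λ (o : ℕ → ℝ) → (o ⟶ 0ℝ) ×
      (∀ m → 1 ≤ m → fromℕ (n m) ≃ℝ (fromℚ ½ +ℝ o m) *ℝ (exp ((+ 2 /ℚ 1) *ℚ α) -ℝ 1ℝ) *ℝ fromℕ (m ^ 2))
  asymptotics α 0<α n threshold = o , o⟶0 , o-equation
    where
    open Limit α 0<α n (two-sided α 0<α n threshold)

open Limits using (asymptotics)
open import Data.Integer.Base using (+_)
open import Data.Nat.Base as ℕ using (ℕ)
open import Data.Product.Base using (∃; _×_)
open import Data.Rational.Base using (ℚ; 0ℚ; ½; _<_; _*_; _/_)

theorem3 : (α : ℚ) → 0ℚ < α →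
    (n : ℕ → ℕ) → (∀ m → 1 ℕ.≤ m → IsThreshold α m (n m)) →
    ∃ λ (o : ℕ → ℝ) → (o ⟶ 0ℝ) ×
    (∀ m → 1 ℕ.≤ m →
    fromℕ (n m) ≃ℝ (fromℚ ½ +ℝ o m) *ℝ (exp ((+ 2 / 1) * α) -ℝ 1ℝ) *ℝ fromℕ (m ℕ.^ 2))
theorem3 = asymptotics
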